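{- The proportion of weighted (unrooted) trees of total weight $n$ that are weighted cospectral to another (non-isomorphic) weighted tree approaches $1$ as $n\to\infty$.
   Context: A weighted tree is a finite unrooted tree in which each vertex is assigned a positive integer weight. Its total weight is the sum of the weights of all its vertices. Weighted trees are counted up to weight-preserving isomorphism. For a weighted tree $W$ with adjacency matrix $A(W)$ (a $0/1$ matrix) and vertex weights $w(i)$, let $I^*=I^*(x)$ be the diagonal matrix indexed by the vertices of $W$ whose $ii$-entry is $x^{w(i)}$, with $x$ an indeterminate. The weighted characteristic polynomial of $W$ is $\phi^*(W)=\phi^*(W,x)=\det(I^*(x)-A(W))$. Two weighted trees are weighted cospectral if they have the same weighted characteristic polynomial. -}

module Defs where

open import Algebra.Bundles.Raw using (RawRing)
import Algebra.Definitions.RawMonoid as RawMonoidOps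
import Algebra.Definitions.RawSemiring as RawSemiringOps
open import Data.Bool.Base using (Bool; true; false; if_then_else_)
open import Data.Fin.Base using (Fin; zero; suc; toℕ; fromℕ; inject₁; punchIn)
open import Data.Fin.Properties using (_≟_)
open import Data.Integer.Base as ℤ using (ℤ; +_; 0ℤ; 1ℤ)
open import Data.List.Base using (List; []; _∷_; map)
open import Data.Nat.Base as ℕ using (ℕ; zero; suc; NonZero)
open import Data.Product.Base using (Σ; Σ-syntax; ∃-syntax; _×_; proj₁)
open import Data.Rational.Base as ℚ using (ℚ; 0ℚ)
open import Function.Base using (_∘_)
open import Function.Bundles using (_↔_; module Inverse) renaming (Inverse to SetoidInverse)
open import Function.Construct.Composition using (_↔-∘_)
open import Function.Construct.Identity using (↔-id)
open import Function.Construct.Symmetry using (↔-sym)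
open import Function.Definitions using (Injective)
open import Level using (0ℓ; _⊔_)
open import Relation.Binary.Bundles using (Setoid)
open import Relation.Binary.Construct.Closure.ReflexiveTransitive using (Star)
import Relation.Binary.Construct.On as On
open import Relation.Binary.PropositionalEquality
  using (_≡_; refl; sym; trans; cong; cong₂; setoid)
open import Relation.Nullary.Decidable.Core using (does)
open import Relation.Nullary.Negation.Core using (¬_)

------------------------------------------------------------------------
-- Graphs and trees

record Graph (m : ℕ) : Set where
  field
    adj       : Fin m → Fin m → Bool
    symmetric : ∀ i j → adj i j ≡ adj j i
    loopless  : ∀ i → adj i i ≡ false

  Adjacent : Fin m → Fin m → Set
  Adjacent i j = adj i j ≡ true

module _ {m : ℕ} (G : Graph m) where
  open Graph G

  Connected : Set
  Connected = ∀ i j → Star Adjacent i j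

  -- A cycle of length 3 + k: distinct vertices v₀, …, v₂₊ₖ, with
  -- consecutive ones adjacent and the last one adjacent to the first.
  record Cycle : Set where
    field
      k        : ℕ
      vertex   : Fin (3 ℕ.+ k) → Fin m
      distinct : Injective _≡_ _≡_ vertex
      step     : ∀ (i : Fin (2 ℕ.+ k)) → Adjacent (vertex (inject₁ i)) (vertex (suc i))
      close    : Adjacent (vertex (fromℕ (2 ℕ.+ k))) (vertex zero)

  record IsTree : Set where
    field
      nonempty  : 1 ℕ.≤ m
      connected : Connected
      acyclic   : ¬ Cycle

------------------------------------------------------------------------
-- Weighted trees and weight-preserving isomorphism

record WeightedTree : Set where
  field
    order    : ℕ
    graph    : Graph order
    isTree   : IsTree graph
    weight   : Fin order → ℕ
    positive : ∀ i → 1 ℕ.≤ weight i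

  open Graph graph public using (adj)

  totalWeight : ℕ
  totalWeight = RawMonoidOps.sum ℕ.+-0-rawMonoid weight

open WeightedTree public using (totalWeight)

infix 4 _≅_ _≇_

record _≅_ (V W : WeightedTree) : Set where
  private
    module V = WeightedTree V
    module W = WeightedTree W
  field
    bijection : Fin V.order ↔ Fin W.order

  open Inverse bijection public using (to; from; strictlyInverseˡ)

  field
    adj-preserving    : ∀ i j → W.adj (to i) (to j) ≡ V.adj i j
    weight-preserving : ∀ i → W.weight (to i) ≡ V.weight i

_≇_ : WeightedTree → WeightedTree → Set
V ≇ W = ¬ (V ≅ W)

≅-refl : ∀ {V} → V ≅ V
≅-refl = record
  { bijection         = ↔-id _
  ; adj-preserving    = λ _ _ → refl
  ; weight-preserving = λ _ → refl
  }

≅-sym : ∀ {V W} → V ≅ W → W ≅ V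
≅-sym {V} {W} f = record
  { bijection         = ↔-sym bijection
  ; adj-preserving    = λ i j → trans
      (sym (adj-preserving (from i) (from j)))
      (cong₂ (WeightedTree.adj W) (strictlyInverseˡ i) (strictlyInverseˡ j))
  ; weight-preserving = λ i → trans
      (sym (weight-preserving (from i)))
      (cong (WeightedTree.weight W) (strictlyInverseˡ i))
  }
  where open _≅_ f

≅-trans : ∀ {U V W} → U ≅ V → V ≅ W → U ≅ W
≅-trans f g = record
  { bijection         = g.bijection ↔-∘ f.bijection
  ; adj-preserving    = λ i j →
      trans (g.adj-preserving (f.to i) (f.to j)) (f.adj-preserving i j)
  ; weight-preserving = λ i →
      trans (g.weight-preserving (f.to i)) (f.weight-preserving i)
  }
  where
  module f = _≅_ f
  module g = _≅_ g

weightedTrees : Setoid 0ℓ 0ℓ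
weightedTrees = record
  { Carrier       = WeightedTree
  ; _≈_           = _≅_
  ; isEquivalence = record { refl = ≅-refl ; sym = ≅-sym ; trans = ≅-trans }
  }

------------------------------------------------------------------------
-- The polynomial ring ℤ[x]: lists of coefficients, constant term first,
-- where trailing zeros are irrelevant

Poly : Set
Poly = List ℤ

coeff : Poly → ℕ → ℤ
coeff []      _       = 0ℤ
coeff (a ∷ p) zero    = a
coeff (a ∷ p) (suc k) = coeff p k

infix  4 _≈ₚ_
infixl 6 _+ₚ_
infixl 7 _*ₚ_

_≈ₚ_ : Poly → Poly → Set
p ≈ₚ q = ∀ k → coeff p k ≡ coeff q k

_+ₚ_ : Poly → Poly → Poly
[]      +ₚ q       = q
(a ∷ p) +ₚ []      = a ∷ p
(a ∷ p) +ₚ (b ∷ q) = (a ℤ.+ b) ∷ (p +ₚ q)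

_*ₚ_ : Poly → Poly → Poly
[]      *ₚ q = []
(a ∷ p) *ₚ q = map (a ℤ.*_) q +ₚ (0ℤ ∷ (p *ₚ q))

ℤ[x] : RawRing 0ℓ 0ℓ
ℤ[x] = record
  { Carrier = Poly
  ; _≈_     = _≈ₚ_
  ; _+_     = _+ₚ_
  ; _*_     = _*ₚ_
  ; -_      = map (ℤ.-_)
  ; 0#      = []
  ; 1#      = 1ℤ ∷ []
  }

x : Poly
x = 0ℤ ∷ 1ℤ ∷ []

------------------------------------------------------------------------
-- Determinants, by cofactor expansion along the first row

module Determinant {c ℓ} (R : RawRing c ℓ) where
  open RawRing R
  open RawSemiringOps rawSemiring using (sum; _^_)

  det : ∀ {m} → (Fin m → Fin m → Carrier) → Carrier
  det {zero}  M = 1#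
  det {suc m} M = sum λ j →
    (- 1#) ^ toℕ j * M zero j * det (λ i k → M (suc i) (punchIn j k))

------------------------------------------------------------------------
-- The weighted characteristic polynomial

module _ (W : WeightedTree) where
  open WeightedTree W
  open RawRing ℤ[x]
  open RawSemiringOps rawSemiring using (_^_)
  open Determinant ℤ[x] using (det)

  adjacencyMatrix : Fin order → Fin order → Poly
  adjacencyMatrix i j = if adj i j then 1# else 0#

  I* : Fin order → Fin order → Poly
  I* i j = if does (i ≟ j) then x ^ weight i else 0#

  φ* : Poly
  φ* = det (λ i j → I* i j + - adjacencyMatrix i j)

WeightedCospectral : WeightedTree → WeightedTree → Set
WeightedCospectral V W = φ* V ≈ₚ φ* W

HasCospectralMate : WeightedTree → Set
HasCospectralMate V = ∃[ W ] WeightedCospectral V W × V ≇ W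

------------------------------------------------------------------------
-- Counting up to an equivalence relation, and proportions

restrict : ∀ {a ℓ p} (S : Setoid a ℓ) → (Setoid.Carrier S → Set p) → Setoid (a ⊔ p) ℓ
restrict S P = On.setoid S (proj₁ {B = P})

-- The number of equivalence classes of S is k.
HasCardinality : ∀ {a ℓ} → Setoid a ℓ → ℕ → Set (a ⊔ ℓ)
HasCardinality S k = SetoidInverse S (setoid (Fin k))

-- Among the (finitely many, at least one) classes of elements of S that
-- satisfy P, the proportion of those that also satisfy Q is r.  (Here P and
-- Q are meant to be invariant under the equivalence of S.)
record IsProportion {a ℓ p q} (S : Setoid a ℓ)
                    (P : Setoid.Carrier S → Set p) (Q : Setoid.Carrier S → Set q)
                    (r : ℚ) : Set (a ⊔ ℓ ⊔ p ⊔ q) where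
  field
    total        : ℕ
    favourable   : ℕ
    ⦃ nonZero ⦄  : NonZero total
    |P|          : HasCardinality (restrict S P) total
    |P∧Q|        : HasCardinality (restrict S (λ s → P s × Q s)) favourable
    ratio        : r ≡ + favourable ℚ./ total

infix 4 _⟶_

_⟶_ : (ℕ → ℚ) → ℚ → Set
r ⟶ l = ∀ ε → 0ℚ ℚ.< ε → ∃[ N ] (∀ n → N ℕ.≤ n → ℚ.∣ r n ℚ.- l ∣ ℚ.< ε)

{-# OPTIONS --safe #-}

-- Let p(T) be the weighted characteristic polynomial of a rooted tree T and q(T) that of T
-- without its root.  Hanging S below the root of T gives p = p(T) p(S) − q(T) q(S) and
-- q = q(T) p(S), so a branch may be replaced by any other branch with the same p and q.  There
-- are two such branches σ and σ′ of weight c = 21 with different numbers of vertices of weight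
-- 7; hence a tree without a cospectral mate contains no branch σ.
--
-- Unordered rooted trees without branch σ correspond to those with all weights at most c: write
-- a weight as r + m c with 1 ≤ r ≤ c and trade m c for m branches σ.  A tree T of weight n with
-- bounded weights contains linearly many disjoint pieces of bounded size, hence at least 2 k,
-- with k linear in n, of one type: either a set of branches at one vertex, or a stretch of a path
-- with the small branches hanging from it.  Replace j₁ of these pieces by a marker that contains
-- a vertex of weight > c, and j₂ of them by another such marker.  As no other vertex has weight
-- > c, expanding the markers recovers T, and j₁, j₂ are read off as numbers of markers.  Counting
-- occurrences of one type, rather than choosing places, makes symmetries of T harmless.
--
-- So if b of the t unrooted trees of weight n have no mate, the k² modifications of each of them
-- give b k² pairs (type, rooted tree of weight n).  With Γ types, and as an unrooted tree of
-- weight n can be rooted in at most n ways, b k² ≤ Γ n t, whence b / t = O(1 / n).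
module Submission where

open import Defs
open import Data.Nat.Base using (ℕ; _≤_)
open import Data.Product.Base using (∃-syntax; _×_)
open import Data.Rational.Base using (ℚ; 1ℚ)
open import Relation.Binary.PropositionalEquality using (_≡_)

open import Algebra.Bundles using (CommutativeRing)
open import Data.Bool.Base using (Bool; true; false; _∧_; if_then_else_)
open import Data.Empty using (⊥; ⊥-elim)
open import Data.Fin.Base using (Fin; zero; suc; toℕ)
open import Data.List.Base using (List; []; _∷_)
open import Data.Nat.Base using (ℕ; zero; suc; pred; _≤_; _<_; s≤s; z≤n; s≤s⁻¹; NonZero; >-nonZero)
open import Data.Product.Base using (_×_; _,_; proj₁; proj₂; ∃-syntax; Σ-syntax)
open import Data.Sum.Base using (_⊎_; inj₁; inj₂)
open import Function.Base using (_∘_)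
open import Function.Bundles using (_↔_; mk↔ₛ′; mk⇔; module Inverse)
open import Relation.Nullary.Decidable using (Dec; yes; no; does; does-⇔; dec-true; dec-false; map′; _×-dec_; ¬?; toWitness)
open import Relation.Nullary.Negation using (¬_; contradiction)

-- The whole proof is an injection; no asymptotic count of trees enters. Forgetting the root costs a
-- factor of up to n. With one sort of marker the k choices, k linear in n, would only balance this
-- loss; the second sort turns them into k² choices and leaves a factor n to spare.
--
-- Bounding the weights serves two purposes: a tree of large weight then has many vertices, hence
-- many pieces, and the weights above c become free to serve as signals. Bundles and threads are
-- both needed, because a star has no long path and a path has no vertex with many branches.
--
-- A piece must have mass at least c + 2. Then a single vertex of the mass of the piece, and a
-- pendant edge of that mass with a leaf of weight 1, both have a root of weight above c, so that
-- either can replace the piece without changing the total weight.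
--
-- The codes need not avoid σ, nor have bounded weights: they are compared with all rooted trees of
-- weight n.

-- Unordered rooted trees, and the expansion of marked children

module RootedTrees where

  open import Data.Nat.Base using (_+_)
  open import Data.Nat.Properties
  open import Data.List.Base using (foldr; map)
  open import Data.Nat.ListAction using (sum)
  open import Relation.Binary.PropositionalEquality

  infixr 5 _◃_ _◃*_
  infix 4 _~_

  -- node k is a single vertex of weight k + 1; s ◃ t is t with s hung below its
  -- root, so the children of the root are listed one at a time.
  data Rooted : Set where
    node : ℕ → Rooted
    _◃_  : Rooted → Rooted → Rooted

  -- Isomorphism of unordered rooted trees, by generators: for a map defined by recursion only
  -- `◃-swap` needs thought. That the generators suffice is `iso⇒~`.
  data _~_ : Rooted → Rooted → Set where
    ~-refl  : ∀ {t} → t ~ t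
    ~-sym   : ∀ {s t} → s ~ t → t ~ s
    ~-trans : ∀ {s t u} → s ~ t → t ~ u → s ~ u
    ◃-cong  : ∀ {s s′ t t′} → s ~ s′ → t ~ t′ → s ◃ t ~ s′ ◃ t′
    ◃-swap  : ∀ s s′ t → s ◃ (s′ ◃ t) ~ s′ ◃ (s ◃ t)

  ~-reflexive : ∀ {s t} → s ≡ t → s ~ t
  ~-reflexive refl = ~-refl

  _◃*_ : List Rooted → Rooted → Rooted
  ss ◃* t = foldr _◃_ t ss

  mass : Rooted → ℕ
  mass (node k) = suc k
  mass (s ◃ t)  = mass t + mass s

  masses : List Rooted → ℕ
  masses ss = sum (map mass ss)

  vertices : (ℕ → ℕ) → Rooted → ℕ
  vertices f (node k) = f k
  vertices f (s ◃ t)  = vertices f s + vertices f t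

  -- Labels are weights minus one, so labels below c are weights of at most c.
  data Bounded (c : ℕ) : Rooted → Set where
    node : ∀ {k} → k < c → Bounded c (node k)
    _◃_  : ∀ {s t} → Bounded c s → Bounded c t → Bounded c (s ◃ t)

  mass>0 : ∀ t → 0 < mass t
  mass>0 (node k) = s≤s z≤n
  mass>0 (s ◃ t)  = <-≤-trans (mass>0 t) (m≤m+n _ _)

  mass-cong : ∀ {s t} → s ~ t → mass s ≡ mass t
  mass-cong ~-refl = refl
  mass-cong (~-sym p) = sym (mass-cong p)
  mass-cong (~-trans p q) = trans (mass-cong p) (mass-cong q)
  mass-cong (◃-cong p q) = cong₂ _+_ (mass-cong q) (mass-cong p)
  mass-cong (◃-swap s s′ t) = begin
    mass t + mass s′ + mass s   ≡⟨ +-assoc (mass t) _ _ ⟩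
    mass t + (mass s′ + mass s) ≡⟨ cong (mass t +_) (+-comm (mass s′) _) ⟩
    mass t + (mass s + mass s′) ≡⟨ +-assoc (mass t) _ _ ⟨
    mass t + mass s + mass s′   ∎
    where open ≡-Reasoning

  vertices-cong : ∀ f {s t} → s ~ t → vertices f s ≡ vertices f t
  vertices-cong f ~-refl = refl
  vertices-cong f (~-sym p) = sym (vertices-cong f p)
  vertices-cong f (~-trans p q) = trans (vertices-cong f p) (vertices-cong f q)
  vertices-cong f (◃-cong p q) = cong₂ _+_ (vertices-cong f p) (vertices-cong f q)
  vertices-cong f (◃-swap s s′ t) = begin
    a + (b + c) ≡⟨ +-assoc a b c ⟨
    a + b + c   ≡⟨ cong (_+ c) (+-comm a b) ⟩
    b + a + c   ≡⟨ +-assoc b a c ⟩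
    b + (a + c) ∎
    where
    open ≡-Reasoning
    a = vertices f s
    b = vertices f s′
    c = vertices f t

  bounded-by-mass : ∀ t {c} → mass t ≤ c → Bounded c t
  bounded-by-mass (node k) p = node p
  bounded-by-mass (s ◃ t) p =
    bounded-by-mass s (≤-trans (m≤n+m _ _) p) ◃ bounded-by-mass t (≤-trans (m≤m+n _ _) p)

  mass-◃* : ∀ ss t → mass (ss ◃* t) ≡ mass t + masses ss
  mass-◃* [] t = sym (+-identityʳ _)
  mass-◃* (s ∷ ss) t = begin
    mass (ss ◃* t) + mass s       ≡⟨ cong (_+ mass s) (mass-◃* ss t) ⟩
    mass t + masses ss + mass s   ≡⟨ +-assoc (mass t) _ _ ⟩
    mass t + (masses ss + mass s) ≡⟨ cong (mass t +_) (+-comm (masses ss) _) ⟩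
    mass t + (mass s + masses ss) ∎
    where open ≡-Reasoning

  ◃*-congʳ : ∀ ss {t t′} → t ~ t′ → ss ◃* t ~ ss ◃* t′
  ◃*-congʳ [] p = p
  ◃*-congʳ (s ∷ ss) p = ◃-cong ~-refl (◃*-congʳ ss p)

  ◃*-◃ : ∀ ss s t → ss ◃* (s ◃ t) ~ s ◃ (ss ◃* t)
  ◃*-◃ [] s t = ~-refl
  ◃*-◃ (r ∷ ss) s t = ~-trans (◃-cong ~-refl (◃*-◃ ss s t)) (◃-swap r s _)

  iter : (Rooted → Rooted) → ℕ → Rooted → Rooted
  iter F zero    t = t
  iter F (suc m) t = F (iter F m t)

  iter-cong : ∀ F → (∀ {s t} → s ~ t → F s ~ F t) → ∀ m {s t} → s ~ t → iter F m s ~ iter F m t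
  iter-cong F F-cong zero p = p
  iter-cong F F-cong (suc m) p = F-cong (iter-cong F F-cong m p)

  -- Every child satisfying P is deleted, and instead F is applied to the finished
  -- branch it was hanging from.
  module Collapse (P : Rooted → Bool) (F : Rooted → Rooted) where

    -- Counting the marked children apart from the stripped branch makes `full` independent of the
    -- order of the children: F may move the root and need not commute with hanging a further child,
    -- so it is iterated only when all the others are in place.
    marks : Rooted → ℕ
    marks (node k) = 0
    marks (s ◃ t)  = if P s then suc (marks t) else marks t

    strip full : Rooted → Rooted
    strip (node k) = node k
    strip (s ◃ t)  = if P s then strip t else full s ◃ strip t
    full t = iter F (marks t) (strip t)

    module _ (s t : Rooted) where
      full-marker : P s ≡ true → full (s ◃ t) ≡ F (full t)
      full-marker p rewrite p = refl

      marks-plain : P s ≡ false → marks (s ◃ t) ≡ marks t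
      marks-plain p rewrite p = refl

      strip-plain : P s ≡ false → strip (s ◃ t) ≡ full s ◃ strip t
      strip-plain p rewrite p = refl

      full-plain : P s ≡ false → full (s ◃ t) ≡ iter F (marks t) (full s ◃ strip t)
      full-plain p rewrite p = refl

    module _ (P-cong : ∀ {s t} → s ~ t → P s ≡ P t)
             (F-cong : ∀ {s t} → s ~ t → F s ~ F t) where

      marks-cong : ∀ {s t} → s ~ t → marks s ≡ marks t
      marks-cong ~-refl = refl
      marks-cong (~-sym p) = sym (marks-cong p)
      marks-cong (~-trans p q) = trans (marks-cong p) (marks-cong q)
      marks-cong (◃-cong {s} {s′} p q) rewrite P-cong p with P s′
      ... | true  = cong suc (marks-cong q)
      ... | false = marks-cong q
      marks-cong (◃-swap s s′ t) with P s | P s′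
      ... | true  | true  = refl
      ... | true  | false = refl
      ... | false | true  = refl
      ... | false | false = refl

      strip-cong : ∀ {s t} → s ~ t → strip s ~ strip t
      full-cong  : ∀ {s t} → s ~ t → full s ~ full t
      full-cong {s} {t} p rewrite marks-cong p = iter-cong F F-cong (marks t) (strip-cong p)
      strip-cong ~-refl = ~-refl
      strip-cong (~-sym p) = ~-sym (strip-cong p)
      strip-cong (~-trans p q) = ~-trans (strip-cong p) (strip-cong q)
      strip-cong (◃-cong {s} {s′} p q) rewrite P-cong p with P s′
      ... | true  = strip-cong q
      ... | false = ◃-cong (full-cong p) (strip-cong q)
      strip-cong (◃-swap s s′ t) with P s | P s′
      ... | true  | true  = ~-refl
      ... | true  | false = ~-refl
      ... | false | true  = ~-refl
      ... | false | false = ◃-swap _ _ _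

-- Pieces of trees and the markers that replace them

module Markers where

  open import Data.Bool.Properties using (∧-zeroʳ)
  import Data.Fin.Properties as Fin
  open import Data.List.Relation.Unary.All using (All; []; _∷_)
  open import Data.Nat.Base using (_+_)
  open import Data.Nat.Properties
  open import Relation.Binary.PropositionalEquality
  open RootedTrees

  -- All that recognising a marker requires: the labels of a tree with one or two vertices, while
  -- every larger tree is `other`.
  data Tag : Set where
    leaf   : ℕ → Tag
    cherry : ℕ → ℕ → Tag
    other  : Tag

  graftTag : Tag → Tag → Tag
  graftTag (leaf a) (leaf b) = cherry a b
  graftTag _        _        = other

  tag : Rooted → Tag
  tag (node k) = leaf k
  tag (s ◃ t)  = graftTag (tag s) (tag t)

  -- With two children at the root there are at least three vertices, so `tag` cannot see their
  -- order.
  graftTag-other : ∀ x y z → graftTag x (graftTag y z) ≡ other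
  graftTag-other x (leaf _) (leaf _) = lemma x
    where
    lemma : ∀ {a b} x → graftTag x (cherry a b) ≡ other
    lemma (leaf _) = refl
    lemma (cherry _ _) = refl
    lemma other = refl
  graftTag-other (leaf _) (leaf _) (cherry _ _) = refl
  graftTag-other (leaf _) (leaf _) other = refl
  graftTag-other (leaf _) (cherry _ _) _ = refl
  graftTag-other (leaf _) other _ = refl
  graftTag-other (cherry _ _) _ _ = refl
  graftTag-other other _ _ = refl

  tag-cong : ∀ {s t} → s ~ t → tag s ≡ tag t
  tag-cong ~-refl = refl
  tag-cong (~-sym p) = sym (tag-cong p)
  tag-cong (~-trans p q) = trans (tag-cong p) (tag-cong q)
  tag-cong (◃-cong p q) = cong₂ graftTag (tag-cong p) (tag-cong q)
  tag-cong (◃-swap s s′ t) =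
    trans (graftTag-other (tag s) (tag s′) (tag t)) (sym (graftTag-other (tag s′) (tag s) (tag t)))

  root : Rooted → ℕ
  root (node k) = k
  root (s ◃ t)  = root t

  -- The two markers of mass w + 2 are a single vertex and a pendant edge.
  isMarkerTag : ℕ → Tag → Bool
  isMarkerTag w (leaf k)     = does (k ≟ suc w)
  isMarkerTag w (cherry a b) = does (a ≟ 0) ∧ does (b ≟ w)
  isMarkerTag w other        = false

  isMarker : ℕ → Rooted → Bool
  isMarker w t = isMarkerTag w (tag t)

  -- The root of a marker has label w or w + 1. A tree with a small root can therefore be hung
  -- anywhere without being taken for a marker, whatever lies below that root.
  isMarker-small : ∀ {w} t → root t < w → isMarker w t ≡ false
  isMarker-small (node k) p = dec-false (k ≟ _) (λ { refl → <-asym p (n<1+n _) })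
  isMarker-small (s ◃ node b) p with tag s
  ... | leaf a rewrite dec-false (b ≟ _) (<⇒≢ p) = ∧-zeroʳ (does (a ≟ 0))
  ... | cherry _ _ = refl
  ... | other = refl
  isMarker-small {w} (s ◃ t ◃ t′) p rewrite graftTag-other (tag s) (tag t) (tag t′) = refl

  data Kind : Set where
    bundled threaded : Kind

  -- Each list member is a vertex of the path together with its small branches, topmost first; u
  -- hangs at the lower end.
  thread : List Rooted → Rooted → Rooted
  thread []       u = u
  thread (t ∷ ts) u = thread ts u ◃ t

  Type : Set
  Type = Kind × List Rooted

  attach : Type → Rooted → Rooted
  attach (bundled  , ss) u = ss ◃* u
  attach (threaded , ts) u = thread ts u

  thread-cong : ∀ ts {u u′} → u ~ u′ → thread ts u ~ thread ts u′
  thread-cong [] p = p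
  thread-cong (t ∷ ts) p = ◃-cong (thread-cong ts p) ~-refl

  attach-cong : ∀ τ {u u′} → u ~ u′ → attach τ u ~ attach τ u′
  attach-cong (bundled  , ss) = ◃*-congʳ ss
  attach-cong (threaded , ts) = thread-cong ts

  -- A bundle leaves the root where it is, whereas a thread moves it; hence the restriction on the
  -- kind.
  attach-◃ : ∀ τ → proj₁ τ ≡ bundled → ∀ s t → attach τ (s ◃ t) ~ s ◃ attach τ t
  attach-◃ (bundled , ss) _ = ◃*-◃ ss

  mass-thread : ∀ ts u → mass (thread ts u) ≡ mass u + masses ts
  mass-thread [] u = sym (+-identityʳ _)
  mass-thread (t ∷ ts) u = begin
    mass t + mass (thread ts u)   ≡⟨ cong (mass t +_) (mass-thread ts u) ⟩
    mass t + (mass u + masses ts) ≡⟨ +-assoc (mass t) _ _ ⟨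
    mass t + mass u + masses ts   ≡⟨ cong (_+ masses ts) (+-comm (mass t) _) ⟩
    mass u + mass t + masses ts   ≡⟨ +-assoc (mass u) _ _ ⟩
    mass u + (mass t + masses ts) ∎
    where open ≡-Reasoning

  mass-attach : ∀ τ u → mass (attach τ u) ≡ mass u + masses (proj₂ τ)
  mass-attach (bundled  , ss) = mass-◃* ss
  mass-attach (threaded , ts) = mass-thread ts

  -- Used to share the markers of both sorts between two subtrees with room for a and b of them. The
  -- first subtree is filled up first.
  split-≤ : ∀ j₁ j₂ {a b} → j₁ + j₂ ≤ a + b →
            ∃[ x₁ ] ∃[ x₂ ] ∃[ y₁ ] ∃[ y₂ ]
              j₁ ≡ x₁ + y₁ × j₂ ≡ x₂ + y₂ × x₁ + x₂ ≤ a × y₁ + y₂ ≤ b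
  split-≤ j₁ j₂ {zero} p = 0 , 0 , j₁ , j₂ , refl , refl , z≤n , p
  split-≤ zero zero {suc a} p = 0 , 0 , 0 , 0 , refl , refl , z≤n , z≤n
  split-≤ zero (suc j₂) {suc a} (s≤s p) with split-≤ zero j₂ {a} p
  ... | zero , x₂ , zero , y₂ , refl , refl , q , r = 0 , suc x₂ , 0 , y₂ , refl , refl , s≤s q , r
  split-≤ (suc j₁) j₂ {suc a} (s≤s p) with split-≤ j₁ j₂ {a} p
  ... | x₁ , x₂ , y₁ , y₂ , refl , refl , q , r = suc x₁ , x₂ , y₁ , y₂ , refl , refl , s≤s q , r

  module Features (c : ℕ) {Γ : ℕ} (type : Fin Γ → Type) where

    kind : Fin Γ → Kind
    kind i = proj₁ (type i)

    parts : Fin Γ → List Rooted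
    parts i = proj₂ (type i)

    -- Trees with some pieces displayed as features: bundles of children of one vertex,
    -- and threads of vertices joining a branch to the rest.
    data Limb : Set
    data Open : Set where
      node   : ∀ {k} → k < c → Open
      _◃_    : Limb → Open → Open
      bundle : ∀ i → kind i ≡ bundled → Open → Open
    data Limb where
      close   : Open → Limb
      segment : ∀ i → kind i ≡ threaded → Limb → Limb

    expandₒ : Open → Rooted
    expand  : Limb → Rooted
    expandₒ (node {k} _)   = node k
    expandₒ (l ◃ o)        = expand l ◃ expandₒ o
    expandₒ (bundle i _ o) = attach (type i) (expandₒ o)
    expand (close o)       = expandₒ o
    expand (segment i _ l) = attach (type i) (expand l)

    occₒ : Fin Γ → Open → ℕ
    occ  : Fin Γ → Limb → ℕ
    occₒ i (node _)       = 0
    occₒ i (l ◃ o)        = occ i l + occₒ i o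
    occₒ i (bundle j _ o) = (if does (i Fin.≟ j) then 1 else 0) + occₒ i o
    occ i (close o)       = occₒ i o
    occ i (segment j _ l) = (if does (i Fin.≟ j) then 1 else 0) + occ i l

    module Mark (bounded : ∀ i → All (Bounded c) (parts i))
                (i : Fin Γ) (w : ℕ) (w≥c : c ≤ w) (mass-parts : masses (parts i) ≡ 2 + w) where

      F : Rooted → Rooted
      F = attach (type i)

      open Collapse (isMarker w) F public

      marker₁ marker₂ : Rooted
      marker₁ = node (suc w)
      marker₂ = node 0 ◃ node w

      is : ℕ → ℕ → ℕ
      is v k = if does (k ≟ v) then 1 else 0

      count₁ count₂ : Rooted → ℕ
      count₁ = vertices (is (suc w))
      count₂ = vertices (is w)

      small : ∀ {k v} → k < c → c ≤ v → is v k ≡ 0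
      small {k} {v} p q rewrite dec-false (k ≟ v) (<⇒≢ (<-≤-trans p q)) = refl

      vertices-bounded : ∀ {v t} → c ≤ v → Bounded c t → vertices (is v) t ≡ 0
      vertices-bounded q (node p) = small p q
      vertices-bounded q (b ◃ b′) = cong₂ _+_ (vertices-bounded q b) (vertices-bounded q b′)

      root-bounded : ∀ {t} → Bounded c t → root t < c
      root-bounded (node p) = p
      root-bounded (b ◃ b′) = root-bounded b′

      isMarker-root : ∀ t → root t < c → isMarker w t ≡ false
      isMarker-root t p = isMarker-small t (<-≤-trans p w≥c)

      marks-bounded : ∀ {t} → Bounded c t → marks t ≡ 0
      marks-bounded (node p) = refl
      marks-bounded {s ◃ t} (b ◃ b′) =
        trans (marks-plain s t (isMarker-root s (root-bounded b))) (marks-bounded b′)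

      strip-bounded : ∀ {t} → Bounded c t → strip t ≡ t
      full-bounded  : ∀ {t} → Bounded c t → full t ≡ t
      strip-bounded (node p) = refl
      strip-bounded {s ◃ t} (b ◃ b′) =
        trans (strip-plain s t (isMarker-root s (root-bounded b)))
              (cong₂ _◃_ (full-bounded b) (strip-bounded b′))
      full-bounded {t} b rewrite marks-bounded b = strip-bounded b

      Commutes : ℕ → Set
      Commutes m = ∀ a b → iter F m (a ◃ b) ~ a ◃ iter F m b

      commutes : kind i ≡ bundled → ∀ m → Commutes m
      commutes p zero a b = ~-refl
      commutes p (suc m) a b =
        ~-trans (attach-cong (type i) (commutes p m a b)) (attach-◃ (type i) p a _)

      -- `tree` is a code for t. The bound on its root keeps the code from being mistaken for a
      -- marker when it becomes a branch in turn.
      record Marked (t : Rooted) (j₁ j₂ : ℕ) : Set where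
        constructor marked
        field
          tree  : Rooted
          full~ : full tree ~ t
          mass≡ : mass tree ≡ mass t
          root< : root tree < c
          num₁  : count₁ tree ≡ j₁
          num₂  : count₂ tree ≡ j₂

      -- More children may still be hung at this root, while `full` applies F after all of them; the
      -- two orders must agree. For a bundled type they do by commutation, and for a threaded type
      -- such a root carries no marks.
      Markedₒ : Rooted → ℕ → ℕ → Set
      Markedₒ t j₁ j₂ = ∃[ E ] Commutes (marks (Marked.tree {t} {j₁} {j₂} E))

      module _ {t : Rooted} {j₁ j₂ : ℕ} (E : Marked t j₁ j₂) where
        open Marked E

        mark₁ : Marked (F t) (suc j₁) j₂
        mark₁ = record
          { tree  = marker₁ ◃ tree
          ; full~ = subst (_~ F t) (sym (full-marker marker₁ tree is₁)) (attach-cong (type i) full~)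
          ; mass≡ = begin
              mass tree + (2 + w)          ≡⟨ cong₂ _+_ mass≡ (sym mass-parts) ⟩
              mass t + masses (parts i)    ≡⟨ mass-attach (type i) t ⟨
              mass (F t)                   ∎
          ; root< = root<
          ; num₁  = cong₂ _+_ (cong (if_then 1 else 0) (dec-true (suc w ≟ suc w) refl)) num₁
          ; num₂  = cong₂ _+_ (cong (if_then 1 else 0) (dec-false (suc w ≟ w) (λ ()))) num₂
          }
          where
          open ≡-Reasoning
          is₁ : isMarker w marker₁ ≡ true
          is₁ = dec-true (suc w ≟ suc w) refl

        mark₂ : 0 < c → Marked (F t) j₁ (suc j₂)
        mark₂ c>0 = record
          { tree  = marker₂ ◃ tree
          ; full~ = subst (_~ F t) (sym (full-marker marker₂ tree is₂)) (attach-cong (type i) full~)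
          ; mass≡ = begin
              mass tree + (suc w + 1)      ≡⟨ cong₂ _+_ mass≡ (trans (+-comm (suc w) 1) (sym mass-parts)) ⟩
              mass t + masses (parts i)    ≡⟨ mass-attach (type i) t ⟨
              mass (F t)                   ∎
          ; root< = root<
          -- The leaf of the second marker has label 0, which is below c, so neither count sees it.
          ; num₁  = cong₂ _+_ (cong₂ _+_ (small c>0 (m≤n⇒m≤1+n w≥c)) (cong (if_then 1 else 0) (dec-false (w ≟ suc w) (λ ())))) num₁
          ; num₂  = cong₂ _+_ (cong₂ _+_ (small c>0 w≥c) (cong (if_then 1 else 0) (dec-true (w ≟ w) refl))) num₂
          }
          where
          open ≡-Reasoning
          is₂ : isMarker w marker₂ ≡ true
          is₂ = dec-true (w ≟ w) refl

      -- The root of a code is small, so the new branch is no marker, and the iterated F of t moves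
      -- past it by `Commutes`.
      graft : ∀ {s t x₁ x₂ y₁ y₂} → Marked s x₁ x₂ → Markedₒ t y₁ y₂ →
              Markedₒ (s ◃ t) (x₁ + y₁) (x₂ + y₂)
      graft {s} {t} S (T , comm) = record
        { tree  = S.tree ◃ T.tree
        ; full~ = ~-trans (~-reflexive (full-plain S.tree T.tree plain))
                    (~-trans (comm (full S.tree) (strip T.tree)) (◃-cong S.full~ T.full~))
        ; mass≡ = cong₂ _+_ T.mass≡ S.mass≡
        ; root< = T.root<
        ; num₁  = cong₂ _+_ S.num₁ T.num₁
        ; num₂  = cong₂ _+_ S.num₂ T.num₂
        } , subst Commutes (sym (marks-plain S.tree T.tree plain)) comm
        where
        module S = Marked S
        module T = Marked T
        plain : isMarker w S.tree ≡ false
        plain = isMarker-root S.tree S.root<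

      unmarked : ∀ {t} → Bounded c t → Markedₒ t 0 0
      unmarked {t} b = record
        { tree  = t
        ; full~ = ~-reflexive (full-bounded b)
        ; mass≡ = refl
        ; root< = root-bounded b
        ; num₁  = vertices-bounded (m≤n⇒m≤1+n w≥c) b
        ; num₂  = vertices-bounded w≥c b
        } , subst Commutes (sym (marks-bounded b)) (λ _ _ → ~-refl)

      plain-bundle : ∀ {ss} → All (Bounded c) ss → ∀ {t j₁ j₂} → Markedₒ t j₁ j₂ → Markedₒ (ss ◃* t) j₁ j₂
      plain-bundle [] T = T
      plain-bundle (b ∷ bs) T = graft (proj₁ (unmarked b)) (plain-bundle bs T)

      plain-thread : ∀ {ts} → All (Bounded c) ts → ∀ {u j₁ j₂} → Marked u j₁ j₂ → Marked (thread ts u) j₁ j₂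
      plain-thread [] U = U
      plain-thread (_∷_ {x = t} {xs = ts} b bs) {u} {j₁} {j₂} U =
        subst₂ (Marked (thread (t ∷ ts) u)) (+-identityʳ j₁) (+-identityʳ j₂)
          (proj₁ (graft (plain-thread bs U) (unmarked b)))

      plainₒ : ∀ τ → proj₁ τ ≡ bundled → All (Bounded c) (proj₂ τ) →
               ∀ {t j₁ j₂} → Markedₒ t j₁ j₂ → Markedₒ (attach τ t) j₁ j₂
      plainₒ (bundled , ss) _ = plain-bundle

      plain : ∀ τ → proj₁ τ ≡ threaded → All (Bounded c) (proj₂ τ) →
              ∀ {t j₁ j₂} → Marked t j₁ j₂ → Marked (attach τ t) j₁ j₂
      plain (threaded , ts) _ = plain-thread

      -- Features of other types and surplus occurrences of type i are written out in full again.
      -- Their parts are bounded, so they disturb neither the recognition of markers nor the two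
      -- counts.
      markₒ : ∀ o j₁ j₂ → j₁ + j₂ ≤ occₒ i o → Markedₒ (expandₒ o) j₁ j₂
      mark  : ∀ l j₁ j₂ → j₁ + j₂ ≤ occ i l → Marked (expand l) j₁ j₂
      mark (close o) j₁ j₂ p = proj₁ (markₒ o j₁ j₂ p)
      mark (segment j q l) j₁ j₂ p with i Fin.≟ j
      ... | no _ = plain (type j) q (bounded j) (mark l j₁ j₂ p)
      mark (segment j q l) zero zero p | yes refl = plain (type j) q (bounded j) (mark l 0 0 z≤n)
      mark (segment j q l) (suc j₁) j₂ (s≤s p) | yes refl = mark₁ (mark l j₁ j₂ p)
      -- That c is positive is read off from the root of the code, whose label is below c.
      mark (segment j q l) zero (suc j₂) (s≤s p) | yes refl =
        mark₂ E (≤-<-trans z≤n (Marked.root< E))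
        where E = mark l zero j₂ p
      markₒ (node p) zero zero _ = unmarked (node p)
      markₒ (l ◃ o) j₁ j₂ p with split-≤ j₁ j₂ {occ i l} {occₒ i o} p
      ... | x₁ , x₂ , y₁ , y₂ , refl , refl , q , r = graft (mark l x₁ x₂ q) (markₒ o y₁ y₂ r)
      markₒ (bundle j q o) j₁ j₂ p with i Fin.≟ j
      ... | no _ = plainₒ (type j) q (bounded j) (markₒ o j₁ j₂ p)
      markₒ (bundle j q o) zero zero p | yes refl = plainₒ (type j) q (bounded j) (markₒ o 0 0 z≤n)
      markₒ (bundle j q o) (suc j₁) j₂ (s≤s p) | yes refl = E , commutes q (marks (Marked.tree E))
        where E = mark₁ (proj₁ (markₒ o j₁ j₂ p))
      markₒ (bundle j q o) zero (suc j₂) (s≤s p) | yes refl =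
        E , commutes q (marks (Marked.tree E))
        where
        E′ = proj₁ (markₒ o zero j₂ p)
        E  = mark₂ E′ (≤-<-trans z≤n (Marked.root< E′))

-- Linearly many disjoint pieces in a tree with bounded weights

module Decomposing where

  import Data.Fin.Properties as Fin
  open import Data.List.Relation.Unary.All using (All; []; _∷_)
  open import Data.Nat.Base using (_+_; _*_)
  open import Data.Nat.Properties
  open import Data.Nat.Tactic.RingSolver using (solve-∀)
  open import Relation.Binary.PropositionalEquality
  open import Algebra.Properties.CommutativeMonoid.Sum +-0-commutativeMonoid using (sum; ∑-distrib-+; sum-replicate-zero)
  open RootedTrees
  open Markers

  pigeonhole-sum : ∀ {n} (f : Fin n → ℕ) m → n * m < sum f → ∃[ i ] m < f i
  pigeonhole-sum {suc n} f m p with m <? f zero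
  ... | yes q = zero , q
  ... | no ¬q with pigeonhole-sum (λ i → f (suc i)) m (+-cancelˡ-< m _ _ (<-≤-trans p (+-monoˡ-≤ _ (≮⇒≥ ¬q))))
  ...   | i , q = suc i , q

  module Decomposition (c : ℕ) {Γ : ℕ} (type : Fin Γ → Type)
    (find : ∀ κ ss → All (Bounded c) ss → 2 + c ≤ masses ss → masses ss ≤ 3 * (2 + c) → ∃[ i ] type i ≡ (κ , ss))
    where

    open Features c type

    -- The least mass of a piece: from here on both markers of that mass contain a vertex of weight
    -- above c. Since weights are at most c, M also bounds the mass of a single vertex.
    M : ℕ
    M = 2 + c

    totalₒ : Open → ℕ
    total  : Limb → ℕ
    totalₒ (node _)       = 0
    totalₒ (l ◃ o)        = total l + totalₒ o
    totalₒ (bundle _ _ o) = suc (totalₒ o)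
    total (close o)       = totalₒ o
    total (segment _ _ l) = suc (total l)

    plain : ∀ {t} → Bounded c t → Open
    plain (node p) = node p
    plain (b ◃ b′) = close (plain b) ◃ plain b′

    expand-plain : ∀ {t} (b : Bounded c t) → expandₒ (plain b) ≡ t
    expand-plain (node p) = refl
    expand-plain (b ◃ b′) = cong₂ _◃_ (expand-plain b) (expand-plain b′)

    total-plain : ∀ {t} (b : Bounded c t) → totalₒ (plain b) ≡ 0
    total-plain (node p) = refl
    total-plain (b ◃ b′) = cong₂ _+_ (total-plain b) (total-plain b′)

    plainThread : ∀ {ts} → All (Bounded c) ts → Limb → Limb
    plainThread [] l = l
    plainThread (b ∷ bs) l = close (plainThread bs l ◃ plain b)

    expand-plainThread : ∀ {ts} (bs : All (Bounded c) ts) l → expand (plainThread bs l) ≡ thread ts (expand l)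
    expand-plainThread [] l = refl
    expand-plainThread (b ∷ bs) l = cong₂ _◃_ (expand-plainThread bs l) (expand-plain b)

    total-plainThread : ∀ {ts} (bs : All (Bounded c) ts) l → total (plainThread bs l) ≡ total l
    total-plainThread [] l = refl
    total-plainThread (b ∷ bs) l =
      trans (cong₂ _+_ (total-plainThread bs l) (total-plain b)) (+-identityʳ _)

    plainBundle : ∀ {ss} → All (Bounded c) ss → Open → Open
    plainBundle [] o = o
    plainBundle (b ∷ bs) o = close (plain b) ◃ plainBundle bs o

    expand-plainBundle : ∀ {ss} (bs : All (Bounded c) ss) o → expandₒ (plainBundle bs o) ≡ ss ◃* expandₒ o
    expand-plainBundle [] o = refl
    expand-plainBundle (b ∷ bs) o = cong₂ _◃_ (expand-plain b) (expand-plainBundle bs o)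

    total-plainBundle : ∀ {ss} (bs : All (Bounded c) ss) o → totalₒ (plainBundle bs o) ≡ totalₒ o
    total-plainBundle [] o = refl
    total-plainBundle (b ∷ bs) o = cong₂ _+_ (total-plain b) (total-plainBundle bs o)

    -- A branch of mass at least 2 M, displayed with enough features, up to an
    -- uncollected thread above them.  The slack 4 M pays for merging two such branches.
    record Heavy (s : Rooted) : Set where
      constructor mkHeavy
      field
        limb     : Limb
        pending  : List Rooted
        bounded  : All (Bounded c) pending
        pending≤ : masses pending ≤ M
        display  : s ~ thread pending (expand limb)
        enough   : mass (expand limb) + 4 * M ≤ total limb * (8 * M)

    absorb : ∀ {s} → Heavy s → Limb
    absorb H = plainThread bounded limb where open Heavy H

    absorb-display : ∀ {s} (H : Heavy s) → s ~ expand (absorb H)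
    absorb-display H = ~-trans display (~-reflexive (sym (expand-plainThread bounded limb)))
      where open Heavy H

    -- The pending thread has mass at most M and is charged to the slack, which drops from 4 M to 3
    -- M.
    absorb-enough : ∀ {s} (H : Heavy s) → mass (expand (absorb H)) + 3 * M ≤ total (absorb H) * (8 * M)
    absorb-enough H = begin
      mass (expand (absorb H)) + 3 * M            ≡⟨ cong (λ t → mass t + 3 * M) (expand-plainThread bounded limb) ⟩
      mass (thread pending (expand limb)) + 3 * M ≡⟨ cong (_+ 3 * M) (mass-thread pending (expand limb)) ⟩
      w + masses pending + 3 * M                  ≤⟨ +-monoˡ-≤ (3 * M) (+-monoʳ-≤ w pending≤) ⟩
      w + M + 3 * M                               ≡⟨ eq w M ⟩
      w + 4 * M                                   ≤⟨ enough ⟩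
      total limb * (8 * M)                        ≡⟨ cong (_* (8 * M)) (total-plainThread bounded limb) ⟨
      total (absorb H) * (8 * M)                  ∎
      where
      open Heavy H
      open ≤-Reasoning
      w = mass (expand limb)
      eq : ∀ w m → w + m + 3 * m ≡ w + 4 * m
      eq = solve-∀

    -- A single heavy child is kept apart because the thread above it can continue through this
    -- root; a second heavy child or a bundle ends that thread. The slack of `many` exceeds that of
    -- `Heavy` by M, to pay for the light branches that `finish` adds.
    data Core (u : Rooted) : Set where
      few  : ∀ {k} → k < c → u ≡ node k → Core u
      one  : ∀ {k s} → k < c → Heavy s → u ~ s ◃ node k → Core u
      many : ∀ o → u ~ expandₒ o → mass (expandₒ o) + 5 * M ≤ totalₒ o * (8 * M) → Core u

    addBundle : ∀ {u} bs → All (Bounded c) bs → M ≤ masses bs → masses bs ≤ 2 * M → Core u → Core (bs ◃* u)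
    addBundle bs Bs lo hi C with find bundled bs Bs lo (≤-trans hi (*-monoˡ-≤ M (n≤1+n 2)))
    ... | i , τ≡ with addTo C
      where
      kind≡ : kind i ≡ bundled
      kind≡ = cong proj₁ τ≡
      open ≤-Reasoning
      adds : ∀ o → expandₒ (bundle i kind≡ o) ≡ bs ◃* expandₒ o
      adds o = cong (λ τ → attach τ (expandₒ o)) τ≡
      mass-adds : ∀ o → mass (expandₒ (bundle i kind≡ o)) ≤ mass (expandₒ o) + 2 * M
      mass-adds o = begin
        mass (expandₒ (bundle i kind≡ o)) ≡⟨ cong mass (adds o) ⟩
        mass (bs ◃* expandₒ o)            ≡⟨ mass-◃* bs (expandₒ o) ⟩
        mass (expandₒ o) + masses bs      ≤⟨ +-monoʳ-≤ (mass (expandₒ o)) hi ⟩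
        mass (expandₒ o) + 2 * M          ∎
      addTo : ∀ {u} → Core u → ∃[ o ] u ~ expandₒ o ×
                mass (expandₒ (bundle i kind≡ o)) + 5 * M ≤ suc (totalₒ o) * (8 * M)
      -- This case fixes the factor 8: a root of mass at most M, a bundle of at most 2 M and slack 5
      -- M are charged to a single feature.
      addTo (few {k} p refl) = node p , ~-refl , (begin
        mass (expandₒ (bundle i kind≡ (node p))) + 5 * M ≤⟨ +-monoˡ-≤ (5 * M) (mass-adds (node p)) ⟩
        suc k + 2 * M + 5 * M ≤⟨ +-monoˡ-≤ (5 * M) (+-monoˡ-≤ (2 * M) (≤-trans p (m≤n+m c 2))) ⟩
        M + 2 * M + 5 * M     ≡⟨ eq M ⟩
        1 * (8 * M)           ∎)
        where
        eq : ∀ m → m + 2 * m + 5 * m ≡ 1 * (8 * m)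
        eq = solve-∀
      addTo (one {k} p H d) = o , ~-trans d (◃-cong (absorb-display H) ~-refl) , (begin
        mass (expandₒ (bundle i kind≡ o)) + 5 * M ≤⟨ +-monoˡ-≤ (5 * M) (mass-adds o) ⟩
        suc k + w + 2 * M + 5 * M   ≤⟨ +-monoˡ-≤ (5 * M) (+-monoˡ-≤ (2 * M) (+-monoˡ-≤ w (≤-trans p (m≤n+m c 2)))) ⟩
        M + w + 2 * M + 5 * M       ≡⟨ eq w M ⟩
        5 * M + (w + 3 * M)         ≤⟨ +-mono-≤ (*-monoˡ-≤ M (m≤m+n 5 3)) (absorb-enough H) ⟩
        8 * M + total (absorb H) * (8 * M) ≡⟨ cong (λ n → 8 * M + n * (8 * M)) (+-identityʳ (total (absorb H))) ⟨
        suc (totalₒ o) * (8 * M)    ∎)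
        where
        o = absorb H ◃ node p
        w = mass (expand (absorb H))
        eq : ∀ w m → m + w + 2 * m + 5 * m ≡ 5 * m + (w + 3 * m)
        eq = solve-∀
      addTo (many o d q) = o , d , (begin
        mass (expandₒ (bundle i kind≡ o)) + 5 * M ≤⟨ +-monoˡ-≤ (5 * M) (mass-adds o) ⟩
        w + 2 * M + 5 * M           ≡⟨ eq w M ⟩
        2 * M + (w + 5 * M)         ≤⟨ +-mono-≤ (*-monoˡ-≤ M (m≤m+n 2 6)) q ⟩
        suc (totalₒ o) * (8 * M)    ∎)
        where
        w = mass (expandₒ o)
        eq : ∀ w m → w + 2 * m + 5 * m ≡ 2 * m + (w + 5 * m)
        eq = solve-∀
    ... | o , d , q = many (bundle i (cong proj₁ τ≡) o)
      (~-trans (◃*-congʳ bs d) (~-reflexive (cong (λ τ → attach τ (expandₒ o)) (sym τ≡)))) q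

    addHeavy : ∀ {s u} → Heavy s → Core u → Core (s ◃ u)
    addHeavy H (few p refl) = one p H ~-refl
    -- The two branches bring slack 3 M each; M pays for the root and 5 M remain.
    addHeavy H (one {k} p H′ d) = many o (◃-cong (absorb-display H) (~-trans d (◃-cong (absorb-display H′) ~-refl))) (begin
      suc k + w′ + w + 5 * M      ≤⟨ +-monoˡ-≤ (5 * M) (+-monoˡ-≤ w (+-monoˡ-≤ w′ (≤-trans p (m≤n+m c 2)))) ⟩
      M + w′ + w + 5 * M          ≡⟨ eq w w′ M ⟩
      (w + 3 * M) + (w′ + 3 * M)  ≤⟨ +-mono-≤ (absorb-enough H) (absorb-enough H′) ⟩
      total (absorb H) * (8 * M) + total (absorb H′) * (8 * M) ≡⟨ *-distribʳ-+ (8 * M) (total (absorb H)) _ ⟨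
      (total (absorb H) + total (absorb H′)) * (8 * M) ≡⟨ cong (λ n → (total (absorb H) + n) * (8 * M)) (+-identityʳ _) ⟨
      totalₒ o * (8 * M)          ∎)
      where
      open ≤-Reasoning
      o = absorb H ◃ (absorb H′ ◃ node p)
      w = mass (expand (absorb H))
      w′ = mass (expand (absorb H′))
      eq : ∀ w w′ m → m + w′ + w + 5 * m ≡ (w + 3 * m) + (w′ + 3 * m)
      eq = solve-∀
    addHeavy H (many o d q) = many (absorb H ◃ o) (◃-cong (absorb-display H) d) (begin
      y + w + 5 * M         ≡⟨ eq w y M ⟩
      w + (y + 5 * M)       ≤⟨ +-mono-≤ (≤-trans (m≤m+n w (3 * M)) (absorb-enough H)) q ⟩
      total (absorb H) * (8 * M) + totalₒ o * (8 * M) ≡⟨ *-distribʳ-+ (8 * M) (total (absorb H)) _ ⟨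
      (total (absorb H) + totalₒ o) * (8 * M) ∎)
      where
      open ≤-Reasoning
      w = mass (expand (absorb H))
      y = mass (expandₒ o)
      eq : ∀ w y m → y + w + 5 * m ≡ w + (y + 5 * m)
      eq = solve-∀

    -- The lights are small branches waiting to be bundled. A new one of mass at most M either still
    -- fits or completes a bundle of mass between M and 2 M.
    record State (t : Rooted) : Set where
      constructor mkState
      field
        core     : Rooted
        Core-c   : Core core
        lights   : List Rooted
        bounded  : All (Bounded c) lights
        lights≤  : masses lights ≤ M
        display  : t ~ lights ◃* core

    -- A `medium` branch shows no feature yet, but it is massive enough to form a bundle alone.
    data Branch (s : Rooted) : Set where
      light  : mass s ≤ M → Branch s
      medium : M ≤ mass s → mass s ≤ 2 * M → Branch s
      heavy  : Heavy s → Branch s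

    bounded-◃* : ∀ {ss t} → All (Bounded c) ss → Bounded c t → Bounded c (ss ◃* t)
    bounded-◃* [] b = b
    bounded-◃* (b′ ∷ bs) b = b′ ◃ bounded-◃* bs b

    finish : ∀ {t} → State t → Branch t
    finish {t} (mkState _ (few {k} p refl) ss Bs ss≤ d) with ≤-total (mass t) M
    ... | inj₁ q = light q
    ... | inj₂ q = medium q (begin
      mass t              ≡⟨ mass-cong d ⟩
      mass (ss ◃* node k) ≡⟨ mass-◃* ss (node k) ⟩
      suc k + masses ss   ≤⟨ +-mono-≤ (≤-trans p (m≤n+m c 2)) ss≤ ⟩
      M + M               ≡⟨ cong (M +_) (+-identityʳ M) ⟨
      2 * M               ∎)
      where open ≤-Reasoning
    finish {t} (mkState u (one {k} {s} p H d′) ss Bs ss≤ d) = extend (≤-total (masses (t′ ∷ pending)) M)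
      where
      open Heavy H
      open ≤-Reasoning
      t′ = ss ◃* node k
      B′ = bounded-◃* Bs (node p)
      display′ : t ~ thread (t′ ∷ pending) (expand limb)
      display′ = ~-trans d (~-trans (◃*-congʳ ss d′) (~-trans (◃*-◃ ss s (node k)) (◃-cong display ~-refl)))
      -- Origin of the upper bound 3 M on pieces: the root vertex, its light branches and the
      -- pending thread contribute at most M each.
      pend≤ : masses (t′ ∷ pending) ≤ 3 * M
      pend≤ = begin
        mass t′ + masses pending              ≡⟨ cong (_+ masses pending) (mass-◃* ss (node k)) ⟩
        suc k + masses ss + masses pending    ≤⟨ +-mono-≤ (+-mono-≤ (≤-trans p (m≤n+m c 2)) ss≤) pending≤ ⟩
        M + M + M                             ≡⟨ eq M ⟩
        3 * M                                 ∎
        where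
        eq : ∀ m → m + m + m ≡ 3 * m
        eq = solve-∀
      extend : masses (t′ ∷ pending) ≤ M ⊎ M ≤ masses (t′ ∷ pending) → Branch t
      extend (inj₁ q) = heavy (mkHeavy limb (t′ ∷ pending) (B′ ∷ bounded) q display′ enough)
      extend (inj₂ q) with find threaded (t′ ∷ pending) (B′ ∷ bounded) q pend≤
      ... | i , τ≡ = heavy (mkHeavy (segment i (cong proj₁ τ≡) limb) [] [] z≤n display″ enough″)
        where
        display″ : t ~ attach (type i) (expand limb)
        display″ = ~-trans display′ (~-reflexive (cong (λ τ → attach τ (expand limb)) (sym τ≡)))
        enough″ : mass (attach (type i) (expand limb)) + 4 * M ≤ suc (total limb) * (8 * M)
        enough″ = begin
          mass (attach (type i) (expand limb)) + 4 * M       ≡⟨ cong (λ τ → mass (attach τ (expand limb)) + 4 * M) τ≡ ⟩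
          mass (thread (t′ ∷ pending) (expand limb)) + 4 * M ≡⟨ cong (_+ 4 * M) (mass-thread (t′ ∷ pending) (expand limb)) ⟩
          w + masses (t′ ∷ pending) + 4 * M                  ≤⟨ +-monoˡ-≤ (4 * M) (+-monoʳ-≤ w pend≤) ⟩
          w + 3 * M + 4 * M                                  ≡⟨ eq w M ⟩
          3 * M + (w + 4 * M)                                ≤⟨ +-mono-≤ (*-monoˡ-≤ M (m≤m+n 3 5)) enough ⟩
          suc (total limb) * (8 * M)                         ∎
          where
          w = mass (expand limb)
          eq : ∀ w m → w + 3 * m + 4 * m ≡ 3 * m + (w + 4 * m)
          eq = solve-∀
    finish {t} (mkState u (many o d′ enough) ss Bs ss≤ d) =
      heavy (mkHeavy (close (plainBundle Bs o)) [] [] z≤n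
        (~-trans d (~-trans (◃*-congʳ ss d′) (~-reflexive (sym (expand-plainBundle Bs o)))))
        (begin
          mass (expandₒ (plainBundle Bs o)) + 4 * M ≡⟨ cong (λ t → mass t + 4 * M) (expand-plainBundle Bs o) ⟩
          mass (ss ◃* expandₒ o) + 4 * M            ≡⟨ cong (_+ 4 * M) (mass-◃* ss (expandₒ o)) ⟩
          w + masses ss + 4 * M                     ≤⟨ +-monoˡ-≤ (4 * M) (+-monoʳ-≤ w ss≤) ⟩
          w + M + 4 * M                             ≡⟨ eq w M ⟩
          w + 5 * M                                 ≤⟨ enough ⟩
          totalₒ o * (8 * M)                        ≡⟨ cong (_* (8 * M)) (total-plainBundle Bs o) ⟨
          totalₒ (plainBundle Bs o) * (8 * M)       ∎))
      where
      open ≤-Reasoning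
      w = mass (expandₒ o)
      eq : ∀ w m → w + m + 4 * m ≡ w + 5 * m
      eq = solve-∀

    add : ∀ {s t} → Bounded c s → Branch s → State t → State (s ◃ t)
    add {s} b (light s≤) (mkState u C ss Bs ss≤ d) with ≤-total (mass s + masses ss) M
    ... | inj₁ q = mkState u C (s ∷ ss) (b ∷ Bs) q (◃-cong ~-refl d)
    ... | inj₂ q = mkState _ (addBundle (s ∷ ss) (b ∷ Bs) q hi C) [] [] z≤n (◃-cong ~-refl d)
      where
      hi : masses (s ∷ ss) ≤ 2 * M
      hi = ≤-trans (+-mono-≤ s≤ ss≤) (≤-reflexive (cong (M +_) (sym (+-identityʳ M))))
    add {s} b (medium lo hi) (mkState u C ss Bs ss≤ d) =
      mkState _ (addBundle (s ∷ []) (b ∷ []) (≤-trans lo (≤-reflexive (sym (+-identityʳ _))))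
        (≤-trans (≤-reflexive (+-identityʳ _)) hi) C) ss Bs ss≤
        (~-trans (◃-cong ~-refl d) (~-sym (◃*-◃ ss s u)))
    add {s} b (heavy H) (mkState u C ss Bs ss≤ d) =
      mkState _ (addHeavy H C) ss Bs ss≤ (~-trans (◃-cong ~-refl d) (~-sym (◃*-◃ ss s u)))

    state : ∀ {t} → Bounded c t → State t
    state {node k} (node p) = mkState _ (few p refl) [] [] z≤n ~-refl
    state (b ◃ b′) = add b (finish (state b)) (state b′)

    decompose : ∀ {t} → Bounded c t → 2 * M < mass t →
                ∃[ l ] t ~ expand l × mass t ≤ total l * (8 * M)
    decompose {t} b q with finish (state b)
    ... | light p = contradiction (≤-trans q p) (≤⇒≯ (m≤m+n M _))
    ... | medium _ p = contradiction p (<⇒≱ q)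
    ... | heavy H = absorb H , absorb-display H ,
      ≤-trans (≤-reflexive (mass-cong (absorb-display H)))
        (≤-trans (m≤m+n _ (3 * M)) (absorb-enough H))

    sum-indicator : ∀ {n} (j : Fin n) → sum (λ i → if does (i Fin.≟ j) then 1 else 0) ≡ 1
    sum-indicator {suc n} zero = cong suc (sum-replicate-zero n)
    sum-indicator {suc n} (suc j) = sum-indicator j

    occurrencesₒ : ∀ o → sum (λ i → occₒ i o) ≡ totalₒ o
    occurrences  : ∀ l → sum (λ i → occ i l) ≡ total l
    occurrencesₒ (node _) = sum-replicate-zero Γ
    occurrencesₒ (l ◃ o) = trans (∑-distrib-+ (λ i → occ i l) (λ i → occₒ i o))
      (cong₂ _+_ (occurrences l) (occurrencesₒ o))
    occurrencesₒ (bundle j _ o) = trans (∑-distrib-+ _ (λ i → occₒ i o))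
      (cong₂ _+_ (sum-indicator j) (occurrencesₒ o))
    occurrences (close o) = occurrencesₒ o
    occurrences (segment j _ l) = trans (∑-distrib-+ _ (λ i → occ i l))
      (cong₂ _+_ (sum-indicator j) (occurrences l))

    frequent : ∀ l m → Γ * m < total l → ∃[ i ] m < occ i l
    frequent l m p = pigeonhole-sum (λ i → occ i l) m (<-≤-trans p (≤-reflexive (sym (occurrences l))))

-- Encoding a tree without branch σ by a type and a marked tree

module Encodings where

  open import Data.List.Base using (map; _++_; length; lookup; upTo; filter; cartesianProductWith)
  open import Data.List.Membership.Propositional using (_∈_)
  open import Data.List.Membership.Propositional.Properties
    using (∈-map⁺; ∈-++⁺ˡ; ∈-++⁺ʳ; ∈-upTo⁺; ∈-cartesianProductWith⁺; ∈-filter⁺; ∈-filter⁻; ∈-lookup)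
  open import Data.List.Relation.Unary.Any using (here; there; index)
  open import Data.List.Relation.Unary.Any.Properties using (lookup-index)
  open import Data.List.Relation.Unary.All as All using (All; []; _∷_)
  open import Data.Nat.Base using (_+_; _*_; _∸_)
  open import Data.Nat.DivMod using (_/_; _%_; m≡m%n+[m/n]*n; m%n<n; m<n⇒m/n≡0; m<n⇒m%n≡m; m/n*n≤m)
  open import Data.Nat.Properties
  open import Data.Nat.Tactic.RingSolver using (solve-∀)
  open import Relation.Binary.PropositionalEquality
  open RootedTrees
  open Markers
  open Decomposing using (module Decomposition)

  -- Only completeness, `∈-trees`, matters: labels and nesting are bounded rather than mass, so
  -- heavier trees occur as well.
  trees : ℕ → List Rooted
  trees zero    = []
  trees (suc n) = map node (upTo (suc n)) ++ cartesianProductWith _◃_ (trees n) (trees n)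

  ∈-trees : ∀ n t → mass t ≤ n → t ∈ trees n
  ∈-trees zero t p = contradiction (≤-trans (mass>0 t) p) λ ()
  ∈-trees (suc n) (node k) p = ∈-++⁺ˡ (∈-map⁺ node (∈-upTo⁺ p))
  ∈-trees (suc n) (s ◃ t) p = ∈-++⁺ʳ (map node (upTo (suc n)))
    (∈-cartesianProductWith⁺ _◃_ (∈-trees n s (≤-pred (≤-trans (+-monoˡ-≤ (mass s) (mass>0 t)) p)))
      (∈-trees n t (≤-pred (≤-trans (≤-trans (≤-reflexive (+-comm 1 _)) (+-monoʳ-≤ (mass t) (mass>0 s))) p))))

  forests : ℕ → List (List Rooted)
  forests zero    = [] ∷ []
  forests (suc n) = [] ∷ cartesianProductWith _∷_ (trees (suc n)) (forests n)

  ∈-forests : ∀ n ss → masses ss ≤ n → ss ∈ forests n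
  ∈-forests zero [] _ = here refl
  ∈-forests zero (s ∷ ss) p = contradiction (≤-trans (mass>0 s) (≤-trans (m≤m+n _ _) p)) λ ()
  ∈-forests (suc n) [] _ = here refl
  ∈-forests (suc n) (s ∷ ss) p = there (∈-cartesianProductWith⁺ _∷_
    (∈-trees (suc n) s (≤-trans (m≤m+n _ _) p))
    (∈-forests n ss (≤-pred (≤-trans (+-monoˡ-≤ (masses ss) (mass>0 s)) p))))

  bounded? : ∀ c t → Dec (Bounded c t)
  bounded? c (node k) = map′ node (λ { (node p) → p }) (k <? c)
  bounded? c (s ◃ t) = map′ (λ (b , b′) → b ◃ b′) (λ { (b ◃ b′) → b , b′ }) (bounded? c s ×-dec bounded? c t)

  module Types (c : ℕ) where

    Admissible : Type → Set
    Admissible (κ , ss) = All (Bounded c) ss × 2 + c ≤ masses ss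

    admissible? : ∀ τ → Dec (Admissible τ)
    admissible? (κ , ss) = All.all? (bounded? c) ss ×-dec (2 + c ≤? masses ss)

    all : List Type
    all = cartesianProductWith _,_ (bundled ∷ threaded ∷ []) (forests (3 * (2 + c)))

    abstract
      types : List Type
      types = filter admissible? all

      admissible : ∀ i → Admissible (lookup types i)
      admissible i = proj₂ (∈-filter⁻ admissible? {xs = all} (∈-lookup i))

      find : ∀ κ ss → All (Bounded c) ss → 2 + c ≤ masses ss → masses ss ≤ 3 * (2 + c) →
             ∃[ i ] lookup types i ≡ (κ , ss)
      find κ ss Bs lo hi = index member , sym (lookup-index member)
        where
        ∈-kinds : ∀ κ → κ ∈ (bundled ∷ threaded ∷ [])
        ∈-kinds bundled  = here refl
        ∈-kinds threaded = there (here refl)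
        member : (κ , ss) ∈ types
        member = ∈-filter⁺ admissible?
          (∈-cartesianProductWith⁺ _,_ (∈-kinds κ) (∈-forests (3 * (2 + c)) ss hi)) (Bs , lo)

  -- P is tested on complete branches only: in `s ◃ t` the term t is the same root with one child
  -- missing, not a branch.
  data Avoids (P : Rooted → Bool) : Rooted → Set where
    node : ∀ {k} → Avoids P (node k)
    graft : ∀ {s t} → P s ≡ false → Avoids P s → Avoids P t → Avoids P (s ◃ t)

  module Encoding (σ : Rooted) (P : Rooted → Bool) (P-cong : ∀ {s t} → s ~ t → P s ≡ P t)
                  (P-σ : P σ ≡ true) (P-mass : ∀ {s} → P s ≡ true → mass s ≡ mass σ) where

    c : ℕ
    c = mass σ

    instance
      nonZero-c : NonZero c
      nonZero-c = >-nonZero (mass>0 σ)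

    bump : Rooted → Rooted
    bump (node k) = node (c + k)
    bump (s ◃ t)  = s ◃ bump t

    bump-cong : ∀ {s t} → s ~ t → bump s ~ bump t
    bump-cong ~-refl = ~-refl
    bump-cong (~-sym p) = ~-sym (bump-cong p)
    bump-cong (~-trans p q) = ~-trans (bump-cong p) (bump-cong q)
    bump-cong (◃-cong p q) = ◃-cong p (bump-cong q)
    bump-cong (◃-swap s s′ t) = ◃-swap s s′ (bump t)

    module Unpack = Collapse P bump
    open Unpack using (full; strip; marks)

    -- It is the label, the weight minus one, that is divided by c, so the remaining weight lies
    -- between 1 and c.
    pack : Rooted → Rooted
    pack (node k) = iter (σ ◃_) (k / c) (node (k % c))
    pack (s ◃ t)  = pack s ◃ pack t

    pack-bounded : ∀ t → Bounded c (pack t)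
    pack-bounded (node k) = lemma (k / c)
      where
      lemma : ∀ q → Bounded c (iter (σ ◃_) q (node (k % c)))
      lemma zero = node (m%n<n k c)
      lemma (suc q) = bounded-by-mass σ ≤-refl ◃ lemma q
    pack-bounded (s ◃ t) = pack-bounded s ◃ pack-bounded t

    mass-pack : ∀ t → mass (pack t) ≡ mass t
    mass-pack (node k) = trans (lemma (k / c)) (cong suc (sym (m≡m%n+[m/n]*n k c)))
      where
      lemma : ∀ q → mass (iter (σ ◃_) q (node (k % c))) ≡ suc (k % c) + q * c
      lemma zero = sym (+-identityʳ _)
      lemma (suc q) = begin
        mass (iter (σ ◃_) q (node (k % c))) + c ≡⟨ cong (_+ c) (lemma q) ⟩
        suc (k % c) + q * c + c                 ≡⟨ +-assoc (suc (k % c)) _ _ ⟩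
        suc (k % c) + (q * c + c)               ≡⟨ cong (suc (k % c) +_) (+-comm (q * c) c) ⟩
        suc (k % c) + (c + q * c)               ∎
        where open ≡-Reasoning
    mass-pack (s ◃ t) = cong₂ _+_ (mass-pack t) (mass-pack s)

    pack-small : ∀ {t} → Bounded c t → pack t ≡ t
    pack-small (node {k} p) rewrite m<n⇒m/n≡0 p | m<n⇒m%n≡m p = refl
    pack-small (b ◃ b′) = cong₂ _◃_ (pack-small b) (pack-small b′)

    -- If the packed branch passes P, its mass is c. Then all weights of s are at most c, packing
    -- did not change s, and P already held for s.
    P-pack : ∀ {s} → P s ≡ false → P (pack s) ≡ false
    P-pack {s} p with P (pack s) in eq
    ... | false = refl
    ... | true = trans (sym eq) (trans (cong P (pack-small (bounded-by-mass s
                   (≤-reflexive (trans (sym (mass-pack s)) (P-mass eq)))))) p)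

    iter-bump-node : ∀ q r → iter bump q (node r) ≡ node (r + q * c)
    iter-bump-node zero r = cong node (sym (+-identityʳ r))
    iter-bump-node (suc q) r = trans (cong bump (iter-bump-node q r)) (cong node (begin
      c + (r + q * c) ≡⟨ +-assoc c r _ ⟨
      c + r + q * c   ≡⟨ cong (_+ q * c) (+-comm c r) ⟩
      r + c + q * c   ≡⟨ +-assoc r c _ ⟩
      r + (c + q * c) ∎))
      where open ≡-Reasoning

    iter-bump-◃ : ∀ q s t → iter bump q (s ◃ t) ≡ s ◃ iter bump q t
    iter-bump-◃ zero s t = refl
    iter-bump-◃ (suc q) s t = cong bump (iter-bump-◃ q s t)

    -- By `P-pack` the only branches that get collapsed are the copies of σ inserted by `pack`, and
    -- `bump` touches only the root label, hence commutes with hanging children.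
    full-pack : ∀ {t} → Avoids P t → full (pack t) ≡ t
    full-pack (node {k}) = trans (lemma (k / c))
      (trans (iter-bump-node (k / c) (k % c)) (cong node (sym (m≡m%n+[m/n]*n k c))))
      where
      lemma : ∀ q → full (iter (σ ◃_) q (node (k % c))) ≡ iter bump q (node (k % c))
      lemma zero = refl
      lemma (suc q) = trans (Unpack.full-marker σ (iter (σ ◃_) q (node (k % c))) P-σ) (cong bump (lemma q))
    full-pack {s ◃ t} (graft p a a′) = begin
      full (pack s ◃ pack t)                                          ≡⟨ Unpack.full-plain (pack s) (pack t) (P-pack p) ⟩
      iter bump (marks (pack t)) (full (pack s) ◃ strip (pack t))      ≡⟨ iter-bump-◃ (marks (pack t)) _ _ ⟩
      full (pack s) ◃ full (pack t)                                   ≡⟨ cong₂ _◃_ (full-pack a) (full-pack a′) ⟩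
      s ◃ t                                                           ∎
      where open ≡-Reasoning

    open Types c

    Γ : ℕ
    Γ = length types

    type : Fin Γ → Type
    type = lookup types

    -- Both markers of parameter w have mass w + 2, which is to be the mass of the piece.
    width : Fin Γ → ℕ
    width i = masses (proj₂ (type i)) ∸ 2

    width≥c : ∀ i → c ≤ width i
    width≥c i = ≤-trans (≤-reflexive (sym (m+n∸m≡n 2 c))) (∸-monoˡ-≤ 2 (proj₂ (admissible i)))

    mass-parts : ∀ i → masses (proj₂ (type i)) ≡ 2 + width i
    mass-parts i = sym (m+[n∸m]≡n (≤-trans (m≤m+n 2 c) (proj₂ (admissible i))))

    open Features c type
    module Mᵢ (i : Fin Γ) = Mark (λ i → proj₁ (admissible i)) i (width i) (width≥c i) (mass-parts i)
    open Decomposition c type find public using (M; decompose; total; frequent)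

    record Code (t : Rooted) (j₁ j₂ : ℕ) : Set where
      field
        slot   : Fin Γ
        code   : Rooted
        mass≡  : mass code ≡ mass t
        decode : full (Mᵢ.full slot code) ~ t
        num₁   : Mᵢ.count₁ slot code ≡ j₁
        num₂   : Mᵢ.count₂ slot code ≡ j₂

    -- For a fixed slot, decoding and both counts are functions of the code that respect `~`.
    code-injective : ∀ {t t′ j₁ j₁′ j₂ j₂′} (C : Code t j₁ j₂) (C′ : Code t′ j₁′ j₂′) →
      Code.slot C ≡ Code.slot C′ → Code.code C ~ Code.code C′ → t ~ t′ × j₁ ≡ j₁′ × j₂ ≡ j₂′
    code-injective C C′ refl p =
        ~-trans (~-sym C.decode) (~-trans (Unpack.full-cong P-cong bump-cong
          (M.full-cong (λ q → cong (isMarkerTag _) (tag-cong q)) (attach-cong (type C.slot)) p)) C′.decode)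
      , trans (sym C.num₁) (trans (vertices-cong _ p) C′.num₁)
      , trans (sym C.num₂) (trans (vertices-cong _ p) C′.num₂)
      where
      module C = Code C
      module C′ = Code C′
      module M = Mᵢ C.slot

    -- There is a feature for every 8 M of mass, so one of the Γ types occurs more than 2 k times as
    -- soon as the mass exceeds Γ · 2 k · 8 M. The successor makes this strict for k = mass / K and
    -- makes the division legitimate.
    K : ℕ
    K = suc (Γ * 16 * M)

    encode : ∀ {t} → Avoids P t → 2 * M < mass t → ∀ j₁ j₂ → j₁ < mass t / K → j₂ < mass t / K → Code t j₁ j₂
    encode {t} avoid big j₁ j₂ p₁ p₂ = record
      { slot   = i
      ; code   = tree
      ; mass≡  = trans mass≡ (trans (mass-cong (~-sym disp)) (mass-pack t))
      ; decode = ~-trans (Unpack.full-cong P-cong bump-cong (~-trans full~ (~-sym disp))) (~-reflexive (full-pack avoid))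
      ; num₁   = num₁
      ; num₂   = num₂
      }
      where
      q = mass t / K
      D = decompose (pack-bounded t) (≤-trans big (≤-reflexive (sym (mass-pack t))))
      l = proj₁ D
      disp = proj₁ (proj₂ D)
      enough : mass t ≤ total l * (8 * M)
      enough = ≤-trans (≤-reflexive (sym (mass-pack t))) (proj₂ (proj₂ D))
      small : ∀ q → q * K ≤ mass t → Γ * (2 * q) * (8 * M) < mass t
      small zero h = ≤-<-trans (≤-reflexive (cong (_* (8 * M)) (*-zeroʳ Γ))) (mass>0 t)
      small (suc q) h = <-≤-trans (≤-<-trans (≤-reflexive (eq Γ q M))
        (*-monoʳ-< (suc q) (n<1+n (Γ * 16 * M)))) h
        where
        eq : ∀ g q m → g * (2 * suc q) * (8 * m) ≡ suc q * (g * 16 * m)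
        eq = solve-∀
      F = frequent l (2 * q) (*-cancelʳ-< (8 * M) _ _ (<-≤-trans (small q (m/n*n≤m (mass t) K)) enough))
      i = proj₁ F
      fits : j₁ + j₂ ≤ occ i l
      fits = ≤-trans (+-mono-≤ (<⇒≤ p₁) (<⇒≤ p₂))
        (≤-trans (≤-reflexive (cong (q +_) (sym (+-identityʳ q)))) (<⇒≤ (proj₂ F)))
      open Features.Mark.Marked (Mᵢ.mark i l j₁ j₂ fits)

-- Isomorphisms of rooted trees as maps on vertices

module Isomorphisms where

  open import Data.Bool.Properties using (∧-comm; ∧-zeroʳ)
  import Data.Sum.Base as Sum
  open import Data.Sum.Properties using (inj₁-injective; inj₂-injective)
  open import Data.Unit.Base using (⊤; tt)
  open import Relation.Binary.Construct.Closure.ReflexiveTransitive using (Star; ε; _◅_; _◅◅_; gmap)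
  open import Relation.Binary.PropositionalEquality hiding (J)
  open RootedTrees

  -- The summand with the root comes first, so that the root becomes index `zero` in `toTree`.
  V : Rooted → Set
  V (node k) = ⊤
  V (s ◃ t)  = V t ⊎ V s

  top : ∀ t → V t
  top (node k) = tt
  top (s ◃ t)  = inj₁ (top t)

  isTop : ∀ t → V t → Bool
  isTop (node k) _       = true
  isTop (s ◃ t) (inj₁ v) = isTop t v
  isTop (s ◃ t) (inj₂ v) = false

  label : ∀ t → V t → ℕ
  label (node k) _       = k
  label (s ◃ t) (inj₁ v) = label t v
  label (s ◃ t) (inj₂ v) = label s v

  edge : ∀ t → V t → V t → Bool
  edge (node k) _ _              = false
  edge (s ◃ t) (inj₁ v) (inj₁ w) = edge t v w
  edge (s ◃ t) (inj₁ v) (inj₂ w) = isTop t v ∧ isTop s w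
  edge (s ◃ t) (inj₂ v) (inj₁ w) = isTop s v ∧ isTop t w
  edge (s ◃ t) (inj₂ v) (inj₂ w) = edge s v w

  Edge : ∀ t → V t → V t → Set
  Edge t v w = edge t v w ≡ true

  ∧-true : ∀ {x y} → x ∧ y ≡ true → x ≡ true × y ≡ true
  ∧-true {true} {true} _ = refl , refl

  isTop-top : ∀ t → isTop t (top t) ≡ true
  isTop-top (node k) = refl
  isTop-top (s ◃ t)  = isTop-top t

  isTop⇒≡ : ∀ t v → isTop t v ≡ true → v ≡ top t
  isTop⇒≡ (node k) tt p = refl
  isTop⇒≡ (s ◃ t) (inj₁ v) p = cong inj₁ (isTop⇒≡ t v p)

  edge-sym : ∀ t v w → edge t v w ≡ edge t w v
  edge-sym (node k) v w = refl
  edge-sym (s ◃ t) (inj₁ v) (inj₁ w) = edge-sym t v w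
  edge-sym (s ◃ t) (inj₁ v) (inj₂ w) = ∧-comm (isTop t v) (isTop s w)
  edge-sym (s ◃ t) (inj₂ v) (inj₁ w) = ∧-comm (isTop s v) (isTop t w)
  edge-sym (s ◃ t) (inj₂ v) (inj₂ w) = edge-sym s v w

  edge-irrefl : ∀ t v → edge t v v ≡ false
  edge-irrefl (node k) v = refl
  edge-irrefl (s ◃ t) (inj₁ v) = edge-irrefl t v
  edge-irrefl (s ◃ t) (inj₂ v) = edge-irrefl s v

  edge-top : ∀ s t → Edge (s ◃ t) (inj₁ (top t)) (inj₂ (top s))
  edge-top s t = cong₂ _∧_ (isTop-top t) (isTop-top s)

  edge-root : ∀ s t v → edge (s ◃ t) (inj₁ (top t)) (inj₂ v) ≡ isTop s v
  edge-root s t v = cong (_∧ isTop s v) (isTop-top t)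

  connect : ∀ t v → Star (Edge t) (top t) v
  connect (node k) tt = ε
  connect (s ◃ t) (inj₁ v) = gmap inj₁ (λ p → p) (connect t v)
  connect (s ◃ t) (inj₂ v) = edge-top s t ◅ gmap inj₂ (λ p → p) (connect s v)

  Star-edge-sym : ∀ t {v w} → Star (Edge t) v w → Star (Edge t) w v
  Star-edge-sym t ε = ε
  Star-edge-sym t {v} (_◅_ {j = u} p ps) = Star-edge-sym t ps ◅◅ (trans (edge-sym t u v) p ◅ ε)

  closed : ∀ {t v w} (Q : V t → Set) → (∀ {x y} → Edge t x y → Q x → Q y) → Q v → Star (Edge t) v w → Q w
  closed Q step q ε = q
  closed Q step q (p ◅ ps) = closed Q step (step p q) ps

  record RootedIso (s t : Rooted) : Set where
    field
      to     : V s → V t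
      from   : V t → V s
      to-from : ∀ v → to (from v) ≡ v
      from-to : ∀ v → from (to v) ≡ v
      edge≡  : ∀ v w → edge t (to v) (to w) ≡ edge s v w
      isTop≡ : ∀ v → isTop t (to v) ≡ isTop s v
      label≡ : ∀ v → label t (to v) ≡ label s v

  iso-refl : ∀ {t} → RootedIso t t
  iso-refl = record { to = λ v → v ; from = λ v → v ; to-from = λ _ → refl ; from-to = λ _ → refl
                    ; edge≡ = λ _ _ → refl ; isTop≡ = λ _ → refl ; label≡ = λ _ → refl }

  iso-sym : ∀ {s t} → RootedIso s t → RootedIso t s
  iso-sym {s} {t} I = record
    { to = from ; from = to ; to-from = from-to ; from-to = to-from
    ; edge≡  = λ v w → trans (sym (edge≡ (from v) (from w))) (cong₂ (edge t) (to-from v) (to-from w))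
    ; isTop≡ = λ v → trans (sym (isTop≡ (from v))) (cong (isTop t) (to-from v))
    ; label≡ = λ v → trans (sym (label≡ (from v))) (cong (label t) (to-from v)) }
    where open RootedIso I

  iso-trans : ∀ {s t u} → RootedIso s t → RootedIso t u → RootedIso s u
  iso-trans I J = record
    { to = λ v → J.to (I.to v) ; from = λ v → I.from (J.from v)
    ; to-from = λ v → trans (cong J.to (I.to-from (J.from v))) (J.to-from v)
    ; from-to = λ v → trans (cong I.from (J.from-to (I.to v))) (I.from-to v)
    ; edge≡  = λ v w → trans (J.edge≡ (I.to v) (I.to w)) (I.edge≡ v w)
    ; isTop≡ = λ v → trans (J.isTop≡ (I.to v)) (I.isTop≡ v)
    ; label≡ = λ v → trans (J.label≡ (I.to v)) (I.label≡ v) }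
    where
    module I = RootedIso I
    module J = RootedIso J

  iso-◃ : ∀ {s s′ t t′} → RootedIso s s′ → RootedIso t t′ → RootedIso (s ◃ t) (s′ ◃ t′)
  iso-◃ I J = record
    { to = Sum.map J.to I.to ; from = Sum.map J.from I.from
    ; to-from = λ { (inj₁ v) → cong inj₁ (J.to-from v) ; (inj₂ v) → cong inj₂ (I.to-from v) }
    ; from-to = λ { (inj₁ v) → cong inj₁ (J.from-to v) ; (inj₂ v) → cong inj₂ (I.from-to v) }
    ; edge≡ = λ { (inj₁ v) (inj₁ w) → J.edge≡ v w ; (inj₁ v) (inj₂ w) → cong₂ _∧_ (J.isTop≡ v) (I.isTop≡ w)
                ; (inj₂ v) (inj₁ w) → cong₂ _∧_ (I.isTop≡ v) (J.isTop≡ w) ; (inj₂ v) (inj₂ w) → I.edge≡ v w }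
    ; isTop≡ = λ { (inj₁ v) → J.isTop≡ v ; (inj₂ v) → refl }
    ; label≡ = λ { (inj₁ v) → J.label≡ v ; (inj₂ v) → I.label≡ v } }
    where
    module I = RootedIso I
    module J = RootedIso J

  iso-swap : ∀ s s′ t → RootedIso (s ◃ (s′ ◃ t)) (s′ ◃ (s ◃ t))
  iso-swap s s′ t = record
    { to = exchange ; from = exchange
    ; to-from = exchange² ; from-to = exchange²
    ; edge≡ = λ { (inj₁ (inj₁ v)) (inj₁ (inj₁ w)) → refl ; (inj₁ (inj₁ v)) (inj₁ (inj₂ w)) → refl
                ; (inj₁ (inj₁ v)) (inj₂ w) → refl
                ; (inj₁ (inj₂ v)) (inj₁ (inj₁ w)) → refl ; (inj₁ (inj₂ v)) (inj₁ (inj₂ w)) → refl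
                ; (inj₁ (inj₂ v)) (inj₂ w) → ∧-zeroʳ (isTop s′ v)
                ; (inj₂ v) (inj₁ (inj₁ w)) → refl ; (inj₂ v) (inj₁ (inj₂ w)) → sym (∧-zeroʳ (isTop s v))
                ; (inj₂ v) (inj₂ w) → refl }
    ; isTop≡ = λ { (inj₁ (inj₁ v)) → refl ; (inj₁ (inj₂ v)) → refl ; (inj₂ v) → refl }
    ; label≡ = λ { (inj₁ (inj₁ v)) → refl ; (inj₁ (inj₂ v)) → refl ; (inj₂ v) → refl } }
    where
    exchange : ∀ {A B C : Set} → (A ⊎ B) ⊎ C → (A ⊎ C) ⊎ B
    exchange (inj₁ (inj₁ v)) = inj₁ (inj₁ v)
    exchange (inj₁ (inj₂ v)) = inj₂ v
    exchange (inj₂ v)        = inj₁ (inj₂ v)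
    exchange² : ∀ {A B C : Set} (v : (A ⊎ B) ⊎ C) → exchange (exchange v) ≡ v
    exchange² (inj₁ (inj₁ v)) = refl
    exchange² (inj₁ (inj₂ v)) = refl
    exchange² (inj₂ v)        = refl

  ~⇒iso : ∀ {s t} → s ~ t → RootedIso s t
  ~⇒iso ~-refl = iso-refl
  ~⇒iso (~-sym p) = iso-sym (~⇒iso p)
  ~⇒iso (~-trans p q) = iso-trans (~⇒iso p) (~⇒iso q)
  ~⇒iso (◃-cong p q) = iso-◃ (~⇒iso p) (~⇒iso q)
  ~⇒iso (◃-swap s s′ t) = iso-swap s s′ t

  module _ {s t : Rooted} (I : RootedIso s t) where
    open RootedIso I

    to-injective : ∀ {v w} → to v ≡ to w → v ≡ w
    to-injective {v} {w} p = trans (sym (from-to v)) (trans (cong from p) (from-to w))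

    to-top : to (top s) ≡ top t
    to-top = isTop⇒≡ t (to (top s)) (trans (isTop≡ (top s)) (isTop-top s))

  record Extraction (t : Rooted) (v : V t) : Set where
    field
      child rest : Rooted
      perm  : t ~ child ◃ rest
      iso   : RootedIso (child ◃ rest) t
      child≡ : RootedIso.to iso (inj₂ (top child)) ≡ v

  extract : ∀ t v → Edge t (top t) v → Extraction t v
  extract (s ◃ t) (inj₂ v) p = record
    { child = s ; rest = t ; perm = ~-refl ; iso = iso-refl
    ; child≡ = cong inj₂ (sym (isTop⇒≡ s v (proj₂ (∧-true {isTop t (top t)} p)))) }
  extract (s ◃ t) (inj₁ v) p = record
    { child = E.child ; rest = s ◃ E.rest
    ; perm = ~-trans (◃-cong ~-refl E.perm) (◃-swap s E.child E.rest)
    ; iso = iso-trans (iso-swap E.child s E.rest) (iso-◃ iso-refl E.iso)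
    ; child≡ = cong inj₁ E.child≡ }
    where module E = Extraction (extract t v p)

  -- An isomorphism matching two children of the roots matches the branches there,
  -- because a branch is connected and only leaves through the root.
  module _ {a b a′ b′ : Rooted} (I : RootedIso (a ◃ b) (a′ ◃ b′)) where
    open RootedIso I

    into-branch : to (inj₂ (top a)) ≡ inj₂ (top a′) → ∀ v → ∃[ w ] to (inj₂ v) ≡ inj₂ w
    into-branch p v = closed (λ v → ∃[ w ] to (inj₂ v) ≡ inj₂ w) step (top a′ , p) (connect a v)
      where
      step : ∀ {x y} → Edge a x y → ∃[ w ] to (inj₂ x) ≡ inj₂ w → ∃[ w ] to (inj₂ y) ≡ inj₂ w
      step {x} {y} e (w , q) with to (inj₂ y) in r
      ... | inj₂ w′ = w′ , refl
      ... | inj₁ u  = ⊥-elim (absurd (trans (sym (trans (cong (isTop (a′ ◃ b′)) (sym r)) (isTop≡ (inj₂ y))))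
                        (proj₂ (∧-true {isTop a′ w} {isTop b′ u}
                          (trans (sym (cong₂ (edge (a′ ◃ b′)) q r)) (trans (edge≡ (inj₂ x) (inj₂ y)) e))))))
        where
        absurd : false ≢ true
        absurd ()

  module _ {a b a′ b′ : Rooted} (I : RootedIso (a ◃ b) (a′ ◃ b′))
           (p : RootedIso.to I (inj₂ (top a)) ≡ inj₂ (top a′)) where
    open RootedIso I

    private
      p⁻¹ : from (inj₂ (top a′)) ≡ inj₂ (top a)
      p⁻¹ = trans (cong from (sym p)) (from-to _)

      to₂ : ∀ v → ∃[ w ] to (inj₂ v) ≡ inj₂ w
      to₂ = into-branch I p
      from₂ : ∀ v → ∃[ w ] from (inj₂ v) ≡ inj₂ w
      from₂ = into-branch (iso-sym I) p⁻¹

      to₁ : ∀ v → ∃[ w ] to (inj₁ v) ≡ inj₁ w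
      to₁ v with to (inj₁ v) in eq
      ... | inj₁ w = w , refl
      ... | inj₂ w with trans (sym (from-to (inj₁ v))) (trans (cong from eq) (proj₂ (from₂ w)))
      ...   | ()
      from₁ : ∀ v → ∃[ w ] from (inj₁ v) ≡ inj₁ w
      from₁ v with from (inj₁ v) in eq
      ... | inj₁ w = w , refl
      ... | inj₂ w with trans (sym (to-from (inj₁ v))) (trans (cong to eq) (proj₂ (to₂ w)))
      ...   | ()

    branch-iso : RootedIso a a′
    branch-iso = record
      { to = λ v → proj₁ (to₂ v) ; from = λ v → proj₁ (from₂ v)
      ; to-from = λ v → inj₂-injective (trans (sym (proj₂ (to₂ _))) (trans (cong to (sym (proj₂ (from₂ v)))) (to-from _)))
      ; from-to = λ v → inj₂-injective (trans (sym (proj₂ (from₂ _))) (trans (cong from (sym (proj₂ (to₂ v)))) (from-to _)))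
      ; edge≡ = λ v w → trans (sym (cong₂ (edge (a′ ◃ b′)) (proj₂ (to₂ v)) (proj₂ (to₂ w)))) (edge≡ _ _)
      ; isTop≡ = λ v → top-preserving v
      ; label≡ = λ v → trans (sym (cong (label (a′ ◃ b′)) (proj₂ (to₂ v)))) (label≡ _) }
      where
      -- The top of a branch is its only vertex adjacent to the root, which the isomorphism fixes.
      top-preserving : ∀ v → isTop a′ (proj₁ (to₂ v)) ≡ isTop a v
      top-preserving v = trans (sym (edge-root a′ b′ _))
        (trans (sym (cong₂ (edge (a′ ◃ b′)) (to-top I) (proj₂ (to₂ v)))) (trans (edge≡ _ _) (edge-root a b v)))

    rest-iso : RootedIso b b′
    rest-iso = record
      { to = λ v → proj₁ (to₁ v) ; from = λ v → proj₁ (from₁ v)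
      ; to-from = λ v → inj₁-injective (trans (sym (proj₂ (to₁ _))) (trans (cong to (sym (proj₂ (from₁ v)))) (to-from _)))
      ; from-to = λ v → inj₁-injective (trans (sym (proj₂ (from₁ _))) (trans (cong from (sym (proj₂ (to₁ v)))) (from-to _)))
      ; edge≡ = λ v w → trans (sym (cong₂ (edge (a′ ◃ b′)) (proj₂ (to₁ v)) (proj₂ (to₁ w)))) (edge≡ _ _)
      ; isTop≡ = λ v → trans (sym (cong (isTop (a′ ◃ b′)) (proj₂ (to₁ v)))) (isTop≡ _)
      ; label≡ = λ v → trans (sym (cong (label (a′ ◃ b′)) (proj₂ (to₁ v)))) (label≡ _) }

  -- One child is peeled off at a time: its image is a neighbour of the root of t, so t can be
  -- rearranged to list that branch first, and then the isomorphism splits into one of the branches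
  -- and one of the rests.
  iso⇒~ : ∀ {s t} → RootedIso s t → s ~ t
  iso⇒~ {node k} {node k′} I = ~-reflexive (cong node (sym (RootedIso.label≡ I tt)))
  iso⇒~ {node k} {c ◃ d} I with trans (sym (RootedIso.to-from I (inj₁ (top d)))) (RootedIso.to-from I (inj₂ (top c)))
  ... | ()
  iso⇒~ {a ◃ b} {t} I = ~-trans (◃-cong (iso⇒~ (branch-iso J p)) (iso⇒~ (rest-iso J p))) (~-sym E.perm)
    where
    open RootedIso I
    v = to (inj₂ (top a))
    module E = Extraction (extract t v
      (trans (cong (λ u → edge t u v) (sym (to-top I))) (trans (edge≡ _ _) (edge-top a b))))
    J = iso-trans I (iso-sym E.iso)
    p : RootedIso.to J (inj₂ (top a)) ≡ inj₂ (top E.child)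
    p = trans (cong (RootedIso.from E.iso) (sym E.child≡)) (RootedIso.from-to E.iso _)

-- The unrooted weighted tree of a rooted tree

module TreeOf where

  open import Data.Fin.Base using (fromℕ; inject₁; splitAt; join; _↑ˡ_; _↑ʳ_)
  open import Data.Fin.Properties using (join-splitAt; splitAt-↑ˡ; splitAt-↑ʳ; toℕ-inject₁)
  open import Data.Fin.Relation.Unary.Top using (view; ‵fromℕ; ‵inject₁)
  open import Data.Nat.Base using (_+_)
  open import Data.Nat.Properties
  open import Algebra.Properties.CommutativeMonoid.Sum +-0-commutativeMonoid using (sum; sum-cong-≗; sum-permute)
  import Data.Sum.Base as Sum
  open import Data.Unit.Base using (tt)
  open import Relation.Binary.Construct.Closure.ReflexiveTransitive using (Star; _◅◅_; gmap)
  open import Relation.Binary.PropositionalEquality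
  open RootedTrees
  open Isomorphisms

  depth : ∀ t → V t → ℕ
  depth (node k) _       = 0
  depth (s ◃ t) (inj₁ v) = depth t v
  depth (s ◃ t) (inj₂ v) = suc (depth s v)

  depth-top : ∀ t {v} → isTop t v ≡ true → depth t v ≡ 0
  depth-top (node k) p = refl
  depth-top (s ◃ t) {inj₁ v} p = depth-top t p

  below-top : ∀ t {v w} → isTop t v ≡ true → Edge t v w → 0 < depth t w
  below-top (s ◃ t) {inj₁ v} {inj₁ w} p e = below-top t p e
  below-top (s ◃ t) {inj₁ v} {inj₂ w} p e = s≤s z≤n

  -- All neighbours other than the parent are strictly deeper. The weak inequalities are what a
  -- maximal depth along a cycle provides.
  parent-unique : ∀ t {v w w′} → Edge t v w → Edge t v w′ →
                  depth t w ≤ depth t v → depth t w′ ≤ depth t v → w ≡ w′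
  parent-unique (s ◃ t) {inj₁ v} {inj₁ w} {inj₁ w′} e e′ p p′ = cong inj₁ (parent-unique t e e′ p p′)
  parent-unique (s ◃ t) {inj₁ v} {inj₂ w} e e′ p p′ =
    ⊥-elim (n≮0 (subst (_ ≤_) (depth-top t (proj₁ (∧-true e))) p))
  parent-unique (s ◃ t) {inj₁ v} {inj₁ w} {inj₂ w′} e e′ p p′ =
    ⊥-elim (n≮0 (subst (_ ≤_) (depth-top t (proj₁ (∧-true e′))) p′))
  parent-unique (s ◃ t) {inj₂ v} {inj₂ w} {inj₂ w′} e e′ p p′ =
    cong inj₂ (parent-unique s e e′ (s≤s⁻¹ p) (s≤s⁻¹ p′))
  parent-unique (s ◃ t) {inj₂ v} {inj₁ w} {inj₁ w′} e e′ p p′ =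
    cong inj₁ (trans (isTop⇒≡ t w (proj₂ (∧-true {isTop s v} e)))
                (sym (isTop⇒≡ t w′ (proj₂ (∧-true {isTop s v} e′)))))
  parent-unique (s ◃ t) {inj₂ v} {inj₁ w} {inj₂ w′} e e′ p p′ =
    ⊥-elim (<⇒≱ (below-top s (proj₁ (∧-true e)) e′) (subst (_ ≤_) (depth-top s (proj₁ (∧-true e))) (s≤s⁻¹ p′)))
  parent-unique (s ◃ t) {inj₂ v} {inj₂ w} {inj₁ w′} e e′ p p′ =
    ⊥-elim (<⇒≱ (below-top s (proj₁ (∧-true e′)) e) (subst (_ ≤_) (depth-top s (proj₁ (∧-true e′))) (s≤s⁻¹ p)))

  -- One less than the number of vertices: a size that is visibly a successor gives the root the
  -- index `zero`, and `extra` is the dimension left when the root is deleted from the matrix.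
  extra : Rooted → ℕ
  extra (node k) = 0
  extra (s ◃ t)  = extra t + suc (extra s)

  size : Rooted → ℕ
  size t = suc (extra t)

  toV : ∀ t → Fin (size t) → V t
  toV (node k) i = tt
  toV (s ◃ t) i  = Sum.map (toV t) (toV s) (splitAt (size t) i)

  fromV : ∀ t → V t → Fin (size t)
  fromV (node k) v = zero
  fromV (s ◃ t) v  = join (size t) (size s) (Sum.map (fromV t) (fromV s) v)

  toV-fromV : ∀ t v → toV t (fromV t v) ≡ v
  toV-fromV (node k) v = refl
  toV-fromV (s ◃ t) (inj₁ v) rewrite splitAt-↑ˡ (size t) (fromV t v) (size s) = cong inj₁ (toV-fromV t v)
  toV-fromV (s ◃ t) (inj₂ v) rewrite splitAt-↑ʳ (size t) (size s) (fromV s v) = cong inj₂ (toV-fromV s v)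

  fromV-toV : ∀ t i → fromV t (toV t i) ≡ i
  fromV-toV (node k) zero = refl
  fromV-toV (s ◃ t) i = trans (cong (join (size t) (size s)) (lemma (splitAt (size t) i))) (join-splitAt (size t) (size s) i)
    where
    lemma : ∀ x → Sum.map (fromV t) (fromV s) (Sum.map (toV t) (toV s) x) ≡ x
    lemma (inj₁ j) = cong inj₁ (fromV-toV t j)
    lemma (inj₂ j) = cong inj₂ (fromV-toV s j)

  toV-zero : ∀ t → toV t zero ≡ top t
  toV-zero (node k) = refl
  toV-zero (s ◃ t) = cong inj₁ (toV-zero t)

  graph : ∀ t → Graph (size t)
  graph t = record
    { adj       = λ i j → edge t (toV t i) (toV t j)
    ; symmetric = λ i j → edge-sym t (toV t i) (toV t j)
    ; loopless  = λ i → edge-irrefl t (toV t i)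
    }

  maximum : ∀ {n} (f : Fin (suc n) → ℕ) → ∃[ i ] (∀ j → f j ≤ f i)
  maximum {zero} f = zero , λ { zero → ≤-refl }
  maximum {suc n} f with maximum (f ∘ suc)
  ... | i , p with ≤-total (f zero) (f (suc i))
  ...   | inj₁ q = suc i , λ { zero → q ; (suc j) → p j }
  ...   | inj₂ q = zero , λ { zero → ≤-refl ; (suc j) → ≤-trans (p j) q }

  module _ {m} {G : Graph m} (C : Cycle G) where
    open Graph G
    open Cycle C

    private
      flip : ∀ {i j} → Adjacent i j → Adjacent j i
      flip {i} {j} p = trans (symmetric j i) p

    two-neighbours : ∀ i → ∃[ a ] ∃[ b ] a ≢ b × Adjacent (vertex i) (vertex a) × Adjacent (vertex i) (vertex b)
    two-neighbours zero = suc zero , fromℕ (2 + k) , (λ ()) , step zero , flip close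
    two-neighbours (suc i) with view i
    ... | ‵fromℕ = inject₁ (fromℕ (suc k)) , zero , (λ ()) , flip (step (fromℕ (suc k))) , close
    ... | ‵inject₁ j = inject₁ (inject₁ j) , suc (suc j) , ne , flip (step (inject₁ j)) , step (suc j)
      where
      ne : inject₁ (inject₁ j) ≢ suc (suc j)
      ne p = m≢1+n+m (toℕ j) {1} (trans (sym (trans (toℕ-inject₁ (inject₁ j)) (toℕ-inject₁ j))) (cong toℕ p))

  -- A deepest vertex of a cycle would have two parents.
  acyclic : ∀ t → Cycle (graph t) → ⊥
  acyclic t C with maximum (λ i → depth t (toV t (Cycle.vertex C i)))
  ... | i , deepest with two-neighbours C i
  ...   | a , b , a≢b , p , q = a≢b (Cycle.distinct C (trans (sym (fromV-toV t _))
          (trans (cong (fromV t) (parent-unique t p q (deepest a) (deepest b))) (fromV-toV t _))))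

  connected : ∀ t → Connected (graph t)
  connected t i j = subst₂ (Star (Graph.Adjacent (graph t))) (fromV-toV t i) (fromV-toV t j)
    (gmap (fromV t) (λ {v} {w} p → trans (cong₂ (edge t) (toV-fromV t v) (toV-fromV t w)) p)
      (Star-edge-sym t (connect t (toV t i)) ◅◅ connect t (toV t j)))

  toTree : Rooted → WeightedTree
  toTree t = record
    { order    = size t
    ; graph    = graph t
    ; isTree   = record { nonempty = s≤s z≤n ; connected = connected t ; acyclic = acyclic t }
    ; weight   = λ i → suc (label t (toV t i))
    ; positive = λ i → s≤s z≤n
    }

  sum-splitAt : ∀ m {n} (f : Fin (m + n) → ℕ) → sum f ≡ sum (λ i → f (i ↑ˡ n)) + sum (λ i → f (m ↑ʳ i))
  sum-splitAt zero f = refl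
  sum-splitAt (suc m) f = trans (cong (f zero +_) (sum-splitAt m (f ∘ suc))) (sym (+-assoc (f zero) _ _))

  sum-labels : ∀ (f : ℕ → ℕ) t → sum (λ i → f (label t (toV t i))) ≡ vertices f t
  sum-labels f (node k) = +-identityʳ (f k)
  sum-labels f (s ◃ t) = begin
    sum (g ∘ splitAt (size t))
      ≡⟨ sum-splitAt (size t) {size s} (g ∘ splitAt (size t)) ⟩
    sum {size t} (λ i → g (splitAt (size t) (i ↑ˡ size s))) + sum {size s} (λ i → g (splitAt (size t) (size t ↑ʳ i)))
      ≡⟨ cong₂ _+_ (sum-cong-≗ {n = size t} λ i → cong g (splitAt-↑ˡ (size t) i (size s)))
                   (sum-cong-≗ {n = size s} λ i → cong g (splitAt-↑ʳ (size t) (size s) i)) ⟩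
    sum (λ i → f (label t (toV t i))) + sum (λ i → f (label s (toV s i)))
      ≡⟨ cong₂ _+_ (sum-labels f t) (sum-labels f s) ⟩
    vertices f t + vertices f s
      ≡⟨ +-comm (vertices f t) _ ⟩
    vertices f s + vertices f t ∎
    where
    open ≡-Reasoning
    g : Fin (size t) ⊎ Fin (size s) → ℕ
    g x = f (label (s ◃ t) (Sum.map (toV t) (toV s) x))

  vertices-suc : ∀ t → vertices suc t ≡ mass t
  vertices-suc (node k) = refl
  vertices-suc (s ◃ t) = trans (cong₂ _+_ (vertices-suc s) (vertices-suc t)) (+-comm (mass s) _)

  totalWeight-toTree : ∀ t → totalWeight (toTree t) ≡ mass t
  totalWeight-toTree t = trans (sum-labels suc t) (vertices-suc t)

  -- Every vertex weighs at least 1; this bounds the number of positions that a root can have.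
  size≤mass : ∀ t → size t ≤ mass t
  size≤mass (node k) = s≤s z≤n
  size≤mass (s ◃ t) = +-mono-≤ (size≤mass t) (size≤mass s)

  sum-weights-cong : ∀ (f : ℕ → ℕ) {U W} → U ≅ W →
    sum (λ i → f (WeightedTree.weight U i)) ≡ sum (λ i → f (WeightedTree.weight W i))
  sum-weights-cong f {U} {W} I = sym (trans (sum-permute (λ i → f (WeightedTree.weight W i)) (_≅_.bijection I))
    (sum-cong-≗ λ i → cong f (_≅_.weight-preserving I i)))

  totalWeight-cong : ∀ {U W} → U ≅ W → totalWeight U ≡ totalWeight W
  totalWeight-cong {U} {W} = sum-weights-cong (λ w → w) {U} {W}

  iso⇒≅ : ∀ {s t} → RootedIso s t → toTree s ≅ toTree t
  iso⇒≅ {s} {t} I = record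
    { bijection = mk↔ₛ′ (fromV t ∘ to ∘ toV s) (fromV s ∘ from ∘ toV t)
        (λ i → trans (cong (fromV t ∘ to) (toV-fromV s _)) (trans (cong (fromV t) (to-from _)) (fromV-toV t i)))
        (λ i → trans (cong (fromV s ∘ from) (toV-fromV t _)) (trans (cong (fromV s) (from-to _)) (fromV-toV s i)))
    ; adj-preserving = λ i j → trans (cong₂ (edge t) (toV-fromV t _) (toV-fromV t _)) (edge≡ _ _)
    ; weight-preserving = λ i → cong suc (trans (cong (label t) (toV-fromV t _)) (label≡ _))
    }
    where open RootedIso I

  ≅⇒iso : ∀ {s t} (I : toTree s ≅ toTree t) → _≅_.to I zero ≡ zero → RootedIso s t
  ≅⇒iso {s} {t} I p = record
    { to = f ; from = g
    ; to-from = λ v → trans (cong (toV t ∘ to) (fromV-toV s _)) (trans (cong (toV t) (strictlyInverseˡ _)) (toV-fromV t v))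
    ; from-to = g-f
    ; edge≡ = λ v w → trans (adj-preserving _ _) (cong₂ (edge s) (toV-fromV s v) (toV-fromV s w))
    ; isTop≡ = tops
    ; label≡ = λ v → suc-injective (trans (weight-preserving _) (cong (suc ∘ label s) (toV-fromV s v)))
    }
    where
    open _≅_ I
    f = toV t ∘ to ∘ fromV s
    g = toV s ∘ from ∘ fromV t
    g-f : ∀ v → g (f v) ≡ v
    g-f v = trans (cong (toV s ∘ from) (fromV-toV t _))
      (trans (cong (toV s) (Inverse.strictlyInverseʳ bijection _)) (toV-fromV s v))
    f-top : f (top s) ≡ top t
    f-top = trans (cong (toV t ∘ to) (trans (cong (fromV s) (sym (toV-zero s))) (fromV-toV s zero)))
      (trans (cong (toV t) p) (toV-zero t))
    tops : ∀ v → isTop t (f v) ≡ isTop s v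
    tops v with isTop s v in eq
    ... | true = trans (cong (isTop t ∘ f) (isTop⇒≡ s v eq)) (trans (cong (isTop t) f-top) (isTop-top t))
    ... | false with isTop t (f v) in eq′
    ...   | false = refl
    ...   | true = trans (sym (isTop-top s)) (trans (cong (isTop s) (trans (sym (g-f (top s)))
              (trans (cong g (trans f-top (sym (isTop⇒≡ t _ eq′)))) (g-f v)))) eq)

-- Every weighted tree comes from a rooted term

module RootedForm where

  open import Data.Bool.Properties using (∧-zeroʳ) renaming (_≟_ to _≟ᵇ_)
  open import Data.Fin.Base using (fromℕ; inject₁; fromℕ<)
  open import Data.Fin.Properties using (any?; all?; ¬∀⟶∃¬; injective⇒≤) renaming (_≟_ to _≟ᶠ_)
  open import Data.List.Base using (map; _++_; length; lookup)
  open import Data.List.Membership.Propositional using (_∈_)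
  open import Data.List.Membership.Propositional.Properties using (∈-map⁻; ∈-lookup)
  open import Data.List.Relation.Unary.All as All using (All; []; _∷_)
  open import Data.List.Relation.Unary.AllPairs using ([]; _∷_)
  open import Data.List.Relation.Unary.Unique.Propositional using (Unique)
  open import Data.List.Relation.Unary.Unique.Propositional.Properties using () renaming (map⁺ to unique-map; ++⁺ to unique-++)
  open import Data.Maybe.Base as Maybe using (Maybe; just; nothing; maybe)
  open import Data.Maybe.Properties using (map-injective)
  open import Data.Nat.Base using (_+_)
  open import Data.Nat.Properties
  import Data.Sum.Base as Sum
  open import Data.Sum.Properties using (inj₁-injective; inj₂-injective)
  open import Data.Unit.Base using (tt)
  open import Relation.Binary.Construct.Closure.ReflexiveTransitive using (Star; ε; _◅_)
  open import Relation.Binary.PropositionalEquality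
  open RootedTrees
  open Isomorphisms
  open TreeOf hiding (graph; acyclic; connected)

  addLeaf : ∀ t → V t → ℕ → Rooted
  addLeaf (node k) _ a       = node a ◃ node k
  addLeaf (s ◃ t) (inj₁ v) a = s ◃ addLeaf t v a
  addLeaf (s ◃ t) (inj₂ v) a = addLeaf s v a ◃ t

  -- The old vertex that a vertex of addLeaf t v a comes from, or nothing for the new leaf.
  origin : ∀ t v a → V (addLeaf t v a) → Maybe (V t)
  origin (node k) _ a (inj₁ _)       = just tt
  origin (node k) _ a (inj₂ _)       = nothing
  origin (s ◃ t) (inj₁ v) a (inj₁ u) = Maybe.map inj₁ (origin t v a u)
  origin (s ◃ t) (inj₁ v) a (inj₂ u) = just (inj₂ u)
  origin (s ◃ t) (inj₂ v) a (inj₁ u) = just (inj₁ u)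
  origin (s ◃ t) (inj₂ v) a (inj₂ u) = Maybe.map inj₂ (origin s v a u)

  same : ∀ t → V t → V t → Bool
  same (node k) _ _              = true
  same (s ◃ t) (inj₁ v) (inj₁ w) = same t v w
  same (s ◃ t) (inj₁ v) (inj₂ w) = false
  same (s ◃ t) (inj₂ v) (inj₁ w) = false
  same (s ◃ t) (inj₂ v) (inj₂ w) = same s v w

  same⇒≡ : ∀ t v w → same t v w ≡ true → v ≡ w
  same⇒≡ (node k) tt tt p = refl
  same⇒≡ (s ◃ t) (inj₁ v) (inj₁ w) p = cong inj₁ (same⇒≡ t v w p)
  same⇒≡ (s ◃ t) (inj₂ v) (inj₂ w) p = cong inj₂ (same⇒≡ s v w p)

  same-refl : ∀ t v → same t v v ≡ true
  same-refl (node k) v = refl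
  same-refl (s ◃ t) (inj₁ v) = same-refl t v
  same-refl (s ◃ t) (inj₂ v) = same-refl s v

  -- Here `nothing` stands for the new leaf, whose only neighbour is v.
  leafEdge : ∀ t → V t → Maybe (V t) → Maybe (V t) → Bool
  leafEdge t v (just x) (just y) = edge t x y
  leafEdge t v (just x) nothing  = same t x v
  leafEdge t v nothing  (just y) = same t y v
  leafEdge t v nothing  nothing  = false

  origin-injective : ∀ t v a {u w} → origin t v a u ≡ origin t v a w → u ≡ w
  origin-injective (node k) _ a {inj₁ _} {inj₁ _} p = refl
  origin-injective (node k) _ a {inj₂ _} {inj₂ _} p = refl
  origin-injective (s ◃ t) (inj₁ v) a {inj₁ u} {inj₁ w} p = cong inj₁ (origin-injective t v a (map-injective inj₁-injective p))
  origin-injective (s ◃ t) (inj₁ v) a {inj₁ u} {inj₂ w} p with origin t v a u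
  origin-injective (s ◃ t) (inj₁ v) a {inj₁ u} {inj₂ w} () | just _
  origin-injective (s ◃ t) (inj₁ v) a {inj₁ u} {inj₂ w} () | nothing
  origin-injective (s ◃ t) (inj₁ v) a {inj₂ u} {inj₁ w} p with origin t v a w
  origin-injective (s ◃ t) (inj₁ v) a {inj₂ u} {inj₁ w} () | just _
  origin-injective (s ◃ t) (inj₁ v) a {inj₂ u} {inj₁ w} () | nothing
  origin-injective (s ◃ t) (inj₁ v) a {inj₂ u} {inj₂ w} refl = refl
  origin-injective (s ◃ t) (inj₂ v) a {inj₁ u} {inj₁ w} refl = refl
  origin-injective (s ◃ t) (inj₂ v) a {inj₁ u} {inj₂ w} p with origin s v a w
  origin-injective (s ◃ t) (inj₂ v) a {inj₁ u} {inj₂ w} () | just _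
  origin-injective (s ◃ t) (inj₂ v) a {inj₁ u} {inj₂ w} () | nothing
  origin-injective (s ◃ t) (inj₂ v) a {inj₂ u} {inj₁ w} p with origin s v a u
  origin-injective (s ◃ t) (inj₂ v) a {inj₂ u} {inj₁ w} () | just _
  origin-injective (s ◃ t) (inj₂ v) a {inj₂ u} {inj₁ w} () | nothing
  origin-injective (s ◃ t) (inj₂ v) a {inj₂ u} {inj₂ w} p = cong inj₂ (origin-injective s v a (map-injective inj₂-injective p))

  isTop-addLeaf : ∀ t v a u → isTop (addLeaf t v a) u ≡ maybe (isTop t) false (origin t v a u)
  isTop-addLeaf (node k) _ a (inj₁ _) = refl
  isTop-addLeaf (node k) _ a (inj₂ _) = refl
  isTop-addLeaf (s ◃ t) (inj₁ v) a (inj₁ u) with origin t v a u | isTop-addLeaf t v a u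
  ... | just _  | p = p
  ... | nothing | p = p
  isTop-addLeaf (s ◃ t) (inj₁ v) a (inj₂ u) = refl
  isTop-addLeaf (s ◃ t) (inj₂ v) a (inj₁ u) = refl
  isTop-addLeaf (s ◃ t) (inj₂ v) a (inj₂ u) with origin s v a u
  ... | just _  = refl
  ... | nothing = refl

  label-addLeaf : ∀ t v a u → label (addLeaf t v a) u ≡ maybe (label t) a (origin t v a u)
  label-addLeaf (node k) _ a (inj₁ _) = refl
  label-addLeaf (node k) _ a (inj₂ _) = refl
  label-addLeaf (s ◃ t) (inj₁ v) a (inj₁ u) with origin t v a u | label-addLeaf t v a u
  ... | just _  | p = p
  ... | nothing | p = p
  label-addLeaf (s ◃ t) (inj₁ v) a (inj₂ u) = refl
  label-addLeaf (s ◃ t) (inj₂ v) a (inj₁ u) = refl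
  label-addLeaf (s ◃ t) (inj₂ v) a (inj₂ u) with origin s v a u | label-addLeaf s v a u
  ... | just _  | p = p
  ... | nothing | p = p

  edge-addLeaf : ∀ t v a u w → edge (addLeaf t v a) u w ≡ leafEdge t v (origin t v a u) (origin t v a w)
  edge-addLeaf (node k) v a (inj₁ u) (inj₁ w) = refl
  edge-addLeaf (node k) v a (inj₁ u) (inj₂ w) = refl
  edge-addLeaf (node k) v a (inj₂ u) (inj₁ w) = refl
  edge-addLeaf (node k) v a (inj₂ u) (inj₂ w) = refl
  edge-addLeaf (s ◃ t) (inj₁ v) a (inj₁ u) (inj₁ w)
    with origin t v a u | origin t v a w | edge-addLeaf t v a u w
  ... | just _  | just _  | p = p
  ... | just _  | nothing | p = p
  ... | nothing | just _  | p = p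
  ... | nothing | nothing | p = p
  edge-addLeaf (s ◃ t) (inj₁ v) a (inj₁ u) (inj₂ w) with origin t v a u | isTop-addLeaf t v a u
  ... | just _  | p = cong (_∧ isTop s w) p
  ... | nothing | p = cong (_∧ isTop s w) p
  edge-addLeaf (s ◃ t) (inj₁ v) a (inj₂ u) (inj₁ w) with origin t v a w | isTop-addLeaf t v a w
  ... | just _  | p = cong (isTop s u ∧_) p
  ... | nothing | p = trans (cong (isTop s u ∧_) p) (∧-zeroʳ (isTop s u))
  edge-addLeaf (s ◃ t) (inj₁ v) a (inj₂ u) (inj₂ w) = refl
  edge-addLeaf (s ◃ t) (inj₂ v) a (inj₁ u) (inj₁ w) = refl
  edge-addLeaf (s ◃ t) (inj₂ v) a (inj₁ u) (inj₂ w) with origin s v a w | isTop-addLeaf s v a w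
  ... | just _  | p = cong (isTop t u ∧_) p
  ... | nothing | p = trans (cong (isTop t u ∧_) p) (∧-zeroʳ (isTop t u))
  edge-addLeaf (s ◃ t) (inj₂ v) a (inj₂ u) (inj₁ w) with origin s v a u | isTop-addLeaf s v a u
  ... | just _  | p = cong (_∧ isTop t w) p
  ... | nothing | p = cong (_∧ isTop t w) p
  edge-addLeaf (s ◃ t) (inj₂ v) a (inj₂ u) (inj₂ w)
    with origin s v a u | origin s v a w | edge-addLeaf s v a u w
  ... | just _  | just _  | p = p
  ... | just _  | nothing | p = p
  ... | nothing | just _  | p = p
  ... | nothing | nothing | p = p

  data Path {A : Set} (E : A → A → Set) : A → A → Set where
    [_] : ∀ u → Path E u u
    _∷_ : ∀ {u v w} → E u v → Path E v w → Path E u w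

  module _ {A : Set} {E : A → A → Set} where

    later : ∀ {u w} → Path E u w → List A
    later [ u ] = []
    later (_∷_ {v = v} e p) = v ∷ later p

    visited : ∀ {u w} → Path E u w → List A
    visited {u} p = u ∷ later p

    join : ∀ {u v v′ w} → Path E u v → E v v′ → Path E v′ w → Path E u w
    join [ _ ] e q = e ∷ q
    join (d ∷ p) e q = d ∷ join p e q

    visited-join : ∀ {u v v′ w} (p : Path E u v) (e : E v v′) (q : Path E v′ w) →
                   visited (join p e q) ≡ visited p ++ visited q
    visited-join [ _ ] e q = refl
    visited-join {u} (d ∷ p) e q = cong (u ∷_) (visited-join p e q)

    consecutive : ∀ {u w} (p : Path E u w) (i : Fin (length (later p))) →
                  E (lookup (visited p) (inject₁ i)) (lookup (visited p) (suc i))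
    consecutive (e ∷ p) zero = e
    consecutive (e ∷ p) (suc i) = consecutive p i

    endpoint : ∀ {u w} (p : Path E u w) → lookup (visited p) (fromℕ (length (later p))) ≡ w
    endpoint [ _ ] = refl
    endpoint (e ∷ p) = endpoint p

  module _ {A B : Set} {E : A → A → Set} {F : B → B → Set} (f : A → B) (f-edge : ∀ {x y} → E x y → F (f x) (f y)) where

    mapPath : ∀ {u w} → Path E u w → Path F (f u) (f w)
    mapPath [ u ] = [ f u ]
    mapPath (e ∷ p) = f-edge e ∷ mapPath p

    visited-map : ∀ {u w} (p : Path E u w) → visited (mapPath p) ≡ map f (visited p)
    visited-map [ u ] = refl
    visited-map {u} (e ∷ p) = cong (f u ∷_) (visited-map p)

  unique-lookup : ∀ {A : Set} {xs : List A} → Unique xs → ∀ i j → lookup xs i ≡ lookup xs j → i ≡ j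
  unique-lookup (_ ∷ _) zero zero p = refl
  unique-lookup {xs = _ ∷ xs} (n ∷ _) zero (suc j) p = ⊥-elim (All.lookup n (∈-lookup {xs = xs} j) p)
  unique-lookup {xs = _ ∷ xs} (n ∷ _) (suc i) zero p = ⊥-elim (All.lookup n (∈-lookup {xs = xs} i) (sym p))
  unique-lookup (_ ∷ U) (suc i) (suc j) p = cong suc (unique-lookup U i j p)

  SimplePath : ∀ t → V t → V t → Set
  SimplePath t v w = Σ[ p ∈ Path (Edge t) v w ] Unique (visited p)

  -- A path between the two sides of a graft crosses the edge at the root just once, so its two
  -- halves are disjoint.
  simplePath : ∀ t v w → SimplePath t v w
  simplePath (node k) v w = [ v ] , ([] ∷ [])
  simplePath (s ◃ t) (inj₁ v) (inj₁ w) with simplePath t v w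
  ... | p , U = mapPath inj₁ (λ e → e) p , subst Unique (sym (visited-map inj₁ _ p)) (unique-map inj₁-injective U)
  simplePath (s ◃ t) (inj₂ v) (inj₂ w) with simplePath s v w
  ... | p , U = mapPath inj₂ (λ e → e) p , subst Unique (sym (visited-map inj₂ _ p)) (unique-map inj₂-injective U)
  simplePath (s ◃ t) (inj₁ v) (inj₂ w) with simplePath t v (top t) | simplePath s (top s) w
  ... | p , U | q , U′ = join p′ (edge-top s t) q′ , subst Unique (sym eq)
      (unique-++ (unique-map inj₁-injective U) (unique-map inj₂-injective U′) disjoint)
    where
    p′ = mapPath inj₁ (λ e → e) p
    q′ = mapPath inj₂ (λ e → e) q
    eq = trans (visited-join p′ (edge-top s t) q′) (cong₂ _++_ (visited-map inj₁ _ p) (visited-map inj₂ _ q))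
    disjoint : ∀ {x} → ¬ (x ∈ map inj₁ (visited p) × x ∈ map inj₂ (visited q))
    disjoint (a , b) with ∈-map⁻ inj₁ a | ∈-map⁻ inj₂ b
    ... | _ , _ , refl | _ , _ , ()
  simplePath (s ◃ t) (inj₂ v) (inj₁ w) with simplePath s v (top s) | simplePath t (top t) w
  ... | p , U | q , U′ = join p′ e q′ , subst Unique (sym eq)
      (unique-++ (unique-map inj₂-injective U) (unique-map inj₁-injective U′) disjoint)
    where
    e = trans (edge-sym (s ◃ t) (inj₂ (top s)) (inj₁ (top t))) (edge-top s t)
    p′ = mapPath inj₂ (λ e → e) p
    q′ = mapPath inj₁ (λ e → e) q
    eq = trans (visited-join p′ e q′) (cong₂ _++_ (visited-map inj₂ _ p) (visited-map inj₁ _ q))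
    disjoint : ∀ {x} → ¬ (x ∈ map inj₂ (visited p) × x ∈ map inj₁ (visited q))
    disjoint (a , b) with ∈-map⁻ inj₂ a | ∈-map⁻ inj₁ b
    ... | _ , _ , refl | _ , _ , ()

  module Growth (W : WeightedTree) where
    open WeightedTree W
    open Graph graph using (Adjacent; symmetric; loopless)
    open IsTree isTree

    -- An induced copy of t in W: `edges` is an equality, so it preserves non-edges too. The copy
    -- grows by one vertex at a time until it covers W.
    record Embedded (t : Rooted) : Set where
      field
        emb       : V t → Fin order
        injective : ∀ {v w} → emb v ≡ emb w → v ≡ w
        edges     : ∀ v w → adj (emb v) (emb w) ≡ edge t v w
        labels    : ∀ v → suc (label t v) ≡ weight (emb v)

    suc-pred-weight : ∀ i → suc (pred (weight i)) ≡ weight i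
    suc-pred-weight i with weight i | positive i
    ... | suc w | _ = refl

    module _ {t : Rooted} (E : Embedded t) where
      open Embedded E

      Hit : Fin order → Set
      Hit z = ∃[ v ] emb v ≡ z

      hit? : ∀ z → Dec (Hit z)
      hit? z = map′ (λ (i , p) → toV t i , p) (λ (v , p) → fromV t v , trans (cong emb (toV-fromV t v)) p)
        (any? (λ i → emb (toV t i) ≟ᶠ z))

      size≤order : size t ≤ order
      size≤order = injective⇒≤ {f = emb ∘ toV t}
        (λ {i} {j} p → trans (sym (fromV-toV t i)) (trans (cong (fromV t) (injective p)) (fromV-toV t j)))

      -- A new vertex with two old neighbours would close a cycle.
      neighbour-unique : ∀ {z v w} → ¬ Hit z → Adjacent (emb v) z → Adjacent (emb w) z → v ≡ w
      neighbour-unique {z} {v} {w} new p q with v ≟ᵛ w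
        where
        _≟ᵛ_ : ∀ v w → Dec (v ≡ w)
        v ≟ᵛ w = map′ (same⇒≡ t v w) (λ { refl → same-refl t v }) (same t v w ≟ᵇ true)
      ... | yes v≡w = v≡w
      ... | no v≢w with simplePath t v w
      ...   | path , U = ⊥-elim (acyclic (cycle (mapPath emb (λ {x} {y} e → trans (edges x y) e) path)
                (subst Unique (sym (visited-map emb _ path)) (unique-map injective U))
                (subst (All (z ≢_)) (sym (visited-map emb _ path)) (missed (visited path)))
                p q (λ eq → v≢w (injective eq))))
        where
        missed : ∀ vs → All (z ≢_) (map emb vs)
        missed [] = []
        missed (v ∷ vs) = (λ eq → new (v , sym eq)) ∷ missed vs
        cycle : ∀ {x x′} (path : Path Adjacent x x′) → Unique (visited path) → All (z ≢_) (visited path) →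
                Adjacent x z → Adjacent x′ z → x ≢ x′ → Cycle graph
        cycle [ _ ] _ _ _ _ ne = ⊥-elim (ne refl)
        cycle {x} path@(_∷_ {v = y} e path′) U missed p q _ = record
          { k        = length (later path′)
          ; vertex   = lookup (z ∷ visited path)
          ; distinct = λ {i} {j} → unique-lookup (missed ∷ U) i j
          ; step     = λ { zero → trans (symmetric z x) p ; (suc i) → consecutive path i }
          ; close    = trans (cong (λ x → adj x z) (endpoint path)) q
          }

      grow : ∀ {v z} → ¬ Hit z → Adjacent (emb v) z → Embedded (addLeaf t v (pred (weight z)))
      grow {v} {z} new p = record
        { emb = place ∘ orig
        ; injective = λ {u} {w} eq → origin-injective t v a (place-injective (orig u) (orig w) eq)
        ; edges = λ u w → trans (place-edge (orig u) (orig w)) (sym (edge-addLeaf t v a u w))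
        ; labels = λ u → trans (cong suc (label-addLeaf t v a u)) (place-label (orig u))
        }
        where
        a = pred (weight z)
        orig = origin t v a
        place : Maybe (V t) → Fin order
        place = maybe emb z
        place-injective : ∀ x y → place x ≡ place y → x ≡ y
        place-injective (just x) (just y) eq = cong just (injective eq)
        place-injective (just x) nothing eq = ⊥-elim (new (x , eq))
        place-injective nothing (just y) eq = ⊥-elim (new (y , sym eq))
        place-injective nothing nothing eq = refl
        to-leaf : ∀ x → adj (emb x) z ≡ same t x v
        to-leaf x with adj (emb x) z in q
        ... | true = sym (trans (cong (λ x → same t x v) (neighbour-unique new q p)) (same-refl t v))
        ... | false with same t x v in r
        ...   | false = refl
        ...   | true = trans (sym q) (trans (cong (λ x → adj (emb x) z) (same⇒≡ t x v r)) p)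
        place-edge : ∀ x y → adj (place x) (place y) ≡ leafEdge t v x y
        place-edge (just x) (just y) = edges x y
        place-edge (just x) nothing = to-leaf x
        place-edge nothing (just y) = trans (symmetric z (emb y)) (to-leaf y)
        place-edge nothing nothing = loopless z
        place-label : ∀ x → suc (maybe (label t) a x) ≡ weight (place x)
        place-label (just x) = labels x
        place-label nothing = suc-pred-weight z

      exit : ∀ {y z} → Hit y → ¬ Hit z → Star Adjacent y z → ∃[ v ] ∃[ z′ ] ¬ Hit z′ × Adjacent (emb v) z′
      exit h n ε = ⊥-elim (n h)
      exit (v , refl) n (_◅_ {j = y′} e es) with hit? y′
      ... | yes h = exit h n es
      ... | no ¬h = v , y′ , ¬h , e

      finished : (∀ z → Hit z) → toTree t ≅ W
      finished h = record
        { bijection = mk↔ₛ′ (emb ∘ toV t) (λ z → fromV t (proj₁ (h z)))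
            (λ z → trans (cong emb (toV-fromV t _)) (proj₂ (h z)))
            (λ i → trans (cong (fromV t) (injective (proj₂ (h _)))) (fromV-toV t i))
        ; adj-preserving = λ i j → edges (toV t i) (toV t j)
        ; weight-preserving = λ i → sym (labels (toV t i))
        }

    extra-addLeaf : ∀ t v a → extra (addLeaf t v a) ≡ suc (extra t)
    extra-addLeaf (node k) v a = refl
    extra-addLeaf (s ◃ t) (inj₁ v) a = cong (_+ suc (extra s)) (extra-addLeaf t v a)
    extra-addLeaf (s ◃ t) (inj₂ v) a = trans (cong (λ n → extra t + suc n) (extra-addLeaf s v a)) (+-suc (extra t) _)

    -- Each step adds a vertex, and an embedded tree has at most `order` of them. Without fuel the
    -- bound would give order ≤ `extra` t, one less than the size of t, which is impossible.
    fill : ∀ fuel {t} → Embedded t → order ≤ extra t + fuel → ∃[ t′ ] toTree t′ ≅ W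
    fill zero {t} E p = ⊥-elim (<⇒≱ (size≤order E) (≤-trans p (≤-reflexive (+-identityʳ _))))
    fill (suc fuel) {t} E p with all? (hit? E)
    ... | yes h = t , finished E h
    ... | no ¬h with ¬∀⟶∃¬ order (Hit E) (hit? E) ¬h
    ...   | z , n with exit E (top t , refl) n (connected (Embedded.emb E (top t)) z)
    ...     | v , z′ , n′ , e = fill fuel (grow E n′ e)
              (≤-trans p (≤-reflexive (trans (+-suc (extra t) fuel) (cong (_+ fuel) (sym (extra-addLeaf t v _))))))

    fromTree : ∃[ t ] toTree t ≅ W
    fromTree = fill order {node (pred (weight i₀))} (record
      { emb = λ _ → i₀ ; injective = λ _ → refl ; edges = λ _ _ → loopless i₀ ; labels = λ _ → suc-pred-weight i₀ }) ≤-refl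
      where i₀ = fromℕ< nonempty

  open Growth public using (fromTree)

-- Coefficient lists form a commutative ring

module Polynomials where

  open import Data.Integer.Base as ℤ using (ℤ; +_; 0ℤ; 1ℤ)
  import Data.Integer.Properties as ℤ
  open import Data.Integer.Tactic.RingSolver using (solve-∀)
  open import Data.List.Base using (map)
  open import Level using (0ℓ)
  open import Relation.Binary.Bundles using (Setoid)
  open import Relation.Binary.PropositionalEquality
  import Relation.Binary.Reasoning.Setoid

  infixr 7 _·_

  _·_ : ℤ → Poly → Poly
  a · p = map (a ℤ.*_) p

  coeff-+ : ∀ p q k → coeff (p +ₚ q) k ≡ coeff p k ℤ.+ coeff q k
  coeff-+ [] q k = sym (ℤ.+-identityˡ _)
  coeff-+ (a ∷ p) [] k = sym (ℤ.+-identityʳ _)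
  coeff-+ (a ∷ p) (b ∷ q) zero = refl
  coeff-+ (a ∷ p) (b ∷ q) (suc k) = coeff-+ p q k

  coeff-· : ∀ a p k → coeff (a · p) k ≡ a ℤ.* coeff p k
  coeff-· a [] k = sym (ℤ.*-zeroʳ a)
  coeff-· a (b ∷ p) zero = refl
  coeff-· a (b ∷ p) (suc k) = coeff-· a p k

  coeff-neg : ∀ p k → coeff (map ℤ.-_ p) k ≡ ℤ.- coeff p k
  coeff-neg [] k = refl
  coeff-neg (b ∷ p) zero = refl
  coeff-neg (b ∷ p) (suc k) = coeff-neg p k

  -- _≈ₚ_ unfolds to a function type, from which p and q cannot be inferred.
  infix 4 _≋_

  record _≋_ (p q : Poly) : Set where
    constructor wrap
    field
      coeffs : p ≈ₚ q

  open _≋_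

  ≋-refl : ∀ {p} → p ≋ p
  ≋-refl = wrap λ _ → refl

  ≋-sym : ∀ {p q} → p ≋ q → q ≋ p
  ≋-sym e = wrap λ k → sym (coeffs e k)

  ≋-trans : ∀ {p q r} → p ≋ q → q ≋ r → p ≋ r
  ≋-trans e f = wrap λ k → trans (coeffs e k) (coeffs f k)

  polySetoid : Setoid 0ℓ 0ℓ
  polySetoid = record
    { Carrier = Poly
    ; _≈_ = _≋_
    ; isEquivalence = record { refl = ≋-refl ; sym = ≋-sym ; trans = ≋-trans }
    }

  open Relation.Binary.Reasoning.Setoid polySetoid

  +ₚ-cong : ∀ {p p′ q q′} → p ≋ p′ → q ≋ q′ → p +ₚ q ≋ p′ +ₚ q′
  +ₚ-cong {p} {p′} {q} {q′} e f = wrap λ k →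
    trans (coeff-+ p q k) (trans (cong₂ ℤ._+_ (coeffs e k) (coeffs f k)) (sym (coeff-+ p′ q′ k)))

  ·-cong : ∀ a {p q} → p ≋ q → a · p ≋ a · q
  ·-cong a {p} {q} e = wrap λ k → trans (coeff-· a p k) (trans (cong (a ℤ.*_) (coeffs e k)) (sym (coeff-· a q k)))

  ∷-cong : ∀ {a b p q} → a ≡ b → p ≋ q → a ∷ p ≋ b ∷ q
  ∷-cong e f = wrap λ { zero → e ; (suc k) → coeffs f k }

  +ₚ-assoc : ∀ p q r → (p +ₚ q) +ₚ r ≋ p +ₚ (q +ₚ r)
  +ₚ-assoc p q r = wrap coefficient
    where
    coefficient : (p +ₚ q) +ₚ r ≈ₚ p +ₚ (q +ₚ r)
    coefficient k rewrite coeff-+ (p +ₚ q) r k | coeff-+ p q k | coeff-+ p (q +ₚ r) k | coeff-+ q r k =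
      ℤ.+-assoc (coeff p k) _ _

  +ₚ-comm : ∀ p q → p +ₚ q ≋ q +ₚ p
  +ₚ-comm p q = wrap coefficient
    where
    coefficient : p +ₚ q ≈ₚ q +ₚ p
    coefficient k rewrite coeff-+ p q k | coeff-+ q p k = ℤ.+-comm (coeff p k) _

  +ₚ-identityʳ : ∀ p → p +ₚ [] ≋ p
  +ₚ-identityʳ p = wrap λ k → trans (coeff-+ p [] k) (ℤ.+-identityʳ _)

  +ₚ-inverseʳ : ∀ p → p +ₚ map ℤ.-_ p ≋ []
  +ₚ-inverseʳ p = wrap coefficient
    where
    coefficient : p +ₚ map ℤ.-_ p ≈ₚ []
    coefficient k rewrite coeff-+ p (map ℤ.-_ p) k | coeff-neg p k = ℤ.+-inverseʳ (coeff p k)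

  +ₚ-interchange : ∀ p q r s → (p +ₚ q) +ₚ (r +ₚ s) ≋ (p +ₚ r) +ₚ (q +ₚ s)
  +ₚ-interchange p q r s = wrap coefficient
    where
    coefficient : (p +ₚ q) +ₚ (r +ₚ s) ≈ₚ (p +ₚ r) +ₚ (q +ₚ s)
    coefficient k
      rewrite coeff-+ (p +ₚ q) (r +ₚ s) k | coeff-+ p q k | coeff-+ r s k
            | coeff-+ (p +ₚ r) (q +ₚ s) k | coeff-+ p r k | coeff-+ q s k =
      eq (coeff p k) (coeff q k) (coeff r k) (coeff s k)
      where
      eq : ∀ a b c d → (a ℤ.+ b) ℤ.+ (c ℤ.+ d) ≡ (a ℤ.+ c) ℤ.+ (b ℤ.+ d)
      eq = solve-∀

  ·-distrib-+ : ∀ a p q → a · (p +ₚ q) ≋ a · p +ₚ a · q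
  ·-distrib-+ a p q = wrap coefficient
    where
    coefficient : a · (p +ₚ q) ≈ₚ a · p +ₚ a · q
    coefficient k
      rewrite coeff-· a (p +ₚ q) k | coeff-+ p q k | coeff-+ (a · p) (a · q) k | coeff-· a p k | coeff-· a q k =
      ℤ.*-distribˡ-+ a (coeff p k) (coeff q k)

  ·-· : ∀ a b p → a · (b · p) ≋ (a ℤ.* b) · p
  ·-· a b p = wrap coefficient
    where
    coefficient : a · (b · p) ≈ₚ (a ℤ.* b) · p
    coefficient k rewrite coeff-· a (b · p) k | coeff-· b p k | coeff-· (a ℤ.* b) p k = sym (ℤ.*-assoc a b _)

  ·-zeroˡ : ∀ p → 0ℤ · p ≋ []
  ·-zeroˡ p = wrap λ k → trans (coeff-· 0ℤ p k) (ℤ.*-zeroˡ (coeff p k))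

  ·-identityˡ : ∀ p → 1ℤ · p ≋ p
  ·-identityˡ p = wrap λ k → trans (coeff-· 1ℤ p k) (ℤ.*-identityˡ (coeff p k))

  0∷-distrib-+ : ∀ p q → 0ℤ ∷ (p +ₚ q) ≋ (0ℤ ∷ p) +ₚ (0ℤ ∷ q)
  0∷-distrib-+ p q = wrap λ { zero → refl ; (suc k) → refl }

  ·-0∷ : ∀ a p → a · (0ℤ ∷ p) ≋ 0ℤ ∷ (a · p)
  ·-0∷ a p = wrap λ { zero → ℤ.*-zeroʳ a ; (suc k) → refl }

  0∷[] : 0ℤ ∷ [] ≋ []
  0∷[] = wrap λ { zero → refl ; (suc k) → refl }

  *ₚ-congˡ : ∀ p {q r} → q ≋ r → p *ₚ q ≋ p *ₚ r
  *ₚ-congˡ [] e = ≋-refl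
  *ₚ-congˡ (a ∷ p) e = +ₚ-cong (·-cong a e) (∷-cong refl (*ₚ-congˡ p e))

  *ₚ-zeroʳ : ∀ p → p *ₚ [] ≋ []
  *ₚ-zeroʳ [] = ≋-refl
  *ₚ-zeroʳ (a ∷ p) = ≋-trans (∷-cong refl (*ₚ-zeroʳ p)) 0∷[]

  -- The defining recursion of the product, mirrored to the right factor; commutativity follows from
  -- the two by induction.
  *ₚ-∷ : ∀ q a p → q *ₚ (a ∷ p) ≋ a · q +ₚ (0ℤ ∷ (q *ₚ p))
  *ₚ-∷ [] a p = ≋-sym 0∷[]
  *ₚ-∷ (b ∷ q) a p = begin
    (b ℤ.* a ℤ.+ 0ℤ) ∷ (b · p +ₚ (q *ₚ (a ∷ p)))
      ≈⟨ ∷-cong (cong (ℤ._+ 0ℤ) (ℤ.*-comm b a)) (≋-trans (+ₚ-cong ≋-refl (*ₚ-∷ q a p)) rearrange) ⟩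
    (a ℤ.* b ℤ.+ 0ℤ) ∷ (a · q +ₚ (b · p +ₚ (0ℤ ∷ (q *ₚ p)))) ∎
    where
    X = 0ℤ ∷ (q *ₚ p)
    rearrange : b · p +ₚ (a · q +ₚ X) ≋ a · q +ₚ (b · p +ₚ X)
    rearrange = begin
      b · p +ₚ (a · q +ₚ X) ≈⟨ +ₚ-assoc (b · p) (a · q) X ⟨
      b · p +ₚ a · q +ₚ X   ≈⟨ +ₚ-cong (+ₚ-comm (b · p) (a · q)) ≋-refl ⟩
      a · q +ₚ b · p +ₚ X   ≈⟨ +ₚ-assoc (a · q) (b · p) X ⟩
      a · q +ₚ (b · p +ₚ X) ∎

  *ₚ-comm : ∀ p q → p *ₚ q ≋ q *ₚ p
  *ₚ-comm [] q = ≋-sym (*ₚ-zeroʳ q)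
  *ₚ-comm (a ∷ p) q = begin
    a · q +ₚ (0ℤ ∷ (p *ₚ q)) ≈⟨ +ₚ-cong ≋-refl (∷-cong refl (*ₚ-comm p q)) ⟩
    a · q +ₚ (0ℤ ∷ (q *ₚ p)) ≈⟨ *ₚ-∷ q a p ⟨
    q *ₚ (a ∷ p)             ∎

  *ₚ-congʳ : ∀ r {p q} → p ≋ q → p *ₚ r ≋ q *ₚ r
  *ₚ-congʳ r {p} {q} e = begin
    p *ₚ r ≈⟨ *ₚ-comm p r ⟩
    r *ₚ p ≈⟨ *ₚ-congˡ r e ⟩
    r *ₚ q ≈⟨ *ₚ-comm r q ⟩
    q *ₚ r ∎

  *ₚ-distribˡ : ∀ p q r → p *ₚ (q +ₚ r) ≋ p *ₚ q +ₚ p *ₚ r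
  *ₚ-distribˡ [] q r = ≋-refl
  *ₚ-distribˡ (a ∷ p) q r = begin
    a · (q +ₚ r) +ₚ (0ℤ ∷ (p *ₚ (q +ₚ r)))
      ≈⟨ +ₚ-cong (·-distrib-+ a q r) (≋-trans (∷-cong refl (*ₚ-distribˡ p q r)) (0∷-distrib-+ (p *ₚ q) (p *ₚ r))) ⟩
    (a · q +ₚ a · r) +ₚ ((0ℤ ∷ (p *ₚ q)) +ₚ (0ℤ ∷ (p *ₚ r)))
      ≈⟨ +ₚ-interchange (a · q) (a · r) (0ℤ ∷ (p *ₚ q)) (0ℤ ∷ (p *ₚ r)) ⟩
    (a · q +ₚ (0ℤ ∷ (p *ₚ q))) +ₚ (a · r +ₚ (0ℤ ∷ (p *ₚ r))) ∎

  *ₚ-distribʳ : ∀ r p q → (p +ₚ q) *ₚ r ≋ p *ₚ r +ₚ q *ₚ r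
  *ₚ-distribʳ r p q = begin
    (p +ₚ q) *ₚ r     ≈⟨ *ₚ-comm (p +ₚ q) r ⟩
    r *ₚ (p +ₚ q)     ≈⟨ *ₚ-distribˡ r p q ⟩
    r *ₚ p +ₚ r *ₚ q  ≈⟨ +ₚ-cong (*ₚ-comm r p) (*ₚ-comm r q) ⟩
    p *ₚ r +ₚ q *ₚ r  ∎

  ·-*ₚ : ∀ a p q → (a · p) *ₚ q ≋ a · (p *ₚ q)
  ·-*ₚ a [] q = ≋-refl
  ·-*ₚ a (b ∷ p) q = begin
    (a ℤ.* b) · q +ₚ (0ℤ ∷ ((a · p) *ₚ q))
      ≈⟨ +ₚ-cong (≋-sym (·-· a b q)) (∷-cong refl (·-*ₚ a p q)) ⟩
    a · (b · q) +ₚ (0ℤ ∷ (a · (p *ₚ q)))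
      ≈⟨ +ₚ-cong ≋-refl (·-0∷ a (p *ₚ q)) ⟨
    a · (b · q) +ₚ a · (0ℤ ∷ (p *ₚ q))
      ≈⟨ ·-distrib-+ a (b · q) (0ℤ ∷ (p *ₚ q)) ⟨
    a · (b · q +ₚ (0ℤ ∷ (p *ₚ q))) ∎

  0∷-*ₚ : ∀ p q → (0ℤ ∷ p) *ₚ q ≋ 0ℤ ∷ (p *ₚ q)
  0∷-*ₚ p q = +ₚ-cong (·-zeroˡ q) ≋-refl

  *ₚ-assoc : ∀ p q r → (p *ₚ q) *ₚ r ≋ p *ₚ (q *ₚ r)
  *ₚ-assoc [] q r = ≋-refl
  *ₚ-assoc (a ∷ p) q r = begin
    (a · q +ₚ (0ℤ ∷ (p *ₚ q))) *ₚ r        ≈⟨ *ₚ-distribʳ r (a · q) (0ℤ ∷ (p *ₚ q)) ⟩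
    (a · q) *ₚ r +ₚ (0ℤ ∷ (p *ₚ q)) *ₚ r
      ≈⟨ +ₚ-cong (·-*ₚ a q r) (≋-trans (0∷-*ₚ (p *ₚ q) r) (∷-cong refl (*ₚ-assoc p q r))) ⟩
    a · (q *ₚ r) +ₚ (0ℤ ∷ (p *ₚ (q *ₚ r))) ∎

  *ₚ-identityˡ : ∀ p → (1ℤ ∷ []) *ₚ p ≋ p
  *ₚ-identityˡ p = begin
    1ℤ · p +ₚ (0ℤ ∷ []) ≈⟨ +ₚ-cong (·-identityˡ p) 0∷[] ⟩
    p +ₚ []             ≈⟨ +ₚ-identityʳ p ⟩
    p                   ∎

  polyRing : CommutativeRing 0ℓ 0ℓ
  polyRing = record
    { Carrier = Poly
    ; _≈_ = _≈ₚ_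
    ; _+_ = _+ₚ_
    ; _*_ = _*ₚ_
    ; -_  = map (ℤ.-_)
    ; 0#  = []
    ; 1#  = 1ℤ ∷ []
    ; isCommutativeRing = record
      { isRing = record
        { +-isAbelianGroup = record
          { isGroup = record
            { isMonoid = record
              { isSemigroup = record
                { isMagma = record
                  { isEquivalence = record
                    { refl = λ _ → refl ; sym = λ e k → sym (e k) ; trans = λ e f k → trans (e k) (f k) }
                  ; ∙-cong = λ {p} {q} {r} {s} e f → coeffs (+ₚ-cong {p} {q} {r} {s} (wrap e) (wrap f)) }
                ; assoc = λ p q r → coeffs (+ₚ-assoc p q r) }
              ; identity = (λ p _ → refl) , (λ p → coeffs (+ₚ-identityʳ p)) }
            ; inverse = (λ p → coeffs (≋-trans (+ₚ-comm (map ℤ.-_ p) p) (+ₚ-inverseʳ p)))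
                      , (λ p → coeffs (+ₚ-inverseʳ p))
            ; ⁻¹-cong = λ {p} {q} e k → trans (coeff-neg p k) (trans (cong ℤ.-_ (e k)) (sym (coeff-neg q k))) }
          ; comm = λ p q → coeffs (+ₚ-comm p q) }
        ; *-cong = λ {p} {q} {r} {s} e f → coeffs (≋-trans (*ₚ-congʳ r {p} {q} (wrap e)) (*ₚ-congˡ q {r} {s} (wrap f)))
        ; *-assoc = λ p q r → coeffs (*ₚ-assoc p q r)
        ; *-identity = (λ p → coeffs (*ₚ-identityˡ p))
                     , (λ p → coeffs (≋-trans (*ₚ-comm p (1ℤ ∷ [])) (*ₚ-identityˡ p)))
        ; distrib = (λ p q r → coeffs (*ₚ-distribˡ p q r)) , (λ r p q → coeffs (*ₚ-distribʳ r p q))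
        }
      ; *-comm = λ p q → coeffs (*ₚ-comm p q)
      }
    }

-- Determinants through the exterior algebra

module Determinants {c ℓ} (R : CommutativeRing c ℓ) where

  open import Algebra.Bundles.Raw using (RawRing)
  open import Data.Fin.Base using (punchIn; punchOut)
  open import Data.Fin.Properties using (punchIn-punchOut; punchOut-injective)
  open import Data.Maybe.Base using (nothing)
  open import Data.Vec.Base using (Vec; []; _∷_; replicate; insertAt)
  open import Relation.Binary.PropositionalEquality as ≡ using (_≡_; _≢_; cong)
  open import Tactic.RingSolver using (solve-∀)
  open import Tactic.RingSolver.Core.AlmostCommutativeRing using (AlmostCommutativeRing; fromCommutativeRing)

  open CommutativeRing R hiding (_-_; zero)
  open import Algebra.Properties.Ring ring
  open RawRing rawRing using (rawSemiring)
  open import Algebra.Definitions.RawSemiring rawSemiring using (sum; _^_)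
  open Defs.Determinant rawRing using (det)
  open import Relation.Binary.Reasoning.Setoid setoid

  private
    acr : AlmostCommutativeRing c ℓ
    acr = fromCommutativeRing R (λ _ → nothing)

  open AlmostCommutativeRing acr using () renaming (_≈_ to _≋_; _+_ to _⊕_; _*_ to _⊗_; -_ to ⊖_)

  Vector : ℕ → Set c
  Vector m = Fin m → Carrier

  -- An element of the exterior algebra, as the family of its coefficients: the entry at S
  -- is that of the product, in increasing order, of the basis vectors selected by S.
  Form : ℕ → Set c
  Form m = Vec Bool m → Carrier

  -- The product v ∧ ω. When the first basis vector comes from ω, the rest of v has to pass it,
  -- hence the sign.
  wedge : ∀ {m} → Vector m → Form m → Form m
  wedge v ω []          = 0#
  wedge v ω (false ∷ S) = wedge (v ∘ suc) (ω ∘ (false ∷_)) S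
  wedge v ω (true ∷ S)  = v zero * ω (false ∷ S) + - wedge (v ∘ suc) (ω ∘ (true ∷_)) S

  full : ∀ m → Vec Bool m
  full m = replicate m true

  unit : ∀ {m} → Form m
  unit []          = 1#
  unit (false ∷ S) = unit S
  unit (true ∷ S)  = 0#

  neg-sub : ∀ a b → - (a + - b) ≈ - a + b
  neg-sub a b = trans (sym (-‿+-comm a (- b))) (+-congˡ (-‿involutive b))

  wedge-cong : ∀ {m} {v w : Vector m} {ω η : Form m} → (∀ i → v i ≈ w i) → (∀ S → ω S ≈ η S) →
               ∀ S → wedge v ω S ≈ wedge w η S
  wedge-cong p q []          = refl
  wedge-cong p q (false ∷ S) = wedge-cong (p ∘ suc) (q ∘ (false ∷_)) S
  wedge-cong p q (true ∷ S)  = +-cong (*-cong (p zero) (q _)) (-‿cong (wedge-cong (p ∘ suc) (q ∘ (true ∷_)) S))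

  wedge-congʳ : ∀ {m} (v : Vector m) {ω η : Form m} → (∀ S → ω S ≈ η S) → ∀ S → wedge v ω S ≈ wedge v η S
  wedge-congʳ v = wedge-cong (λ _ → refl)

  linear-step : ∀ v a b x y p q →
    v * (a * x + b * y) + - (a * p + b * q) ≈ a * (v * x + - p) + b * (v * y + - q)
  linear-step v a b x y p q = begin
    v * (a * x + b * y) + - (a * p + b * q)                  ≈⟨ +-congˡ (-1*x≈-x _) ⟨
    v * (a * x + b * y) + - 1# * (a * p + b * q)             ≈⟨ shuffle (- 1#) v a b x y p q ⟩
    a * (v * x + - 1# * p) + b * (v * y + - 1# * q)          ≈⟨ +-cong (*-congˡ (+-congˡ (-1*x≈-x p))) (*-congˡ (+-congˡ (-1*x≈-x q))) ⟩
    a * (v * x + - p) + b * (v * y + - q)                    ∎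
    where
    shuffle : ∀ u v a b x y p q →
      v ⊗ (a ⊗ x ⊕ b ⊗ y) ⊕ u ⊗ (a ⊗ p ⊕ b ⊗ q) ≋ a ⊗ (v ⊗ x ⊕ u ⊗ p) ⊕ b ⊗ (v ⊗ y ⊕ u ⊗ q)
    shuffle = solve-∀ acr

  wedge-linear : ∀ {m} (v : Vector m) a b (ω η : Form m) S →
                 wedge v (λ S → a * ω S + b * η S) S ≈ a * wedge v ω S + b * wedge v η S
  wedge-linear v a b ω η [] = sym (trans (+-cong (zeroʳ a) (zeroʳ b)) (+-identityʳ 0#))
  wedge-linear v a b ω η (false ∷ S) = wedge-linear (v ∘ suc) a b _ _ S
  wedge-linear v a b ω η (true ∷ S) = trans (+-congˡ (-‿cong (wedge-linear (v ∘ suc) a b _ _ S)))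
    (linear-step (v zero) a b _ _ _ _)

  Linear : ∀ {m n} → (Form m → Form n) → Set _
  Linear {m} {n} L = ∀ a b (ω η : Form m) S → L (λ S → a * ω S + b * η S) S ≈ a * L ω S + b * L η S

  Congruent : ∀ {m n} → (Form m → Form n) → Set _
  Congruent L = ∀ {ω η} → (∀ S → ω S ≈ η S) → ∀ S → L ω S ≈ L η S

  module _ {m n} (L : Form m → Form n) (cong-L : Congruent L) (linear : Linear L) where

    linear-scale : ∀ a ω S → L (λ S → a * ω S) S ≈ a * L ω S
    linear-scale a ω S = begin
      L (λ S → a * ω S) S            ≈⟨ cong-L (λ S → trans (sym (+-identityʳ _)) (+-congˡ (sym (zeroˡ (ω S))))) S ⟩
      L (λ S → a * ω S + 0# * ω S) S ≈⟨ linear a 0# ω ω S ⟩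
      a * L ω S + 0# * L ω S         ≈⟨ trans (+-congˡ (zeroˡ _)) (+-identityʳ _) ⟩
      a * L ω S                      ∎

    linear-zero : ∀ S → L (λ _ → 0#) S ≈ 0#
    linear-zero S = begin
      L (λ _ → 0#) S      ≈⟨ cong-L (λ _ → sym (zeroˡ 0#)) S ⟩
      L (λ _ → 0# * 0#) S ≈⟨ linear-scale 0# (λ _ → 0#) S ⟩
      0# * L (λ _ → 0#) S ≈⟨ zeroˡ _ ⟩
      0#                  ∎

    linear-neg : ∀ ω S → L (λ S → - ω S) S ≈ - L ω S
    linear-neg ω S = begin
      L (λ S → - ω S) S      ≈⟨ cong-L (λ S → sym (-1*x≈-x (ω S))) S ⟩
      L (λ S → - 1# * ω S) S ≈⟨ linear-scale (- 1#) ω S ⟩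
      - 1# * L ω S           ≈⟨ -1*x≈-x _ ⟩
      - L ω S                ∎

    linear-sub : ∀ a ω η S → L (λ S → a * ω S + - η S) S ≈ a * L ω S + - L η S
    linear-sub a ω η S = begin
      L (λ S → a * ω S + - η S) S      ≈⟨ cong-L (λ S → +-congˡ (sym (-1*x≈-x (η S)))) S ⟩
      L (λ S → a * ω S + - 1# * η S) S ≈⟨ linear a (- 1#) ω η S ⟩
      a * L ω S + - 1# * L η S         ≈⟨ +-congˡ (-1*x≈-x _) ⟩
      a * L ω S + - L η S              ∎

  wedge-scale : ∀ {m} (v : Vector m) a (ω : Form m) S → wedge v (λ S → a * ω S) S ≈ a * wedge v ω S
  wedge-scale v = linear-scale (wedge v) (wedge-congʳ v) (wedge-linear v)

  wedge-neg : ∀ {m} (v : Vector m) (ω : Form m) S → wedge v (λ S → - ω S) S ≈ - wedge v ω S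
  wedge-neg v = linear-neg (wedge v) (wedge-congʳ v) (wedge-linear v)

  wedge-sub : ∀ {m} (v : Vector m) a (ω η : Form m) S →
              wedge v (λ S → a * ω S + - η S) S ≈ a * wedge v ω S + - wedge v η S
  wedge-sub v = linear-sub (wedge v) (wedge-congʳ v) (wedge-linear v)

  wedge-zeroˡ : ∀ {m} (v : Vector m) (ω : Form m) → (∀ i → v i ≈ 0#) → ∀ S → wedge v ω S ≈ 0#
  wedge-zeroˡ v ω p [] = refl
  wedge-zeroˡ v ω p (false ∷ S) = wedge-zeroˡ (v ∘ suc) _ (p ∘ suc) S
  wedge-zeroˡ v ω p (true ∷ S) = begin
    v zero * ω (false ∷ S) + - wedge (v ∘ suc) (ω ∘ (true ∷_)) S
      ≈⟨ +-cong (*-congʳ (p zero)) (-‿cong (wedge-zeroˡ (v ∘ suc) _ (p ∘ suc) S)) ⟩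
    0# * ω (false ∷ S) + - 0# ≈⟨ +-cong (zeroˡ _) -0#≈0# ⟩
    0# + 0#                   ≈⟨ +-identityʳ 0# ⟩
    0#                        ∎

  wedge-negˡ : ∀ {m} (v : Vector m) (ω : Form m) S → wedge (λ i → - v i) ω S ≈ - wedge v ω S
  wedge-negˡ v ω [] = sym -0#≈0#
  wedge-negˡ v ω (false ∷ S) = wedge-negˡ (v ∘ suc) _ S
  wedge-negˡ v ω (true ∷ S) = trans (+-cong (sym (-‿distribˡ-* _ _)) (-‿cong (wedge-negˡ (v ∘ suc) _ S))) (-‿+-comm _ _)

  wedge-anticomm : ∀ {m} (v w : Vector m) (ω : Form m) S → wedge v (wedge w ω) S ≈ - wedge w (wedge v ω) S
  wedge-anticomm v w ω [] = sym -0#≈0#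
  wedge-anticomm v w ω (false ∷ S) = wedge-anticomm (v ∘ suc) (w ∘ suc) _ S
  wedge-anticomm v w ω (true ∷ S) = begin
    v zero * A + - wedge v′ (λ S → w zero * ω (false ∷ S) + - wedge w′ (ω ∘ (true ∷_)) S) S
      ≈⟨ +-congˡ (-‿cong (wedge-sub v′ (w zero) _ _ S)) ⟩
    v zero * A + - (w zero * B + - X) ≈⟨ +-congˡ (neg-sub _ _) ⟩
    v zero * A + (- (w zero * B) + X) ≈⟨ +-congˡ (+-congˡ (wedge-anticomm v′ w′ _ S)) ⟩
    v zero * A + (- (w zero * B) + - Y) ≈⟨ shuffle (v zero * A) (w zero * B) Y ⟩
    - (w zero * B) + (v zero * A + - Y) ≈⟨ neg-sub _ _ ⟨
    - (w zero * B + - (v zero * A + - Y)) ≈⟨ -‿cong (+-congˡ (-‿cong (wedge-sub w′ (v zero) _ _ S))) ⟨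
    - (w zero * B + - wedge w′ (λ S → v zero * ω (false ∷ S) + - wedge v′ (ω ∘ (true ∷_)) S) S) ∎
    where
    v′ = v ∘ suc
    w′ = w ∘ suc
    A = wedge w′ (ω ∘ (false ∷_)) S
    B = wedge v′ (ω ∘ (false ∷_)) S
    X = wedge v′ (wedge w′ (ω ∘ (true ∷_))) S
    Y = wedge w′ (wedge v′ (ω ∘ (true ∷_))) S
    shuffle : ∀ a b y → a ⊕ (⊖ b ⊕ ⊖ y) ≋ ⊖ b ⊕ (a ⊕ ⊖ y)
    shuffle = solve-∀ acr

  drop : ∀ {m} → Fin (suc m) → Form (suc m) → Form m
  drop j ω S = ω (insertAt S j false)

  drop-wedge : ∀ {m} (j : Fin (suc m)) v ω S → drop j (wedge v ω) S ≈ wedge (v ∘ punchIn j) (drop j ω) S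
  drop-wedge zero v ω S = refl
  drop-wedge (suc j) v ω (false ∷ S) = drop-wedge j (v ∘ suc) (ω ∘ (false ∷_)) S
  drop-wedge (suc j) v ω (true ∷ S)  = +-congˡ (-‿cong (drop-wedge j (v ∘ suc) (ω ∘ (true ∷_)) S))

  drop-unit : ∀ {m} (j : Fin (suc m)) S → drop j unit S ≈ unit S
  drop-unit zero S = refl
  drop-unit (suc j) (false ∷ S) = drop-unit j S
  drop-unit (suc j) (true ∷ S) = refl

  sum-cong : ∀ {m} {f g : Vector m} → (∀ i → f i ≈ g i) → sum f ≈ sum g
  sum-cong {zero} p = refl
  sum-cong {suc m} p = +-cong (p zero) (sum-cong (p ∘ suc))

  sum-neg : ∀ {m} (f : Vector m) → - sum f ≈ sum (λ i → - f i)
  sum-neg {zero} f = -0#≈0#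
  sum-neg {suc m} f = trans (sym (-‿+-comm _ _)) (+-congˡ (sum-neg (f ∘ suc)))

  wedge-expand : ∀ {m} (v : Vector (suc m)) ω →
    wedge v ω (full (suc m)) ≈ sum (λ j → (- 1#) ^ toℕ j * v j * drop j ω (full m))
  wedge-expand {zero} v ω = +-cong (*-congʳ (sym (*-identityˡ _))) -0#≈0#
  wedge-expand {suc m} v ω = +-cong (*-congʳ (sym (*-identityˡ _)))
    (trans (-‿cong (wedge-expand (v ∘ suc) (ω ∘ (true ∷_))))
    (trans (sum-neg (λ j → (- 1#) ^ toℕ j * v (suc j) * drop j (ω ∘ (true ∷_)) (full m)))
           (sum-cong λ j → signs ((- 1#) ^ toℕ j) (v (suc j)) (drop j (ω ∘ (true ∷_)) (full m)))))
    where
    signs : ∀ s a b → - (s * a * b) ≈ - 1# * s * a * b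
    signs s a b = trans (-‿distribˡ-* _ _) (*-congʳ (trans (-‿distribˡ-* _ _) (*-congʳ (sym (-1*x≈-x s)))))

  wedges : ∀ {k m} → (Fin k → Vector m) → Form m → Form m
  wedges {zero}  M ω = ω
  wedges {suc k} M ω = wedge (M zero) (wedges (M ∘ suc) ω)

  wedges-cong : ∀ {k m} {M N : Fin k → Vector m} {ω η : Form m} → (∀ i j → M i j ≈ N i j) → (∀ S → ω S ≈ η S) →
                ∀ S → wedges M ω S ≈ wedges N η S
  wedges-cong {zero} p q = q
  wedges-cong {suc k} p q = wedge-cong (p zero) (wedges-cong (p ∘ suc) q)

  wedges-congʳ : ∀ {k m} (M : Fin k → Vector m) {ω η : Form m} → (∀ S → ω S ≈ η S) →
                 ∀ S → wedges M ω S ≈ wedges M η S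
  wedges-congʳ M = wedges-cong {M = M} {N = M} (λ _ _ → refl)

  wedges-linear : ∀ {k m} (M : Fin k → Vector m) → Linear (wedges M)
  wedges-linear {zero} M a b ω η S = refl
  wedges-linear {suc k} M a b ω η S =
    trans (wedge-congʳ (M zero) (wedges-linear (M ∘ suc) a b ω η) S) (wedge-linear (M zero) a b _ _ S)

  wedges-scale : ∀ {k m} (M : Fin k → Vector m) a ω S → wedges M (λ S → a * ω S) S ≈ a * wedges M ω S
  wedges-scale M = linear-scale (wedges M) (wedges-congʳ M) (wedges-linear M)

  drop-wedges : ∀ {k m} (j : Fin (suc m)) (M : Fin k → Vector (suc m)) ω S →
                drop j (wedges M ω) S ≈ wedges (λ i → M i ∘ punchIn j) (drop j ω) S
  drop-wedges {zero} j M ω S = refl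
  drop-wedges {suc k} j M ω S = trans (drop-wedge j (M zero) _ S) (wedge-congʳ _ (drop-wedges j (M ∘ suc) ω) S)

  -- Cofactor expansion is the formula for the top coefficient of a product with one more vector:
  -- deleting column j amounts to keeping the coefficients without the j-th basis vector.
  det≈wedges : ∀ {m} (M : Fin m → Vector m) → det M ≈ wedges M unit (full m)
  det≈wedges {zero} M = refl
  det≈wedges {suc m} M = sym (trans (wedge-expand (M zero) (wedges (M ∘ suc) unit))
    (sum-cong λ j → *-congˡ {(- 1#) ^ toℕ j * M zero j}
      (trans (drop-wedges j (M ∘ suc) unit (full m))
      (trans (wedges-congʳ (λ i → M (suc i) ∘ punchIn j) (drop-unit j) (full m))
             (sym (det≈wedges (λ i → M (suc i) ∘ punchIn j)))))))

  det-cong : ∀ {m} {M N : Fin m → Vector m} → (∀ i j → M i j ≈ N i j) → det M ≈ det N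
  det-cong {m} {M} {N} p = trans (det≈wedges M) (trans (wedges-cong p (λ _ → refl) (full m)) (sym (det≈wedges N)))

  infixr 5 _∷_

  -- Lehmer codes: the head is the image of the first index, the tail permutes what remains. They
  -- make the sign of a permutation and its action on forms recursive.
  data Lehmer : ℕ → Set where
    []  : Lehmer 0
    _∷_ : ∀ {m} → Fin (suc m) → Lehmer m → Lehmer (suc m)

  act : ∀ {m} → Lehmer m → Fin m → Fin m
  act (k ∷ π) zero    = k
  act (k ∷ π) (suc i) = punchIn k (act π i)

  lehmer : ∀ {m} (f : Fin m → Fin m) → (∀ {i j} → f i ≡ f j → i ≡ j) → ∃[ π ] (∀ i → act π i ≡ f i)
  lehmer {zero} f inj = [] , λ ()
  lehmer {suc m} f inj = f zero ∷ proj₁ rec , λ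
    { zero → ≡.refl
    ; (suc i) → ≡.trans (cong (punchIn (f zero)) (proj₂ rec i)) (punchIn-punchOut (ne i)) }
    where
    ne : ∀ i → f zero ≢ f (suc i)
    ne i p with inj p
    ... | ()
    suc-injective : ∀ {n} {i j : Fin n} → suc i ≡ suc j → i ≡ j
    suc-injective ≡.refl = ≡.refl
    rec = lehmer (λ i → punchOut (ne i)) (λ {i} {j} p → suc-injective (inj (punchOut-injective (ne i) (ne j) p)))

  sign : ∀ {m} → Fin m → Carrier
  sign zero    = 1#
  sign (suc k) = - sign k

  sgn : ∀ {m} → Lehmer m → Carrier
  sgn []      = 1#
  sgn (k ∷ π) = sgn π * sign k

  neg²  : ∀ a b → - a * - b ≈ a * b
  neg² a b = trans (sym (-‿distribˡ-* a (- b))) (trans (-‿cong (sym (-‿distribʳ-* a b))) (-‿involutive _))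

  sign² : ∀ {m} (k : Fin m) → sign k * sign k ≈ 1#
  sign² zero = *-identityˡ 1#
  sign² (suc k) = trans (neg² _ _) (sign² k)

  sgn² : ∀ {m} (π : Lehmer m) → sgn π * sgn π ≈ 1#
  sgn² [] = *-identityˡ 1#
  sgn² (k ∷ π) = trans (shuffle (sgn π) (sign k)) (trans (*-cong (sgn² π) (sign² k)) (*-identityˡ 1#))
    where
    shuffle : ∀ a b → (a ⊗ b) ⊗ (a ⊗ b) ≋ (a ⊗ a) ⊗ (b ⊗ b)
    shuffle = solve-∀ acr

  -- Row k passes the k rows before it, at the cost of a sign each.
  row-front : ∀ {m n} (k : Fin (suc m)) (M : Fin (suc m) → Vector n) ω S →
              wedge (M k) (wedges (M ∘ punchIn k) ω) S ≈ sign k * wedges M ω S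
  row-front zero M ω S = sym (*-identityˡ _)
  row-front {suc m} (suc k) M ω S = begin
    wedge (M (suc k)) (wedge (M zero) (wedges (M ∘ suc ∘ punchIn k) ω)) S
      ≈⟨ wedge-anticomm (M (suc k)) (M zero) _ S ⟩
    - wedge (M zero) (wedge (M (suc k)) (wedges (M ∘ suc ∘ punchIn k) ω)) S
      ≈⟨ -‿cong (wedge-congʳ (M zero) (row-front k (M ∘ suc) ω) S) ⟩
    - wedge (M zero) (λ S → sign k * wedges (M ∘ suc) ω S) S
      ≈⟨ -‿cong (wedge-scale (M zero) (sign k) _ S) ⟩
    - (sign k * wedges M ω S)
      ≈⟨ -‿distribˡ-* (sign k) _ ⟩
    - sign k * wedges M ω S ∎

  row-permute : ∀ {m n} (π : Lehmer m) (M : Fin m → Vector n) ω S → wedges (M ∘ act π) ω S ≈ sgn π * wedges M ω S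
  row-permute [] M ω S = sym (*-identityˡ _)
  row-permute (k ∷ π) M ω S = begin
    wedge (M k) (wedges (M ∘ punchIn k ∘ act π) ω) S         ≈⟨ wedge-congʳ (M k) (row-permute π (M ∘ punchIn k) ω) S ⟩
    wedge (M k) (λ S → sgn π * wedges (M ∘ punchIn k) ω S) S ≈⟨ wedge-scale (M k) (sgn π) _ S ⟩
    sgn π * wedge (M k) (wedges (M ∘ punchIn k) ω) S         ≈⟨ *-congˡ (row-front k M ω S) ⟩
    sgn π * (sign k * wedges M ω S)                          ≈⟨ *-assoc _ _ _ ⟨
    sgn π * sign k * wedges M ω S                            ∎

  -- The coefficients of the basis elements containing the k-th basis vector, moved to the front.
  extract : ∀ {m} → Fin (suc m) → Form (suc m) → Form m
  extract zero ω S = ω (true ∷ S)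
  extract (suc k) ω (false ∷ S) = extract k (ω ∘ (false ∷_)) S
  extract (suc k) ω (true ∷ S)  = - extract k (ω ∘ (true ∷_)) S

  extract-cong : ∀ {m} (k : Fin (suc m)) → Congruent (extract k)
  extract-cong zero p S = p _
  extract-cong (suc k) p (false ∷ S) = extract-cong k (p ∘ (false ∷_)) S
  extract-cong (suc k) p (true ∷ S) = -‿cong (extract-cong k (p ∘ (true ∷_)) S)

  extract-linear : ∀ {m} (k : Fin (suc m)) → Linear (extract k)
  extract-linear zero a b ω η S = refl
  extract-linear (suc k) a b ω η (false ∷ S) = extract-linear k a b _ _ S
  extract-linear (suc k) a b ω η (true ∷ S) = trans (-‿cong (extract-linear k a b _ _ S))
    (trans (sym (-‿+-comm _ _)) (+-cong (-‿distribʳ-* a _) (-‿distribʳ-* b _)))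

  extract-wedge : ∀ {m} (k : Fin (suc m)) v ω S →
                  extract k (wedge v ω) S ≈ v k * drop k ω S + - wedge (v ∘ punchIn k) (extract k ω) S
  extract-wedge zero v ω S = refl
  extract-wedge (suc k) v ω (false ∷ S) = extract-wedge k (v ∘ suc) (ω ∘ (false ∷_)) S
  extract-wedge (suc k) v ω (true ∷ S) = begin
    - extract k (λ S → v zero * ω (false ∷ S) + - wedge v′ (ω ∘ (true ∷_)) S) S
      ≈⟨ -‿cong (linear-sub (extract k) (extract-cong k) (extract-linear k) (v zero) _ _ S) ⟩
    - (v zero * A + - extract k (wedge v′ (ω ∘ (true ∷_))) S)
      ≈⟨ neg-sub _ _ ⟩
    - (v zero * A) + extract k (wedge v′ (ω ∘ (true ∷_))) S
      ≈⟨ +-congˡ (extract-wedge k v′ (ω ∘ (true ∷_)) S) ⟩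
    - (v zero * A) + (D + - W)
      ≈⟨ shuffle (v zero) A D W ⟩
    D + (- (v zero * A) + - W)
      ≈⟨ +-congˡ (+-congˡ (wedge-neg (v′ ∘ punchIn k) _ S)) ⟨
    D + (- (v zero * A) + wedge (v′ ∘ punchIn k) (λ S → - extract k (ω ∘ (true ∷_)) S) S)
      ≈⟨ +-congˡ (neg-sub _ _) ⟨
    D + - (v zero * A + - wedge (v′ ∘ punchIn k) (λ S → - extract k (ω ∘ (true ∷_)) S) S) ∎
    where
    v′ = v ∘ suc
    A = extract k (ω ∘ (false ∷_)) S
    D = v (suc k) * drop k (ω ∘ (true ∷_)) S
    W = wedge (v′ ∘ punchIn k) (extract k (ω ∘ (true ∷_))) S
    shuffle : ∀ v a d w → ⊖ (v ⊗ a) ⊕ (d ⊕ ⊖ w) ≋ d ⊕ (⊖ (v ⊗ a) ⊕ ⊖ w)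
    shuffle = solve-∀ acr

  extract-unit : ∀ {m} (k : Fin (suc m)) S → extract k unit S ≈ 0#
  extract-unit zero S = refl
  extract-unit (suc k) (false ∷ S) = extract-unit k S
  extract-unit (suc k) (true ∷ S) = trans (-‿cong (linear-zero (extract k) (extract-cong k) (extract-linear k) S)) -0#≈0#

  extract-full : ∀ {m} (k : Fin (suc m)) ω → extract k ω (full m) ≈ sign k * ω (full (suc m))
  extract-full zero ω = sym (*-identityˡ _)
  extract-full {suc m} (suc k) ω = trans (-‿cong (extract-full k (ω ∘ (true ∷_)))) (-‿distribˡ-* _ _)

  -- The map of exterior algebras induced by permuting the coordinates.
  turn : ∀ {m} → Lehmer m → Form m → Form m
  turn [] ω S = ω S
  turn (k ∷ π) ω (false ∷ S) = turn π (drop k ω) S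
  turn (k ∷ π) ω (true ∷ S)  = turn π (extract k ω) S

  turn-cong : ∀ {m} (π : Lehmer m) → Congruent (turn π)
  turn-cong [] p S = p S
  turn-cong (k ∷ π) p (false ∷ S) = turn-cong π (λ S → p _) S
  turn-cong (k ∷ π) p (true ∷ S) = turn-cong π (extract-cong k p) S

  turn-linear : ∀ {m} (π : Lehmer m) → Linear (turn π)
  turn-linear [] a b ω η S = refl
  turn-linear (k ∷ π) a b ω η (false ∷ S) = turn-linear π a b _ _ S
  turn-linear (k ∷ π) a b ω η (true ∷ S) =
    trans (turn-cong π (extract-linear k a b ω η) S) (turn-linear π a b _ _ S)

  turn-wedge : ∀ {m} (π : Lehmer m) v ω S → turn π (wedge v ω) S ≈ wedge (v ∘ act π) (turn π ω) S
  turn-wedge [] v ω [] = refl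
  turn-wedge (k ∷ π) v ω (false ∷ S) =
    trans (turn-cong π (drop-wedge k v ω) S) (turn-wedge π (v ∘ punchIn k) (drop k ω) S)
  turn-wedge (k ∷ π) v ω (true ∷ S) =
    trans (turn-cong π (extract-wedge k v ω) S)
    (trans (linear-sub (turn π) (turn-cong π) (turn-linear π) (v k) _ _ S)
           (+-congˡ (-‿cong (turn-wedge π (v ∘ punchIn k) (extract k ω) S))))

  turn-wedges : ∀ {k m} (π : Lehmer m) (M : Fin k → Vector m) ω S →
                turn π (wedges M ω) S ≈ wedges (λ i → M i ∘ act π) (turn π ω) S
  turn-wedges {zero} π M ω S = refl
  turn-wedges {suc k} π M ω S =
    trans (turn-wedge π (M zero) _ S) (wedge-congʳ _ (turn-wedges π (M ∘ suc) ω) S)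

  turn-unit : ∀ {m} (π : Lehmer m) S → turn π unit S ≈ unit S
  turn-unit [] S = refl
  turn-unit (k ∷ π) (false ∷ S) = trans (turn-cong π (drop-unit k) S) (turn-unit π S)
  turn-unit (k ∷ π) (true ∷ S) =
    trans (turn-cong π (extract-unit k) S) (linear-zero (turn π) (turn-cong π) (turn-linear π) S)

  turn-full : ∀ {m} (π : Lehmer m) ω → turn π ω (full m) ≈ sgn π * ω (full m)
  turn-full [] ω = sym (*-identityˡ _)
  turn-full (k ∷ π) ω = trans (turn-full π (extract k ω)) (trans (*-congˡ (extract-full k ω)) (sym (*-assoc _ _ _)))

  -- Permuting the rows gives the sign by anticommutativity. Permuting the columns gives it again,
  -- as the factor by which the induced map `turn` acts on the top coefficient. The two signs
  -- cancel.
  det-permute : ∀ {m} (M : Fin m → Vector m) (f : Fin m → Fin m) → (∀ {i j} → f i ≡ f j → i ≡ j) →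
                det (λ i j → M (f i) (f j)) ≈ det M
  det-permute {m} M f inj with lehmer f inj
  ... | π , act≡f = begin
    det (λ i j → M (f i) (f j))                     ≈⟨ det-cong (λ i j → reflexive (≡.cong₂ M (act≡f i) (act≡f j))) ⟨
    det (λ i j → M (act π i) (act π j))             ≈⟨ det≈wedges (λ i j → M (act π i) (act π j)) ⟩
    wedges (λ i → M (act π i) ∘ act π) unit (full m) ≈⟨ row-permute π (λ i → M i ∘ act π) unit (full m) ⟩
    sgn π * wedges (λ i → M i ∘ act π) unit (full m)
      ≈⟨ *-congˡ (wedges-congʳ (λ i → M i ∘ act π) (turn-unit π) (full m)) ⟨
    sgn π * wedges (λ i → M i ∘ act π) (turn π unit) (full m)
      ≈⟨ *-congˡ (turn-wedges π M unit (full m)) ⟨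
    sgn π * turn π (wedges M unit) (full m)         ≈⟨ *-congˡ (turn-full π (wedges M unit)) ⟩
    sgn π * (sgn π * wedges M unit (full m))        ≈⟨ *-assoc _ _ _ ⟨
    sgn π * sgn π * wedges M unit (full m)          ≈⟨ *-congʳ (sgn² π) ⟩
    1# * wedges M unit (full m)                     ≈⟨ *-identityˡ _ ⟩
    wedges M unit (full m)                          ≈⟨ det≈wedges M ⟨
    det M                                           ∎

-- Determinants of two blocks joined by one edge

module Bridges {c ℓ} (R : CommutativeRing c ℓ) where

  open import Data.Fin.Base using (_↑ˡ_; _↑ʳ_)
  import Data.Nat.Base as ℕ
  import Data.Nat.Properties as ℕ
  open import Data.Vec.Base using (Vec; []; _∷_; _++_)
  open import Relation.Binary.PropositionalEquality as ≡ using (_≡_; cong)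

  open CommutativeRing R hiding (_-_; zero)
  open import Algebra.Properties.Ring ring
  open Determinants R
  open Defs.Determinant rawRing using (det)
  open import Relation.Binary.Reasoning.Setoid setoid

  parity : ℕ → Carrier
  parity zero    = 1#
  parity (suc k) = - parity k

  trues : ∀ {m} → Vec Bool m → ℕ
  trues []          = 0
  trues (false ∷ S) = trues S
  trues (true ∷ S)  = suc (trues S)

  e₀ : ∀ {m} → Vector m
  e₀ zero    = 1#
  e₀ (suc i) = 0#

  _° : ∀ {m} → (Fin (suc m) → Vector (suc m)) → Fin m → Vector m
  (M °) i j = M (suc i) (suc j)

  -- The right half of v has to pass the `trues S` basis vectors selected on the left, whence the
  -- parity.
  wedge-++ : ∀ {m n} (v : Vector (m ℕ.+ n)) ω (S : Vec Bool m) (U : Vec Bool n) →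
             wedge v ω (S ++ U) ≈ wedge (v ∘ (_↑ˡ n)) (λ S → ω (S ++ U)) S
                                  + parity (trues S) * wedge (v ∘ (m ↑ʳ_)) (λ U → ω (S ++ U)) U
  wedge-++ v ω [] U = sym (trans (+-identityˡ _) (*-identityˡ _))
  wedge-++ v ω (false ∷ S) U = wedge-++ (v ∘ suc) (ω ∘ (false ∷_)) S U
  wedge-++ {suc m} {n} v ω (true ∷ S) U = begin
    v zero * ω (false ∷ S ++ U) + - wedge (v ∘ suc) (ω ∘ (true ∷_)) (S ++ U)
      ≈⟨ +-congˡ (-‿cong (wedge-++ (v ∘ suc) (ω ∘ (true ∷_)) S U)) ⟩
    v zero * ω (false ∷ S ++ U) + - (X + parity (trues S) * Y)
      ≈⟨ +-congˡ (-‿+-comm X _) ⟨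
    v zero * ω (false ∷ S ++ U) + (- X + - (parity (trues S) * Y))
      ≈⟨ +-assoc _ _ _ ⟨
    v zero * ω (false ∷ S ++ U) + - X + - (parity (trues S) * Y)
      ≈⟨ +-congˡ (-‿distribˡ-* _ _) ⟩
    v zero * ω (false ∷ S ++ U) + - X + - parity (trues S) * Y ∎
    where
    X = wedge (v ∘ suc ∘ (_↑ˡ n)) (λ S → ω (true ∷ S ++ U)) S
    Y = wedge (v ∘ suc ∘ (m ↑ʳ_)) (λ U → ω (true ∷ S ++ U)) U

  wedges-split : ∀ m {n k} (M : Fin (m ℕ.+ n) → Vector k) ω →
                 wedges M ω ≡ wedges (M ∘ (_↑ˡ n)) (wedges (M ∘ (m ↑ʳ_)) ω)
  wedges-split zero M ω = ≡.refl
  wedges-split (suc m) M ω = cong (wedge (M zero)) (wedges-split m (M ∘ suc) ω)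

  wedges-left : ∀ {k m n} (M : Fin k → Vector (m ℕ.+ n)) → (∀ i j → M i (m ↑ʳ j) ≈ 0#) → ∀ ω S U →
                wedges M ω (S ++ U) ≈ wedges (λ i → M i ∘ (_↑ˡ n)) (λ S → ω (S ++ U)) S
  wedges-left {zero} M p ω S U = refl
  wedges-left {suc k} {m} {n} M p ω S U = begin
    wedge (M zero) (wedges (M ∘ suc) ω) (S ++ U)
      ≈⟨ wedge-++ (M zero) _ S U ⟩
    wedge (M zero ∘ (_↑ˡ n)) (λ S → wedges (M ∘ suc) ω (S ++ U)) S
      + parity (trues S) * wedge (M zero ∘ (m ↑ʳ_)) (λ U → wedges (M ∘ suc) ω (S ++ U)) U
      ≈⟨ +-congˡ (trans (*-congˡ (wedge-zeroˡ _ _ (p zero) U)) (zeroʳ _)) ⟩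
    wedge (M zero ∘ (_↑ˡ n)) (λ S → wedges (M ∘ suc) ω (S ++ U)) S + 0#
      ≈⟨ +-identityʳ _ ⟩
    wedge (M zero ∘ (_↑ˡ n)) (λ S → wedges (M ∘ suc) ω (S ++ U)) S
      ≈⟨ wedge-congʳ _ (λ S → wedges-left (M ∘ suc) (p ∘ suc) ω S U) S ⟩
    wedge (M zero ∘ (_↑ˡ n)) (wedges (λ i → M (suc i) ∘ (_↑ˡ n)) (λ S → ω (S ++ U))) S ∎

  unit-++ : ∀ {m n} (S : Vec Bool m) (U : Vec Bool n) → unit (S ++ U) ≈ unit S * unit U
  unit-++ [] U = sym (*-identityˡ _)
  unit-++ (false ∷ S) U = unit-++ S U
  unit-++ (true ∷ S) U = sym (zeroˡ _)

  parity-unit : ∀ {m} (S : Vec Bool m) a → parity (trues S) * (unit S * a) ≈ unit S * a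
  parity-unit [] a = *-identityˡ _
  parity-unit (false ∷ S) a = parity-unit S a
  parity-unit (true ∷ S) a = trans (*-congˡ (zeroˡ a)) (trans (zeroʳ _) (sym (zeroˡ a)))

  wedge-right : ∀ {m n} (v : Vector (m ℕ.+ n)) ω (y : Form n) → (∀ S U → ω (S ++ U) ≈ unit S * y U) → ∀ S U →
    wedge v ω (S ++ U) ≈ y U * wedge (v ∘ (_↑ˡ n)) unit S + unit S * wedge (v ∘ (m ↑ʳ_)) y U
  wedge-right {m} {n} v ω y p S U = begin
    wedge v ω (S ++ U)
      ≈⟨ wedge-++ v ω S U ⟩
    wedge (v ∘ (_↑ˡ n)) (λ S → ω (S ++ U)) S + parity (trues S) * wedge (v ∘ (m ↑ʳ_)) (λ U → ω (S ++ U)) U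
      ≈⟨ +-cong (wedge-congʳ _ (λ S → trans (p S U) (*-comm _ _)) S) (*-congˡ (wedge-congʳ _ (p S) U)) ⟩
    wedge (v ∘ (_↑ˡ n)) (λ S → y U * unit S) S + parity (trues S) * wedge (v ∘ (m ↑ʳ_)) (λ U → unit S * y U) U
      ≈⟨ +-cong (wedge-scale _ (y U) unit S) (*-congˡ (wedge-scale _ (unit S) y U)) ⟩
    y U * wedge (v ∘ (_↑ˡ n)) unit S + parity (trues S) * (unit S * wedge (v ∘ (m ↑ʳ_)) y U)
      ≈⟨ +-congˡ (parity-unit S _) ⟩
    y U * wedge (v ∘ (_↑ˡ n)) unit S + unit S * wedge (v ∘ (m ↑ʳ_)) y U ∎

  wedges-right : ∀ {k m n} (M : Fin k → Vector (m ℕ.+ n)) → (∀ i j → M i (j ↑ˡ n) ≈ 0#) → ∀ S U →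
                 wedges M unit (S ++ U) ≈ unit S * wedges (λ i → M i ∘ (m ↑ʳ_)) unit U
  wedges-right {zero} M p = unit-++
  wedges-right {suc k} {m} {n} M p S U =
    trans (wedge-right (M zero) (wedges (M ∘ suc) unit) _ (wedges-right (M ∘ suc) (p ∘ suc)) S U)
    (trans (+-congʳ (trans (*-congˡ (wedge-zeroˡ _ _ (p zero) S)) (zeroʳ _))) (+-identityˡ _))

  Degree≤ : ∀ {m} → ℕ → Form m → Set _
  Degree≤ k ω = ∀ S → k ℕ.< trues S → ω S ≈ 0#

  degree-unit : ∀ {m} → Degree≤ 0 (unit {m})
  degree-unit (false ∷ S) p = degree-unit S p
  degree-unit (true ∷ S) p = refl

  degree-wedge : ∀ {k m} (v : Vector m) ω → Degree≤ k ω → Degree≤ (suc k) (wedge v ω)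
  degree-wedge v ω d (false ∷ S) p = degree-wedge (v ∘ suc) _ (d ∘ (false ∷_)) S p
  degree-wedge {k} v ω d (true ∷ S) p = begin
    v zero * ω (false ∷ S) + - wedge (v ∘ suc) (ω ∘ (true ∷_)) S
      ≈⟨ +-cong (*-congˡ (d (false ∷ S) (ℕ.≤-pred p))) (-‿cong (inner k d (ℕ.≤-pred p))) ⟩
    v zero * 0# + - 0# ≈⟨ +-cong (zeroʳ _) -0#≈0# ⟩
    0# + 0#            ≈⟨ +-identityʳ 0# ⟩
    0#                 ∎
    where
    inner : ∀ k → Degree≤ k ω → k ℕ.< trues S → wedge (v ∘ suc) (ω ∘ (true ∷_)) S ≈ 0#
    inner zero d p = trans (wedge-congʳ (v ∘ suc) (λ S → d (true ∷ S) (ℕ.s≤s ℕ.z≤n)) S)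
      (linear-zero (wedge (v ∘ suc)) (wedge-congʳ (v ∘ suc)) (wedge-linear (v ∘ suc)) S)
    inner (suc k) d p = degree-wedge (v ∘ suc) _ (λ S q → d (true ∷ S) (ℕ.s≤s q)) S p

  degree-wedges : ∀ {k m} (M : Fin k → Vector m) → Degree≤ k (wedges M unit)
  degree-wedges {zero} M = degree-unit
  degree-wedges {suc k} M = degree-wedge (M zero) _ (degree-wedges (M ∘ suc))

  trues-full : ∀ m → trues (full m) ≡ m
  trues-full zero = ≡.refl
  trues-full (suc m) = cong suc (trues-full m)

  -- A product of m vectors has degree at most m and thus no top coefficient in dimension m + 1.
  -- This kills the mixed terms when two blocks are joined.
  wedges-full : ∀ {m} (M : Fin m → Vector (suc m)) → wedges M unit (full (suc m)) ≈ 0#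
  wedges-full {m} M = degree-wedges M (full (suc m)) (ℕ.≤-reflexive (≡.sym (trues-full (suc m))))

  full-++ : ∀ m n → full (m ℕ.+ n) ≡ full m ++ full n
  full-++ zero n = ≡.refl
  full-++ (suc m) n = cong (true ∷_) (full-++ m n)

  wedges-wedge : ∀ {k m} (M : Fin k → Vector m) v ω S →
                 wedges M (wedge v ω) S ≈ parity k * wedge v (wedges M ω) S
  wedges-wedge {zero} M v ω S = sym (*-identityˡ _)
  wedges-wedge {suc k} M v ω S = begin
    wedge (M zero) (wedges (M ∘ suc) (wedge v ω)) S
      ≈⟨ wedge-congʳ (M zero) (wedges-wedge (M ∘ suc) v ω) S ⟩
    wedge (M zero) (λ S → parity k * wedge v (wedges (M ∘ suc) ω) S) S
      ≈⟨ wedge-scale (M zero) (parity k) _ S ⟩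
    parity k * wedge (M zero) (wedge v (wedges (M ∘ suc) ω)) S
      ≈⟨ *-congˡ (wedge-anticomm (M zero) v _ S) ⟩
    parity k * - wedge v (wedges M ω) S
      ≈⟨ trans (sym (-‿distribʳ-* _ _)) (-‿distribˡ-* _ _) ⟩
    - parity k * wedge v (wedges M ω) S ∎

  wedge-e₀ : ∀ {m} (ω : Form (suc m)) S → wedge e₀ ω (true ∷ S) ≈ ω (false ∷ S)
  wedge-e₀ ω S = trans (+-cong (*-identityˡ _) (trans (-‿cong (wedge-zeroˡ _ _ (λ _ → refl) S)) -0#≈0#)) (+-identityʳ _)

  parity² : ∀ k → parity k * parity k ≈ 1#
  parity² zero = *-identityˡ 1#
  parity² (suc k) = trans (neg² _ _) (parity² k)

  det-drop : ∀ {m} (B : Fin (suc m) → Vector (suc m)) → wedges (B ∘ suc) unit (false ∷ full m) ≈ det (B °)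
  det-drop {m} B = begin
    drop zero (wedges (B ∘ suc) unit) (full m) ≈⟨ drop-wedges zero (B ∘ suc) unit (full m) ⟩
    wedges (B °) (drop zero unit) (full m)     ≈⟨ wedges-congʳ (B °) (drop-unit zero) (full m) ⟩
    wedges (B °) unit (full m)                 ≈⟨ det≈wedges (B °) ⟨
    det (B °)                                  ∎

  det-blocks : ∀ m n (M : Fin (m ℕ.+ n) → Vector (m ℕ.+ n)) (B : Fin m → Vector m) (A : Fin n → Vector n) →
    (∀ i j → M (i ↑ˡ n) (j ↑ˡ n) ≈ B i j) → (∀ i j → M (i ↑ˡ n) (m ↑ʳ j) ≈ 0#) →
    (∀ i j → M (m ↑ʳ i) (j ↑ˡ n) ≈ 0#) → (∀ i j → M (m ↑ʳ i) (m ↑ʳ j) ≈ A i j) →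
    det M ≈ det B * det A
  det-blocks m n M B A h₁₁ h₁₂ h₂₁ h₂₂ = begin
    det M
      ≈⟨ det≈wedges M ⟩
    wedges M unit (full (m ℕ.+ n))
      ≈⟨ reflexive (≡.cong₂ (λ ω S → ω S) (wedges-split m M unit) (full-++ m n)) ⟩
    wedges (M ∘ (_↑ˡ n)) Y (full m ++ full n)
      ≈⟨ wedges-left (M ∘ (_↑ˡ n)) h₁₂ Y (full m) (full n) ⟩
    wedges (λ i → M (i ↑ˡ n) ∘ (_↑ˡ n)) (λ S → Y (S ++ full n)) (full m)
      ≈⟨ wedges-cong h₁₁ (λ S → trans (wedges-right (M ∘ (m ↑ʳ_)) h₂₁ S (full n)) (*-comm _ _)) (full m) ⟩
    wedges B (λ S → a * unit S) (full m)
      ≈⟨ wedges-scale B a unit (full m) ⟩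
    a * wedges B unit (full m)
      ≈⟨ *-comm _ _ ⟩
    wedges B unit (full m) * a
      ≈⟨ *-cong (det≈wedges B) (trans (det≈wedges A) (sym (wedges-cong h₂₂ (λ _ → refl) (full n)))) ⟨
    det B * det A ∎
    where
    Y = wedges (M ∘ (m ↑ʳ_)) unit
    a = wedges (λ i → M (m ↑ʳ i) ∘ (m ↑ʳ_)) unit (full n)

  module Joined (m n : ℕ) (M : Fin (suc m ℕ.+ suc n) → Vector (suc m ℕ.+ suc n))
    (B : Fin (suc m) → Vector (suc m)) (A : Fin (suc n) → Vector (suc n))
    (h₁₁ : ∀ (i j : Fin (suc m)) → M (i ↑ˡ suc n) (j ↑ˡ suc n) ≈ B i j)
    (h₂₂ : ∀ (i j : Fin (suc n)) → M (suc m ↑ʳ i) (suc m ↑ʳ j) ≈ A i j)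
    (h₁₂₀ : ∀ (j : Fin (suc n)) → M (zero ↑ˡ suc n) (suc m ↑ʳ j) ≈ - e₀ j)
    (h₁₂ : ∀ (i : Fin m) (j : Fin (suc n)) → M (suc i ↑ˡ suc n) (suc m ↑ʳ j) ≈ 0#)
    (h₂₁₀ : ∀ (j : Fin (suc m)) → M (suc m ↑ʳ zero) (j ↑ˡ suc n) ≈ - e₀ j)
    (h₂₁ : ∀ (i : Fin n) (j : Fin (suc m)) → M (suc m ↑ʳ suc i) (j ↑ˡ suc n) ≈ 0#)
    where

    private
      y : Form (suc n)
      y = wedges (A ∘ suc) unit
      a₀y : Form (suc n)
      a₀y = wedge (A zero) y
      X₀ X₁ : Form (suc m)
      X₀ = wedges (B ∘ suc) unit
      X₁ = wedges (B ∘ suc) (wedge e₀ unit)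

      Z : Form (suc m ℕ.+ suc n)
      Z = wedges (M ∘ (suc m ↑ʳ_)) unit

      Z-++ : ∀ S U → Z (S ++ U) ≈ a₀y U * unit S + - y U * wedge e₀ unit S
      Z-++ S U = begin
        Z (S ++ U)
          ≈⟨ wedge-right {suc m} {suc n} (M (suc m ↑ʳ zero)) (wedges (M ∘ (suc m ↑ʳ_) ∘ suc) unit) y
               (λ S U → trans (wedges-right (M ∘ (suc m ↑ʳ_) ∘ suc) h₂₁ S U) (*-congˡ (wedges-cong (h₂₂ ∘ suc) (λ _ → refl) U))) S U ⟩
        y U * wedge (M (suc m ↑ʳ zero) ∘ (_↑ˡ suc n)) unit S + unit S * wedge (M (suc m ↑ʳ zero) ∘ (suc m ↑ʳ_)) y U
          ≈⟨ +-cong (*-congˡ (trans (wedge-cong h₂₁₀ (λ _ → refl) S) (wedge-negˡ e₀ unit S)))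
                    (*-congˡ (wedge-cong (h₂₂ zero) (λ _ → refl) U)) ⟩
        y U * - wedge e₀ unit S + unit S * a₀y U
          ≈⟨ +-comm _ _ ⟩
        unit S * a₀y U + y U * - wedge e₀ unit S
          ≈⟨ +-cong (*-comm _ _) (trans (sym (-‿distribʳ-* _ _)) (-‿distribˡ-* _ _)) ⟩
        a₀y U * unit S + - y U * wedge e₀ unit S ∎

      Ω : Form (suc m ℕ.+ suc n)
      Ω = wedges (M ∘ (_↑ˡ suc n) ∘ suc) Z

      Ω-++ : ∀ S U → Ω (S ++ U) ≈ a₀y U * X₀ S + - y U * X₁ S
      Ω-++ S U = begin
        Ω (S ++ U)
          ≈⟨ wedges-left (M ∘ (_↑ˡ suc n) ∘ suc) h₁₂ Z S U ⟩
        wedges (λ i → M (suc i ↑ˡ suc n) ∘ (_↑ˡ suc n)) (λ S → Z (S ++ U)) S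
          ≈⟨ wedges-cong (h₁₁ ∘ suc) (λ S → Z-++ S U) S ⟩
        wedges (B ∘ suc) (λ S → a₀y U * unit S + - y U * wedge e₀ unit S) S
          ≈⟨ wedges-linear (B ∘ suc) (a₀y U) (- y U) unit (wedge e₀ unit) S ⟩
        a₀y U * X₀ S + - y U * X₁ S ∎

      F = full (suc m)
      G = full (suc n)

      left-part : wedge (M zero ∘ (_↑ˡ suc n)) (λ S → Ω (S ++ G)) F ≈ det B * det A
      left-part = begin
        wedge (M zero ∘ (_↑ˡ suc n)) (λ S → Ω (S ++ G)) F
          ≈⟨ wedge-cong (h₁₁ zero) (λ S → Ω-++ S G) F ⟩
        wedge (B zero) (λ S → a₀y G * X₀ S + - y G * X₁ S) F
          ≈⟨ wedge-linear (B zero) (a₀y G) (- y G) X₀ X₁ F ⟩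
        a₀y G * wedge (B zero) X₀ F + - y G * wedge (B zero) X₁ F
          -- The second term contains only the n rows of `A ∘ suc`, too few for dimension n + 1.
          ≈⟨ +-congˡ (trans (*-congʳ (trans (-‿cong (wedges-full (A ∘ suc))) -0#≈0#)) (zeroˡ _)) ⟩
        a₀y G * wedge (B zero) X₀ F + 0#
          ≈⟨ +-identityʳ _ ⟩
        a₀y G * wedge (B zero) X₀ F
          ≈⟨ *-comm _ _ ⟩
        wedge (B zero) X₀ F * a₀y G
          ≈⟨ *-cong (det≈wedges B) (det≈wedges A) ⟨
        det B * det A ∎

      X₁-full : X₁ F ≈ parity m * det (B °)
      X₁-full = trans (wedges-wedge (B ∘ suc) e₀ unit F) (*-congˡ (trans (wedge-e₀ X₀ (full m)) (det-drop B)))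

      right-part : parity (trues F) * wedge (M zero ∘ (suc m ↑ʳ_)) (λ U → Ω (F ++ U)) G ≈ - (det (B °) * det (A °))
      right-part = begin
        parity (trues F) * wedge (M zero ∘ (suc m ↑ʳ_)) (λ U → Ω (F ++ U)) G
          ≈⟨ *-cong (reflexive (cong parity (trues-full (suc m))))
               (wedge-cong h₁₂₀ (λ U → trans (Ω-++ F U)
                 -- Here it is X₀ that has too few factors: m rows in dimension m + 1.
                 (trans (+-congʳ (trans (*-congˡ (wedges-full (B ∘ suc))) (zeroʳ _)))
                 (trans (+-identityˡ _) (trans (*-comm _ _) (sym (-‿distribʳ-* _ _)))))) G) ⟩
        - parity m * wedge (λ j → - e₀ j) (λ U → - (X₁ F * y U)) G
          ≈⟨ *-congˡ (trans (wedge-negˡ e₀ (λ U → - W U) G) (-‿cong (wedge-neg e₀ W G))) ⟩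
        - parity m * - - wedge e₀ (λ U → X₁ F * y U) G
          ≈⟨ *-congˡ (trans (-‿involutive _) (wedge-e₀ W (full n))) ⟩
        - parity m * (X₁ F * y (false ∷ full n))
          ≈⟨ *-congˡ (*-cong X₁-full (det-drop A)) ⟩
        - parity m * (parity m * det (B °) * det (A °))
          ≈⟨ -‿distribˡ-* _ _ ⟨
        - (parity m * (parity m * det (B °) * det (A °)))
          ≈⟨ -‿cong (trans (*-congˡ (*-assoc _ _ _)) (trans (sym (*-assoc _ _ _)) (trans (*-congʳ (parity² m)) (*-identityˡ _)))) ⟩
        - (det (B °) * det (A °)) ∎
        where
        W : Form (suc n)
        W U = X₁ F * y U

    det-bridge : det M ≈ det B * det A + - (det (B °) * det (A °))
    det-bridge = begin
      det M
        ≈⟨ det≈wedges M ⟩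
      wedges M unit (full (suc m ℕ.+ suc n))
        ≈⟨ reflexive (≡.cong₂ (λ ω S → ω S) (wedges-split (suc m) M unit) (full-++ (suc m) (suc n))) ⟩
      wedge (M zero) Ω (F ++ G)
        ≈⟨ wedge-++ (M zero) Ω F G ⟩
      wedge (M zero ∘ (_↑ˡ suc n)) (λ S → Ω (S ++ G)) F
        + parity (trues F) * wedge (M zero ∘ (suc m ↑ʳ_)) (λ U → Ω (F ++ U)) G
        ≈⟨ +-cong left-part right-part ⟩
      det B * det A + - (det (B °) * det (A °)) ∎

    det-bridge° : det (M °) ≈ det (B °) * det A
    det-bridge° = det-blocks m (suc n) (M °) (B °) A
      (λ i j → h₁₁ (suc i) (suc j)) (λ i j → h₁₂ i j) off (λ i j → h₂₂ i j)
      where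
      off : ∀ i j → M (suc m ↑ʳ i) (suc j ↑ˡ suc n) ≈ 0#
      off zero j = trans (h₂₁₀ (suc j)) -0#≈0#
      off (suc i) j = h₂₁ i (suc j)

-- The weighted characteristic polynomial by recursion on rooted trees

module CharacteristicPolynomials where

  open import Data.Fin.Base using (_↑ˡ_; _↑ʳ_; splitAt)
  open import Data.Fin.Permutation using (↔⇒≡)
  open import Data.Fin.Properties using (_≟_; splitAt-↑ˡ; splitAt-↑ʳ; ↑ˡ-injective; ↑ʳ-injective)
  import Data.Sum.Base as Sum
  open import Relation.Binary.PropositionalEquality as ≡ using (_≡_; _≢_; cong)
  open RootedTrees
  open Isomorphisms
  open TreeOf
  open Polynomials using (polyRing)

  -- The characteristic polynomials p of a rooted tree and q of the forest left by its root,
  -- for an arbitrary family f of weights.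
  module Recursion {c ℓ} (R : CommutativeRing c ℓ) (f : ℕ → CommutativeRing.Carrier R) where
    open CommutativeRing R hiding (_-_; zero)
    open import Algebra.Properties.Ring ring
    open import Relation.Binary.Reasoning.Setoid setoid
    open import Algebra.Solver.Ring.NaturalCoefficients.Default commutativeSemiring using (solve; _:*_; _:+_; _:=_)

    p q : Rooted → Carrier
    p (node k) = f k
    p (s ◃ t)  = p t * p s + - (q t * q s)
    q (node k) = 1#
    q (s ◃ t)  = q t * p s

    ◃-cong-p : ∀ {s s′ t t′} → p s ≈ p s′ → q s ≈ q s′ → p t ≈ p t′ → q t ≈ q t′ → p (s ◃ t) ≈ p (s′ ◃ t′)
    ◃-cong-p a b c d = +-cong (*-cong c a) (-‿cong (*-cong d b))

    -- The arguments are explicit because they cannot be inferred over the polynomial ring.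
    p-step : ∀ d a b a° b° s t → d ≈ a * b + - (a° * b°) → a ≈ p t → b ≈ p s → a° ≈ q t → b° ≈ q s → d ≈ p (s ◃ t)
    p-step _ _ _ _ _ _ _ e f g f° g° = trans e (+-cong (*-cong f g) (-‿cong (*-cong f° g°)))

    q-step : ∀ d a° b s t → d ≈ a° * b → a° ≈ q t → b ≈ p s → d ≈ q (s ◃ t)
    q-step _ _ _ _ _ e f g = trans e (*-cong f g)

    singleton : ∀ w → 1# * (w + - 0#) * 1# + 0# ≈ w
    singleton w = trans (+-identityʳ _) (trans (*-identityʳ _) (trans (*-identityˡ _) (trans (+-congˡ -0#≈0#) (+-identityʳ w))))

    ◃-cong-q : ∀ {s s′ t t′} → p s ≈ p s′ → q t ≈ q t′ → q (s ◃ t) ≈ q (s′ ◃ t′)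
    ◃-cong-q a d = *-cong d a

    p-cong : ∀ {s t} → s ~ t → p s ≈ p t
    q-cong : ∀ {s t} → s ~ t → q s ≈ q t
    p-cong ~-refl = refl
    p-cong (~-sym e) = sym (p-cong e)
    p-cong (~-trans e e′) = trans (p-cong e) (p-cong e′)
    p-cong (◃-cong {s} {s′} {t} {t′} e e′) = ◃-cong-p {s} {s′} {t} {t′} (p-cong e) (q-cong e) (p-cong e′) (q-cong e′)
    -- Negation is written as multiplication by -1, and -1 is treated as an indeterminate u: the
    -- identity then holds in every commutative semiring.
    p-cong (◃-swap s s′ t) = begin
      (p t * p s′ + - (q t * q s′)) * p s + - (q t * p s′ * q s)
        ≈⟨ +-cong (*-congʳ (+-congˡ (-1*x≈-x _))) (-1*x≈-x _) ⟨
      (p t * p s′ + - 1# * (q t * q s′)) * p s + - 1# * (q t * p s′ * q s)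
        ≈⟨ shuffle (- 1#) (p t) (q t) (p s) (q s) (p s′) (q s′) ⟩
      (p t * p s + - 1# * (q t * q s)) * p s′ + - 1# * (q t * p s * q s′)
        ≈⟨ +-cong (*-congʳ (+-congˡ (-1*x≈-x _))) (-1*x≈-x _) ⟩
      (p t * p s + - (q t * q s)) * p s′ + - (q t * p s * q s′) ∎
      where
      shuffle : ∀ u a b c d e f →
        (a * e + u * (b * f)) * c + u * (b * e * d) ≈ (a * c + u * (b * d)) * e + u * (b * c * f)
      shuffle = solve 7 (λ u a b c d e f →
        (a :* e :+ u :* (b :* f)) :* c :+ u :* (b :* e :* d) := (a :* c :+ u :* (b :* d)) :* e :+ u :* (b :* c :* f)) refl
    q-cong ~-refl = refl
    q-cong (~-sym e) = sym (q-cong e)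
    q-cong (~-trans e e′) = trans (q-cong e) (q-cong e′)
    q-cong (◃-cong e e′) = *-cong (q-cong e′) (p-cong e)
    q-cong (◃-swap s s′ t) = trans (*-assoc _ _ _) (trans (*-congˡ (*-comm _ _)) (sym (*-assoc _ _ _)))

  open CommutativeRing polyRing hiding (_-_; zero)
  open import Algebra.Bundles.Raw using (RawRing)
  open RawRing rawRing using (rawSemiring)
  open import Algebra.Definitions.RawSemiring rawSemiring using (_^_)
  open import Algebra.Properties.Ring ring using (-0#≈0#)
  open Defs.Determinant rawRing using (det)
  open Bridges polyRing using (e₀; _°; module Joined)
  open Determinants polyRing using (det-cong; det-permute)

  open Recursion polyRing (λ k → x ^ suc k) public

  charMatrix : ∀ W → Fin (WeightedTree.order W) → Fin (WeightedTree.order W) → Poly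
  charMatrix W i j = I* W i j + - adjacencyMatrix W i j

  C : ∀ t → Fin (size t) → Fin (size t) → Poly
  C t = charMatrix (toTree t)

  entry : ∀ t → Bool → V t → V t → Poly
  entry t d v w = (if d then x ^ suc (label t v) else 0#) + - (if edge t v w then 1# else 0#)

  entry-cong : ∀ t {d d′ v v′ w w′} → d ≡ d′ → v ≡ v′ → w ≡ w′ → entry t d v w ≡ entry t d′ v′ w′
  entry-cong t ≡.refl ≡.refl ≡.refl = ≡.refl

  isTop-zero : ∀ t → isTop t (toV t zero) ≡ true
  isTop-zero t = ≡.trans (cong (isTop t) (toV-zero t)) (isTop-top t)

  isTop-suc : ∀ t i → isTop t (toV t (suc i)) ≡ false
  isTop-suc t i with isTop t (toV t (suc i)) in eq
  ... | false = ≡.refl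
  ... | true with ≡.trans (≡.sym (fromV-toV t (suc i)))
                    (≡.trans (cong (fromV t) (≡.trans (isTop⇒≡ t _ eq) (≡.sym (toV-zero t)))) (fromV-toV t zero))
  ...   | ()

  module _ (s t : Rooted) where

    private
      m = extra t
      n = extra s

      left : ∀ i → toV (s ◃ t) (i ↑ˡ size s) ≡ inj₁ (toV t i)
      left i = cong (Sum.map (toV t) (toV s)) (splitAt-↑ˡ (size t) i (size s))

      right : ∀ i → toV (s ◃ t) (size t ↑ʳ i) ≡ inj₂ (toV s i)
      right i = cong (Sum.map (toV t) (toV s)) (splitAt-↑ʳ (size t) (size s) i)

      ↑ˡ≢↑ʳ : ∀ i j → i ↑ˡ size s ≢ size t ↑ʳ j
      ↑ˡ≢↑ʳ i j e with ≡.trans (≡.sym (splitAt-↑ˡ (size t) i (size s)))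
                        (≡.trans (cong (splitAt (size t)) e) (splitAt-↑ʳ (size t) (size s) j))
      ... | ()

      h₁₁ : ∀ i j → C (s ◃ t) (i ↑ˡ size s) (j ↑ˡ size s) ≡ C t i j
      h₁₁ i j = entry-cong (s ◃ t)
        (does-⇔ (mk⇔ (↑ˡ-injective (size s) i j) (cong (_↑ˡ size s))) (i ↑ˡ size s ≟ j ↑ˡ size s) (i ≟ j))
        (left i) (left j)

      h₂₂ : ∀ i j → C (s ◃ t) (size t ↑ʳ i) (size t ↑ʳ j) ≡ C s i j
      h₂₂ i j = entry-cong (s ◃ t)
        (does-⇔ (mk⇔ (↑ʳ-injective (size t) i j) (cong (size t ↑ʳ_))) (size t ↑ʳ i ≟ size t ↑ʳ j) (i ≟ j))
        (right i) (right j)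

      link : Bool → Bool → Poly
      link b b′ = - (if b ∧ b′ then 1# else 0#)

      h₁₂ : ∀ i j → C (s ◃ t) (i ↑ˡ size s) (size t ↑ʳ j) ≡ link (isTop t (toV t i)) (isTop s (toV s j))
      h₁₂ i j = entry-cong (s ◃ t) (dec-false (i ↑ˡ size s ≟ size t ↑ʳ j) (↑ˡ≢↑ʳ i j)) (left i) (right j)

      h₂₁ : ∀ i j → C (s ◃ t) (size t ↑ʳ i) (j ↑ˡ size s) ≡ link (isTop s (toV s i)) (isTop t (toV t j))
      h₂₁ i j = entry-cong (s ◃ t) (dec-false (size t ↑ʳ i ≟ j ↑ˡ size s) (λ e → ↑ˡ≢↑ʳ j i (≡.sym e))) (right i) (left j)

      top-row : ∀ t j → - (if isTop t (toV t j) then 1# else 0#) ≡ - e₀ j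
      top-row t zero rewrite isTop-zero t = ≡.refl
      top-row t (suc j) rewrite isTop-suc t j = ≡.refl

      module J = Joined m n (C (s ◃ t)) (C t) (C s) (λ i j → reflexive (h₁₁ i j)) (λ i j → reflexive (h₂₂ i j))
        (λ j → reflexive (≡.trans (h₁₂ zero j)
          (≡.trans (cong (λ b → link b (isTop s (toV s j))) (isTop-zero t)) (top-row s j))))
        (λ i j → reflexive (≡.trans (h₁₂ (suc i) j) (cong (λ b → link b (isTop s (toV s j))) (isTop-suc t i))))
        (λ j → reflexive (≡.trans (h₂₁ zero j)
          (≡.trans (cong (λ b → link b (isTop t (toV t j))) (isTop-zero s)) (top-row t j))))
        (λ i j → reflexive (≡.trans (h₂₁ (suc i) j) (cong (λ b → link b (isTop t (toV t j))) (isTop-suc s i))))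

    bridge : det (C (s ◃ t)) ≈ det (C t) * det (C s) + - (det (C t °) * det (C s °))
    bridge = J.det-bridge

    bridge° : det (C (s ◃ t) °) ≈ det (C t °) * det (C s)
    bridge° = J.det-bridge°

  det-p : ∀ t → det (C t) ≈ p t
  det-q : ∀ t → det (C t °) ≈ q t
  det-p (node k) = singleton (x ^ suc k)
  det-p (s ◃ t) = p-step (det (C (s ◃ t))) (det (C t)) (det (C s)) (det (C t °)) (det (C s °)) s t
    (bridge s t) (det-p t) (det-p s) (det-q t) (det-q s)
  det-q (node k) = refl {1#}
  det-q (s ◃ t) = q-step (det (C (s ◃ t) °)) (det (C t °)) (det (C s)) s t (bridge° s t) (det-q t) (det-p s)

  φ*-toTree : ∀ t → φ* (toTree t) ≈ₚ p t
  φ*-toTree = det-p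

  det-reindex : ∀ {m n} (f : Fin m ↔ Fin n) (M : Fin m → Fin m → Poly) (N : Fin n → Fin n → Poly) →
                (∀ i j → N (Inverse.to f i) (Inverse.to f j) ≡ M i j) → det M ≈ₚ det N
  -- A bijection forces equal orders, after which reindexing is a permutation of rows and columns.
  det-reindex f M N eq with ↔⇒≡ f
  ... | ≡.refl = trans {det M} {det (λ i j → N (to i) (to j))} {det N}
    (det-cong {M = M} {N = λ i j → N (to i) (to j)} (λ i j → reflexive (≡.sym (eq i j))))
    (det-permute N to (λ {i} {j} e →
      ≡.trans (≡.sym (strictlyInverseʳ i)) (≡.trans (cong from e) (strictlyInverseʳ j))))
    where open Inverse f

  φ*-cong : ∀ {U W} → U ≅ W → φ* U ≈ₚ φ* W
  φ*-cong {U} {W} f = det-reindex bijection (charMatrix U) (charMatrix W) eq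
    where
    open _≅_ f
    open Inverse bijection using (strictlyInverseʳ)
    eq : ∀ i j → charMatrix W (to i) (to j) ≡ charMatrix U i j
    eq i j rewrite does-⇔ (mk⇔ (λ e → ≡.trans (≡.sym (strictlyInverseʳ i)) (≡.trans (cong from e) (strictlyInverseʳ j)))
                               (cong to)) (to i ≟ to j) (i ≟ j)
                 | weight-preserving i | adj-preserving i j = ≡.refl

-- Degrees, and decidable equality of polynomials

module Degrees where

  import Algebra.Bundles.Raw
  open import Data.Integer.Base as ℤ using (ℤ; 0ℤ; 1ℤ)
  import Data.Integer.Properties as ℤ
  open import Data.List.Base using (map)
  open import Data.Nat.Base using (_+_)
  open import Data.Nat.Properties
  open import Relation.Binary.Definitions using (tri<; tri≈; tri>)
  open import Relation.Binary.PropositionalEquality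
  open RootedTrees
  open Polynomials using (coeff-+; coeff-·; coeff-neg; _·_)
  open CharacteristicPolynomials using (p; q)

  Degree≤ : ℕ → Poly → Set
  Degree≤ d f = ∀ k → d < k → coeff f k ≡ 0ℤ

  coeff-∷-* : ∀ a f g k → coeff ((a ∷ f) *ₚ g) k ≡ a ℤ.* coeff g k ℤ.+ coeff (0ℤ ∷ (f *ₚ g)) k
  coeff-∷-* a f g k = trans (coeff-+ (a · g) (0ℤ ∷ (f *ₚ g)) k) (cong (ℤ._+ coeff (0ℤ ∷ (f *ₚ g)) k) (coeff-· a g k))

  coeff-*-zero : ∀ f g → (∀ k → coeff f k ≡ 0ℤ) → ∀ k → coeff (f *ₚ g) k ≡ 0ℤ
  coeff-*-zero [] g z k = refl
  coeff-*-zero (a ∷ f) g z k = trans (coeff-∷-* a f g k) (cong₂ ℤ._+_ head (tail k))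
    where
    head : a ℤ.* coeff g k ≡ 0ℤ
    head = trans (cong (ℤ._* coeff g k) (z 0)) (ℤ.*-zeroˡ (coeff g k))
    tail : ∀ k → coeff (0ℤ ∷ (f *ₚ g)) k ≡ 0ℤ
    tail zero = refl
    tail (suc k) = coeff-*-zero f g (λ k → z (suc k)) k

  module _ {e : ℕ} (g : Poly) (deg : Degree≤ e g) where

    private
      tail : ∀ a f → Degree≤ 0 (a ∷ f) → ∀ k → coeff (0ℤ ∷ (f *ₚ g)) k ≡ 0ℤ
      tail a f h zero = refl
      tail a f h (suc k) = coeff-*-zero f g (λ k → h (suc k) (s≤s z≤n)) k

    degree-* : ∀ {d} f → Degree≤ d f → Degree≤ (d + e) (f *ₚ g)
    degree-* [] h k _ = refl
    degree-* {zero} (a ∷ f) h k lt = trans (coeff-∷-* a f g k)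
      (cong₂ ℤ._+_ (trans (cong (a ℤ.*_) (deg k lt)) (ℤ.*-zeroʳ a)) (tail a f h k))
    degree-* {suc d} (a ∷ f) h (suc k) lt = trans (coeff-∷-* a f g (suc k))
      (cong₂ ℤ._+_ (trans (cong (a ℤ.*_) (deg (suc k) (≤-<-trans (m≤n+m e (suc d)) lt))) (ℤ.*-zeroʳ a))
                   (degree-* f (λ k lt → h (suc k) (s≤s lt)) k (s≤s⁻¹ lt)))

    leading-* : ∀ {d} f → Degree≤ d f → coeff (f *ₚ g) (d + e) ≡ coeff f d ℤ.* coeff g e
    leading-* [] h = sym (ℤ.*-zeroˡ (coeff g e))
    leading-* {zero} (a ∷ f) h = trans (coeff-∷-* a f g e)
      (trans (cong (λ z → a ℤ.* coeff g e ℤ.+ z) (tail a f h e)) (ℤ.+-identityʳ _))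
    leading-* {suc d} (a ∷ f) h = trans (coeff-∷-* a f g (suc (d + e)))
      (trans (cong₂ ℤ._+_ (trans (cong (a ℤ.*_) (deg (suc (d + e)) (s≤s (m≤n+m e d)))) (ℤ.*-zeroʳ a))
                          (leading-* f (λ k lt → h (suc k) (s≤s lt))))
             (ℤ.+-identityˡ _))

  degree-sub : ∀ {d} f g → Degree≤ d f → Degree≤ d g → Degree≤ d (f +ₚ map ℤ.-_ g)
  degree-sub f g hf hg k lt = trans (coeff-+ f (map ℤ.-_ g) k)
    (cong₂ ℤ._+_ (hf k lt) (trans (coeff-neg g k) (cong ℤ.-_ (hg k lt))))

  open import Algebra.Definitions.RawSemiring (Algebra.Bundles.Raw.RawRing.rawSemiring Defs.ℤ[x]) using (_^_)

  degree-x^ : ∀ k → Degree≤ k (x ^ k) × coeff (x ^ k) k ≡ 1ℤ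
  degree-x^ zero = (λ { (suc k) _ → refl }) , refl
  degree-x^ (suc k) with degree-x^ k
  ... | h , l = degree-* (x ^ k) h x degree-x , trans (leading-* (x ^ k) h x degree-x) (cong (1ℤ ℤ.*_) l)
    where
    degree-x : Degree≤ 1 x
    degree-x (suc (suc k)) _ = refl
    degree-x (suc zero) (s≤s ())

  pred-+ : ∀ a b → 0 < a → pred a + b ≡ pred (a + b)
  pred-+ (suc a) b _ = refl

  -- The subtracted product q(T) q(S) has degree at most the total mass minus 2, so the product p(T)
  -- p(S) of monic polynomials decides the leading term.
  degree-p : ∀ t → Degree≤ (mass t) (p t) × coeff (p t) (mass t) ≡ 1ℤ
  degree-q : ∀ t → Degree≤ (pred (mass t)) (q t)
  degree-p (node k) = degree-x^ (suc k)
  degree-p (s ◃ t) with degree-p s | degree-p t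
  ... | hs , ls | ht , lt =
      degree-sub (p t *ₚ p s) (q t *ₚ q s) (degree-* (p s) hs (p t) ht) (λ k lt → low k (<⇒≤ lt))
    , trans (coeff-+ (p t *ₚ p s) (map ℤ.-_ (q t *ₚ q s)) (mass t + mass s))
      (cong₂ ℤ._+_ (trans (leading-* (p s) hs (p t) ht) (cong₂ ℤ._*_ lt ls))
        (trans (coeff-neg (q t *ₚ q s) (mass t + mass s)) (cong ℤ.-_ (low _ ≤-refl))))
    where
    pred< : ∀ {a} → 0 < a → pred a < a
    pred< {suc a} _ = ≤-refl
    low : ∀ k → mass t + mass s ≤ k → coeff (q t *ₚ q s) k ≡ 0ℤ
    low k le = degree-* (q s) (degree-q s) (q t) (degree-q t) k
      (<-≤-trans (+-mono-< (pred< (mass>0 t)) (pred< (mass>0 s))) le)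
  degree-q (node k) (suc j) _ = refl
  degree-q (s ◃ t) = subst (λ d → Degree≤ d (q t *ₚ p s)) (pred-+ (mass t) (mass s) (mass>0 t))
    (degree-* (p s) (proj₁ (degree-p s)) (q t) (degree-q t))

  1≢0 : 1ℤ ≢ 0ℤ
  1≢0 ()

  -- The degree of the monic polynomial p is the total weight. Mates therefore have equal weight,
  -- which makes the search for them finite.
  p-mass : ∀ s t → p s ≈ₚ p t → mass s ≡ mass t
  p-mass s t e with <-cmp (mass s) (mass t)
  ... | tri≈ _ eq _ = eq
  ... | tri< lt _ _ = ⊥-elim (1≢0 (trans (sym (proj₂ (degree-p t))) (trans (sym (e (mass t))) (proj₁ (degree-p s) _ lt))))
  ... | tri> _ _ lt = ⊥-elim (1≢0 (trans (sym (proj₂ (degree-p s))) (trans (e (mass s)) (proj₁ (degree-p t) _ lt))))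

  sequences? : ∀ {f g : ℕ → ℤ} → Dec (f 0 ≡ g 0) → Dec (∀ k → f (suc k) ≡ g (suc k)) → Dec (∀ k → f k ≡ g k)
  sequences? d e = map′ (λ (h , t) → λ { zero → h ; (suc k) → t k }) (λ h → h 0 , λ k → h (suc k)) (d ×-dec e)

  -- The quantifier over all k is harmless: past the end of both lists every coefficient is zero.
  ≈ₚ? : ∀ f g → Dec (f ≈ₚ g)
  ≈ₚ? [] []           = yes λ _ → refl
  ≈ₚ? [] (b ∷ g)      = sequences? (0ℤ ℤ.≟ b) (≈ₚ? [] g)
  ≈ₚ? (a ∷ f) []      = sequences? (a ℤ.≟ 0ℤ) (≈ₚ? f [])
  ≈ₚ? (a ∷ f) (b ∷ g) = sequences? (a ℤ.≟ b) (≈ₚ? f g)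

-- Counting isomorphism classes by lists of representatives

module Classes where

  open import Data.Bool.Properties using () renaming (_≟_ to _≟ᵇ_)
  open import Data.Fin.Properties using (any?; all?) renaming (_≟_ to _≟ᶠ_)
  open import Data.List.Base using (length; lookup)
  open import Data.List.Relation.Unary.All as All using (All; []; _∷_)
  open import Data.List.Relation.Unary.All.Properties using (¬Any⇒All¬)
  open import Data.List.Relation.Unary.AllPairs using (AllPairs; []; _∷_)
  open import Data.List.Relation.Unary.Any as Any using (Any; here; there; index)
  open import Data.List.Relation.Unary.Any.Properties using (lookup-index)
  open import Data.List.Membership.Propositional.Properties using (∈-lookup)
  import Data.Nat.Properties as ℕ
  open import Data.Vec.Base as Vec using (Vec; []; _∷_; tabulate)
  open import Data.Vec.Properties using (lookup∘tabulate)
  open import Relation.Binary.PropositionalEquality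
  open RootedTrees
  open TreeOf using (toTree)

  anyVec? : ∀ {n m} {P : Vec (Fin n) m → Set} → (∀ v → Dec (P v)) → Dec (∃[ v ] P v)
  anyVec? {m = ℕ.zero} P? = map′ (λ h → [] , h) (λ { ([] , h) → h }) (P? [])
  anyVec? {m = ℕ.suc m} P? = map′ (λ (i , v , h) → i ∷ v , h) (λ { (i ∷ v , h) → i , v , h })
    (any? λ i → anyVec? λ v → P? (i ∷ v))

  module _ (U W : WeightedTree) where
    private
      module U = WeightedTree U
      module W = WeightedTree W

      IsIso : Vec (Fin W.order) U.order → Vec (Fin U.order) W.order → Set
      IsIso v u = (∀ j → Vec.lookup v (Vec.lookup u j) ≡ j) × (∀ i → Vec.lookup u (Vec.lookup v i) ≡ i)
                × (∀ i j → W.adj (Vec.lookup v i) (Vec.lookup v j) ≡ U.adj i j)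
                × (∀ i → W.weight (Vec.lookup v i) ≡ U.weight i)

      isIso? : ∀ v u → Dec (IsIso v u)
      isIso? v u = all? (λ j → _ ≟ᶠ j) ×-dec all? (λ i → _ ≟ᶠ i)
                   ×-dec all? (λ i → all? λ j → _ ≟ᵇ _) ×-dec all? (λ i → _ ℕ.≟ _)

      fromVecs : ∀ {v u} → IsIso v u → U ≅ W
      fromVecs {v} {u} (a , b , c , d) = record
        { bijection = mk↔ₛ′ (Vec.lookup v) (Vec.lookup u) a b
        ; adj-preserving = c ; weight-preserving = d }

      toVecs : (I : U ≅ W) → IsIso (tabulate (_≅_.to I)) (tabulate (_≅_.from I))
      toVecs I = (λ j → trans (lookup∘tabulate to _) (trans (cong to (lookup∘tabulate from j)) (strictlyInverseˡ j)))
               , (λ i → trans (lookup∘tabulate from _)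
                   (trans (cong from (lookup∘tabulate to i)) (Inverse.strictlyInverseʳ bijection i)))
               , (λ i j → trans (cong₂ W.adj (lookup∘tabulate to i) (lookup∘tabulate to j)) (adj-preserving i j))
               , (λ i → trans (cong W.weight (lookup∘tabulate to i)) (weight-preserving i))
        where open _≅_ I

    infix 4 _≅?_
    -- A bijection and its inverse are tabulated as vectors over finite sets, so that exhaustive
    -- search applies.
    _≅?_ : Dec (U ≅ W)
    _≅?_ = map′ (λ (v , u , h) → fromVecs {v} {u} h)
                (λ I → tabulate (_≅_.to I) , tabulate (_≅_.from I) , toVecs I)
                (anyVec? λ v → anyVec? λ u → isIso? v u)

  Distinct : List Rooted → Set
  Distinct = AllPairs (λ s t → toTree s ≇ toTree t)

  Represented : WeightedTree → List Rooted → Set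
  Represented W ts = Any (λ t → W ≅ toTree t) ts

  distinct-lookup : ∀ {ts} → Distinct ts → ∀ i j → toTree (lookup ts i) ≅ toTree (lookup ts j) → i ≡ j
  distinct-lookup (_ ∷ _) zero zero I = refl
  distinct-lookup {t ∷ ts} (n ∷ _) zero (suc j) I = ⊥-elim (All.lookup n (∈-lookup {xs = ts} j) I)
  distinct-lookup {t ∷ ts} (n ∷ _) (suc i) zero I = ⊥-elim (All.lookup n (∈-lookup {xs = ts} i) (≅-sym I))
  distinct-lookup (_ ∷ d) (suc i) (suc j) I = cong suc (distinct-lookup d i j I)

  classes : List Rooted → List Rooted
  classes [] = []
  classes (t ∷ ts) with Any.any? (λ s → toTree t ≅? toTree s) (classes ts)
  ... | yes _ = classes ts
  ... | no _  = t ∷ classes ts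

  classes-distinct : ∀ ts → Distinct (classes ts)
  classes-distinct [] = []
  classes-distinct (t ∷ ts) with Any.any? (λ s → toTree t ≅? toTree s) (classes ts)
  ... | yes _ = classes-distinct ts
  ... | no n  = ¬Any⇒All¬ (classes ts) n ∷ classes-distinct ts

  classes-all : ∀ {P : Rooted → Set} {ts} → All P ts → All P (classes ts)
  classes-all [] = []
  classes-all {ts = t ∷ ts} (h ∷ hs) with Any.any? (λ s → toTree t ≅? toTree s) (classes ts)
  ... | yes _ = classes-all hs
  ... | no _  = h ∷ classes-all hs

  classes-represent : ∀ {W} ts → Represented W ts → Represented W (classes ts)
  classes-represent (t ∷ ts) h with Any.any? (λ s → toTree t ≅? toTree s) (classes ts)
  classes-represent (t ∷ ts) (here I)  | yes r = Any.map (≅-trans I) r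
  classes-represent (t ∷ ts) (there r) | yes _ = classes-represent ts r
  classes-represent (t ∷ ts) (here I)  | no _  = here I
  classes-represent (t ∷ ts) (there r) | no _  = there (classes-represent ts r)

  cardinality : ∀ (P : WeightedTree → Set) ts → Distinct ts → All (λ t → P (toTree t)) ts →
                (∀ W → P W → Represented W ts) → HasCardinality (restrict weightedTrees P) (length ts)
  cardinality P ts distinct all-P complete = record
    { to        = λ (W , h) → index (complete W h)
    ; from      = λ i → toTree (lookup ts i) , All.lookup all-P (∈-lookup {xs = ts} i)
    ; to-cong   = λ {x} {y} I → distinct-lookup distinct _ _
        (≅-trans (≅-sym (at x)) (≅-trans I (at y)))
    ; from-cong = λ { refl → ≅-refl }
    ; inverse   = (λ {i} {x} I → distinct-lookup distinct _ _ (≅-trans (≅-sym (at x)) I))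
                , (λ { {x} refl → ≅-sym (at x) })
    }
    where
    at : ∀ x → proj₁ x ≅ toTree (lookup ts (index (complete (proj₁ x) (proj₂ x))))
    at (W , h) = lookup-index (complete W h)

-- From the counting inequality to the limit

module Limits where

  open import Data.Integer.Base as ℤ using (ℤ; +_; -[1+_])
  import Data.Integer.Properties as ℤ
  open import Data.Nat.Base as ℕ using (_+_; _*_; _∸_)
  import Data.Nat.Properties as ℕ
  open import Data.Nat.DivMod using (_/_; _%_; m≡m%n+[m/n]*n; m%n<n; /-monoˡ-≤; m*n/n≡m)
  open import Data.Nat.Tactic.RingSolver using (solve-∀)
  open import Data.Rational.Base as ℚ using (ℚ; 0ℚ; 1ℚ; mkℚ)
  import Data.Rational.Properties as ℚ
  open import Data.Rational.Unnormalised.Base as ℚᵘ using (ℚᵘ; mkℚᵘ; *<*)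
  import Data.Rational.Unnormalised.Properties as ℚᵘ
  open import Relation.Binary.PropositionalEquality

  gap : ∀ a b t → a + b ≡ suc t → ℤ.∣ + a ℤ.* + 1 ℤ.+ -[1+ 0 ] ℤ.* + suc t ∣ ≡ b
  gap a b t e = begin
    ℤ.∣ + a ℤ.* + 1 ℤ.+ -[1+ 0 ] ℤ.* + suc t ∣ ≡⟨ cong₂ (λ u v → ℤ.∣ u ℤ.+ v ∣) (ℤ.*-identityʳ (+ a)) (ℤ.-1*i≡-i (+ suc t)) ⟩
    ℤ.∣ + a ℤ.- + suc t ∣                      ≡⟨ cong (λ n → ℤ.∣ + a ℤ.- + n ∣) (sym e) ⟩
    ℤ.∣ + a ℤ.- + (a + b) ∣                    ≡⟨ cong ℤ.∣_∣ (ℤ.m-n≡m⊖n a (a + b)) ⟩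
    ℤ.∣ a ℤ.⊖ (a + b) ∣                        ≡⟨ ℤ.∣⊖∣-≤ (ℕ.m≤m+n a b) ⟩
    (a + b) ∸ a                                ≡⟨ ℕ.m+n∸m≡n a b ⟩
    b                                          ∎
    where open ≡-Reasoning

  -- The distance of a / t from 1 is b / t, and a positive ε is at least the reciprocal of its
  -- denominator.
  close-to-1 : ∀ a b t .{{_ : NonZero t}} ε → 0ℚ ℚ.< ε → a + b ≡ t → b * ℚ.denominatorℕ ε < t →
               ℚ.∣ (+ a) ℚ./ t ℚ.- 1ℚ ∣ ℚ.< ε
  close-to-1 a b (suc t) (mkℚ (+ zero) _ _) (ℚ.*<* (ℤ.+<+ ())) _ _
  close-to-1 a b (suc t) (mkℚ -[1+ _ ] _ _) (ℚ.*<* ()) _ _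
  close-to-1 a b (suc t) ε@(mkℚ (+ suc e) d _) _ eq small = ℚ.toℚᵘ-cancel-< (ℚᵘ.<-respˡ-≃ (ℚᵘ.≃-sym value)
    (*<* (subst₂ ℤ._<_ (ℤ.pos-* m (suc d)) (ℤ.pos-* (suc e) (suc (t * 1))) (ℤ.+<+ bound))))
    where
    r = (+ a) ℚ./ suc t
    m = ℤ.∣ + a ℤ.* + 1 ℤ.+ -[1+ 0 ] ℤ.* + suc t ∣
    value : ℚ.toℚᵘ ℚ.∣ r ℚ.- 1ℚ ∣ ℚᵘ.≃ ℚᵘ.∣ mkℚᵘ (+ a) t ℚᵘ.+ ℚᵘ.- ℚᵘ.1ℚᵘ ∣
    value = ℚᵘ.≃-trans (ℚ.toℚᵘ-homo-∣-∣ (r ℚ.- 1ℚ)) (ℚᵘ.∣-∣-cong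
      (ℚᵘ.≃-trans (ℚ.toℚᵘ-homo-+ r (ℚ.- 1ℚ)) (ℚᵘ.+-congˡ (ℚᵘ.- ℚᵘ.1ℚᵘ) (ℚ.toℚᵘ-fromℚᵘ (mkℚᵘ (+ a) t)))))
    open ℕ.≤-Reasoning
    bound : m * suc d < suc e * suc (t * 1)
    bound = begin-strict
      m * suc d           ≡⟨ cong (_* suc d) (gap a b t eq) ⟩
      b * suc d           <⟨ small ⟩
      suc t               ≡⟨ cong suc (ℕ.*-identityʳ t) ⟨
      suc (t * 1)         ≤⟨ ℕ.m≤n*m (suc (t * 1)) (suc e) ⟩
      suc e * suc (t * 1) ∎

  -- If b k² ≤ t n G for k = n / K, then b is negligible against t, because n < 2 k K.
  sparse : ∀ K .{{_ : NonZero K}} G d n b t → suc (2 * K * G * d) * K ≤ n → 0 < t →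
           b * (n / K * (n / K)) ≤ t * (n * G) → b * d < t
  sparse K G d n b t big t>0 h with b * d ℕ.<? t
  ... | yes p = p
  ... | no ¬p = contradiction (b-bound b (ℕ.≮⇒≥ ¬p) h) λ ()
    where
    k = n / K
    k-big : 2 * K * G * d < k
    k-big = ℕ.≤-trans (ℕ.≤-reflexive (sym (m*n/n≡m (suc (2 * K * G * d)) K))) (/-monoˡ-≤ K big)
    k>0 : 0 < k
    k>0 = ℕ.≤-<-trans z≤n k-big
    -- As k is at least 1, rounding down in n / K loses at most a factor 2.
    n≤ : n ≤ 2 * K * k
    n≤ = begin
      n             ≡⟨ m≡m%n+[m/n]*n n K ⟩
      n % K + k * K ≤⟨ ℕ.+-monoˡ-≤ (k * K) (ℕ.<⇒≤ (m%n<n n K)) ⟩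
      K + k * K     ≡⟨ cong (_+ k * K) (ℕ.*-identityˡ K) ⟨
      1 * K + k * K ≤⟨ ℕ.+-monoˡ-≤ (k * K) (ℕ.*-monoˡ-≤ K k>0) ⟩
      k * K + k * K ≡⟨ eq k K ⟩
      2 * K * k     ∎
      where
      open ℕ.≤-Reasoning
      eq : ∀ k K → k * K + k * K ≡ 2 * K * k
      eq = solve-∀
    -- For b = 0 the assumption contradicts t > 0. Otherwise t ≤ b d and n ≤ 2 K k turn the
    -- hypothesis into b k² ≤ b (2 K G d) k, and cancelling k contradicts `k-big`.
    b-bound : ∀ b → t ≤ b * d → b * (k * k) ≤ t * (n * G) → 1 ≤ 0
    b-bound zero t≤ _ = ℕ.≤-trans t>0 t≤
    b-bound (suc b) t≤ h = contradiction (ℕ.*-cancelʳ-≤ (suc b * k) (suc b * (2 * K * G * d)) k {{ℕ.>-nonZero k>0}} (begin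
      suc b * k * k                       ≡⟨ ℕ.*-assoc (suc b) k k ⟩
      suc b * (k * k)                     ≤⟨ h ⟩
      t * (n * G)                         ≤⟨ ℕ.*-mono-≤ t≤ (ℕ.*-monoˡ-≤ G n≤) ⟩
      suc b * d * (2 * K * k * G)         ≡⟨ eq (suc b) d K k G ⟩
      suc b * (2 * K * G * d) * k         ∎)) (ℕ.<⇒≱ (ℕ.*-monoʳ-< (suc b) k-big))
      where
      open ℕ.≤-Reasoning
      eq : ∀ b d K k G → b * d * (2 * K * k * G) ≡ b * (2 * K * G * d) * k
      eq = solve-∀

-- Cospectral mates, exchange of branches, and the proportion

module Mates where

  open import Data.Fin.Base using (inject≤)
  open import Data.Fin.Properties using (toℕ-injective; toℕ-inject≤; toℕ<n; injective⇒≤; *↔×)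
  import Data.Integer.Base as ℤ
  open import Data.List.Base using (filter; length; lookup)
  open import Data.List.Membership.Propositional using (lose; find)
  open import Data.List.Membership.Propositional.Properties using (∈-lookup; ∈-filter⁺)
  open import Data.List.Relation.Unary.All as All using (All; []; _∷_)
  import Data.List.Relation.Unary.All.Properties as All
  open import Data.List.Relation.Unary.Any as Any using (Any; here; there; index)
  open import Data.List.Relation.Unary.Any.Properties using (lookup-index)
  open import Data.List.Relation.Unary.AllPairs.Properties using () renaming (filter⁺ to AllPairs-filter⁺)
  open import Data.Nat.Base using (_+_; _*_)
  open import Data.Nat.DivMod using (_/_)
  open import Data.Nat.Properties
  open import Data.Product.Properties using (,-injective)
  open import Data.Rational.Base as ℚ using (ℚ; 0ℚ; 1ℚ)
  open import Relation.Binary.PropositionalEquality hiding (J)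
  open RootedTrees
  open Isomorphisms using (~⇒iso; iso⇒~)
  open TreeOf
  open RootedForm using (fromTree)
  open CharacteristicPolynomials
  open Degrees
  open Classes
  open Encodings
  open Limits

  does-true : ∀ {A : Set} (d : Dec A) → does d ≡ true → A
  does-true (yes a) _ = a

  ≈ₚ-sym : ∀ {f g} → f ≈ₚ g → g ≈ₚ f
  ≈ₚ-sym e k = sym (e k)

  ≈ₚ-trans : ∀ {f g h} → f ≈ₚ g → g ≈ₚ h → f ≈ₚ h
  ≈ₚ-trans e e′ k = trans (e k) (e′ k)

  p-cospectral : ∀ s t → WeightedCospectral (toTree s) (toTree t) → p s ≈ₚ p t
  p-cospectral s t e = ≈ₚ-trans {p s} {φ* (toTree s)} {p t} (≈ₚ-sym {φ* (toTree s)} {p s} (φ*-toTree s))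
    (≈ₚ-trans {φ* (toTree s)} {φ* (toTree t)} {p t} e (φ*-toTree t))

  cospectral : ∀ s t → p s ≈ₚ p t → WeightedCospectral (toTree s) (toTree t)
  cospectral s t e = ≈ₚ-trans {φ* (toTree s)} {p s} {φ* (toTree t)} (φ*-toTree s)
    (≈ₚ-trans {p s} {p t} {φ* (toTree t)} e (≈ₚ-sym {φ* (toTree t)} {p t} (φ*-toTree t)))

  -- By `p-mass` a mate has the mass of t, so a finite list is enough to search. Deciding this is
  -- what allows the trees with a mate to be counted.
  mate? : ∀ t → Dec (HasCospectralMate (toTree t))
  mate? t = map′ from to (Any.any? (λ s → ≈ₚ? (p t) (p s) ×-dec ¬? (toTree t ≅? toTree s)) (trees (mass t)))
    where
    from : Any (λ s → p t ≈ₚ p s × toTree t ≇ toTree s) (trees (mass t)) → HasCospectralMate (toTree t)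
    from a with find a
    ... | s , _ , e , n = toTree s , cospectral t s e , n
    to : HasCospectralMate (toTree t) → Any (λ s → p t ≈ₚ p s × toTree t ≇ toTree s) (trees (mass t))
    to (W , e , n) with fromTree W
    ... | s , I = lose (∈-trees (mass t) s (≤-reflexive (sym (p-mass t s e′)))) (e′ , λ J → n (≅-trans J I))
      where
      e′ : p t ≈ₚ p s
      e′ = p-cospectral t s (≈ₚ-trans {φ* (toTree t)} {φ* W} {φ* (toTree s)} e (≈ₚ-sym {φ* (toTree s)} {φ* W} (φ*-cong I)))

  mate-cong : ∀ {U W} → U ≅ W → HasCospectralMate U → HasCospectralMate W
  mate-cong {U} {W} I (U′ , e , n) =
    U′ , ≈ₚ-trans {φ* W} {φ* U} {φ* U′} (≈ₚ-sym {φ* U} {φ* W} (φ*-cong I)) e , λ J → n (≅-trans I J)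

  module _ {P : Rooted → Set} (P? : ∀ t → Dec (P t)) where

    represented-filter : ∀ {W ts} → (∀ {t} → W ≅ toTree t → P t) → Represented W ts → Represented W (filter P? ts)
    represented-filter {ts = t ∷ ts} h (here I) with P? t
    ... | yes _ = here I
    ... | no ¬p = ⊥-elim (¬p (h I))
    represented-filter {ts = t ∷ ts} h (there r) with P? t
    ... | yes _ = there (represented-filter h r)
    ... | no _  = represented-filter h r

    length-filters : ∀ ts → length (filter P? ts) + length (filter (¬? ∘ P?) ts) ≡ length ts
    length-filters [] = refl
    length-filters (t ∷ ts) with P? t
    ... | yes _ = cong suc (length-filters ts)
    ... | no _  = trans (+-suc _ _) (cong suc (length-filters ts))

  representatives : ℕ → List Rooted
  representatives n = classes (filter (λ t → mass t ≟ n) (trees n))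

  module _ (n : ℕ) where

    abstract
      represent : ∀ W → totalWeight W ≡ n → Represented W (representatives n)
      represent W e with fromTree W
      ... | t , I = classes-represent (filter (λ t → mass t ≟ n) (trees n))
        (lose (∈-filter⁺ (λ t → mass t ≟ n) (∈-trees n t (≤-reflexive mass≡n)) mass≡n) (≅-sym I))
        where
        mass≡n : mass t ≡ n
        mass≡n = trans (sym (totalWeight-toTree t)) (trans (totalWeight-cong I) e)

    representatives-mass : All (λ t → mass t ≡ n) (representatives n)
    representatives-mass = classes-all (All.all-filter (λ t → mass t ≟ n) (trees n))

    representatives-distinct : Distinct (representatives n)
    representatives-distinct = classes-distinct (filter (λ t → mass t ≟ n) (trees n))

    good bad : List Rooted
    good = filter mate? (representatives n)
    bad  = filter (¬? ∘ mate?) (representatives n)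

    total-weights : All (λ t → totalWeight (toTree t) ≡ n) (representatives n)
    total-weights = All.map (λ {t} e → trans (totalWeight-toTree t) e) representatives-mass

    all-trees : HasCardinality (restrict weightedTrees (λ W → totalWeight W ≡ n)) (length (representatives n))
    all-trees = cardinality (λ W → totalWeight W ≡ n) (representatives n) representatives-distinct total-weights represent

    trees-with-mate : HasCardinality (restrict weightedTrees (λ W → totalWeight W ≡ n × HasCospectralMate W)) (length good)
    trees-with-mate = cardinality (λ W → totalWeight W ≡ n × HasCospectralMate W) good
      (AllPairs-filter⁺ mate? representatives-distinct)
      (All.zip (All.filter⁺ mate? total-weights , All.all-filter mate? (representatives n)))
      (λ W (e , h) → represented-filter mate? (λ I → mate-cong I h) (represent W e))

  injection-≤ : ∀ {a b c d e g} (f : Fin a × Fin b × Fin c → Fin d × Fin e × Fin g) →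
                (∀ {x y} → f x ≡ f y → x ≡ y) → a * (b * c) ≤ d * (e * g)
  injection-≤ {a} {b} {c} {d} {e} {g} f inj = injective⇒≤ {f = pack ∘ f ∘ unpack}
    (λ {x} {y} h → unpack-injective (inj (pack-injective h)))
    where
    unpack : Fin (a * (b * c)) → Fin a × Fin b × Fin c
    unpack i = let (x , y) = Inverse.to *↔× i in x , Inverse.to (*↔× {b} {c}) y
    pack : Fin d × Fin e × Fin g → Fin (d * (e * g))
    pack (x , y) = Inverse.from *↔× (x , Inverse.from *↔× y)
    from-injective : ∀ {A B : Set} (I : A ↔ B) {x y} → Inverse.from I x ≡ Inverse.from I y → x ≡ y
    from-injective I {x} {y} h =
      trans (sym (Inverse.strictlyInverseˡ I x)) (trans (cong (Inverse.to I) h) (Inverse.strictlyInverseˡ I y))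
    to-injective : ∀ {A B : Set} (I : A ↔ B) {x y} → Inverse.to I x ≡ Inverse.to I y → x ≡ y
    to-injective I {x} {y} h =
      trans (sym (Inverse.strictlyInverseʳ I x)) (trans (cong (Inverse.from I) h) (Inverse.strictlyInverseʳ I y))
    pack-injective : ∀ {x y} → pack x ≡ pack y → x ≡ y
    pack-injective h with ,-injective (from-injective *↔× h)
    ... | h₁ , h₂ = cong₂ _,_ h₁ (from-injective *↔× h₂)
    unpack-injective : ∀ {x y} → unpack x ≡ unpack y → x ≡ y
    unpack-injective h with ,-injective h
    ... | h₁ , h₂ = to-injective *↔× (cong₂ _,_ h₁ (to-injective (*↔× {b} {c}) h₂))

  -- Both roots go to the same vertex of the same representative, so I followed by the inverse of J
  -- takes root to root and is an isomorphism of rooted trees.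
  place-injective : ∀ (ts : List Rooted) {s t} (i j : Fin (length ts))
    (I : toTree s ≅ toTree (lookup ts i)) (J : toTree t ≅ toTree (lookup ts j)) →
    i ≡ j → toℕ (_≅_.to I zero) ≡ toℕ (_≅_.to J zero) → s ~ t
  place-injective ts i .i I J refl e = iso⇒~ (≅⇒iso (≅-trans I (≅-sym J))
    (trans (cong (_≅_.from J) (toℕ-injective e)) (Inverse.strictlyInverseʳ (_≅_.bijection J) zero)))

  -- A rooted tree is determined by its class as an unrooted tree and the position of its
  -- root in the representative of that class.
  module _ (n : ℕ) {b k Γ} (tree : Fin b → Fin k → Fin k → Rooted) (slot : Fin b → Fin k → Fin k → Fin Γ)
    (mass≡n : ∀ β j₁ j₂ → mass (tree β j₁ j₂) ≡ n)
    (injective : ∀ β β′ j₁ j₁′ j₂ j₂′ → slot β j₁ j₂ ≡ slot β′ j₁′ j₂′ → tree β j₁ j₂ ~ tree β′ j₁′ j₂′ →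
                 β ≡ β′ × j₁ ≡ j₁′ × j₂ ≡ j₂′) where

    private
      module Place (t : Rooted) (mass≡n : mass t ≡ n) where
        found = represent n (toTree t) (trans (totalWeight-toTree t) mass≡n)
        class : Fin (length (representatives n))
        class = index found
        iso : toTree t ≅ toTree (lookup (representatives n) class)
        iso = lookup-index found
        size≤n : size (lookup (representatives n) class) ≤ n
        size≤n = ≤-trans (size≤mass (lookup (representatives n) class))
          (≤-reflexive (All.lookup (representatives-mass n) (∈-lookup {xs = representatives n} class)))
        position : Fin n
        position = inject≤ (_≅_.to iso zero) size≤n

      module At (β : Fin b) (j₁ j₂ : Fin k) = Place (tree β j₁ j₂) (mass≡n β j₁ j₂)

      image : Fin b × Fin k × Fin k → Fin (length (representatives n)) × Fin n × Fin Γ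
      image (β , j₁ , j₂) = At.class β j₁ j₂ , At.position β j₁ j₂ , slot β j₁ j₂

      image-injective : ∀ {x y} → image x ≡ image y → x ≡ y
      image-injective {β , j₁ , j₂} {β′ , j₁′ , j₂′} e = conclude (injective β β′ j₁ j₁′ j₂ j₂′ (cong (proj₂ ∘ proj₂) e)
        (place-injective (representatives n) I.class I′.class I.iso I′.iso (cong proj₁ e)
          (trans (sym (toℕ-inject≤ (_≅_.to I.iso zero) I.size≤n))
            (trans (cong (toℕ ∘ proj₁ ∘ proj₂) e) (toℕ-inject≤ (_≅_.to I′.iso zero) I′.size≤n)))))
        where
        module I = At β j₁ j₂
        module I′ = At β′ j₁′ j₂′
        conclude : β ≡ β′ × j₁ ≡ j₁′ × j₂ ≡ j₂′ → (β , j₁ , j₂) ≡ (β′ , j₁′ , j₂′)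
        conclude (refl , refl , refl) = refl

    place-≤ : b * (k * k) ≤ length (representatives n) * (n * Γ)
    place-≤ = injection-≤ image image-injective

  -- Two rooted trees with the same p and q can replace each other as branches; a vertex
  -- statistic f that tells them apart shows that the result is not isomorphic.
  module Switch (f : ℕ → ℕ) (σ σ′ : Rooted) (p≈ : p σ ≈ₚ p σ′) (q≈ : q σ ≈ₚ q σ′)
                (f≢ : vertices f σ ≢ vertices f σ′) where

    -- A decidable stand-in for being σ: it keeps exactly what the exchange by σ′ relies on, namely
    -- the polynomials, and the statistic that must change.
    Twin : Rooted → Set
    Twin s = vertices f s ≡ vertices f σ × p s ≈ₚ p σ × q s ≈ₚ q σ

    twin? : ∀ s → Dec (Twin s)
    twin? s = vertices f s ≟ vertices f σ ×-dec ≈ₚ? (p s) (p σ) ×-dec ≈ₚ? (q s) (q σ)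

    P : Rooted → Bool
    P s = does (twin? s)

    twin-cong : ∀ {s t} → s ~ t → Twin s → Twin t
    twin-cong {s} {t} e (a , b , c) = trans (sym (vertices-cong f e)) a
      , ≈ₚ-trans {p t} {p s} {p σ} (≈ₚ-sym {p s} {p t} (p-cong e)) b
      , ≈ₚ-trans {q t} {q s} {q σ} (≈ₚ-sym {q s} {q t} (q-cong e)) c

    P-cong : ∀ {s t} → s ~ t → P s ≡ P t
    P-cong {s} {t} e = does-⇔ (mk⇔ (twin-cong e) (twin-cong (~-sym e))) (twin? s) (twin? t)

    P-σ : P σ ≡ true
    P-σ = dec-true (twin? σ) (refl , (λ _ → refl) , λ _ → refl)

    P-mass : ∀ {s} → P s ≡ true → mass s ≡ mass σ
    P-mass {s} e = p-mass s σ (proj₁ (proj₂ (does-true (twin? s) e)))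

    -- A single branch is exchanged, so the statistic changes by the nonzero difference between σ′
    -- and σ; `change` states this without subtraction.
    record Switched (t : Rooted) : Set where
      field
        other  : Rooted
        p-same : p other ≈ₚ p t
        q-same : q other ≈ₚ q t
        change : vertices f other + vertices f σ ≡ vertices f t + vertices f σ′

    avoids⊎switched : ∀ t → Avoids P t ⊎ Switched t
    avoids⊎switched (node k) = inj₁ node
    avoids⊎switched (s ◃ t) with P s in eq
    ... | true = inj₂ record
      { other  = σ′ ◃ t
      ; p-same = ◃-cong-p {σ′} {s} {t} {t} p′ q′ (λ _ → refl) (λ _ → refl)
      ; q-same = ◃-cong-q {σ′} {s} {t} {t} p′ (λ _ → refl)
      ; change = trans (cong (vertices f σ′ + vertices f t +_) (sym a)) (rearrange (vertices f σ′) (vertices f t) (vertices f s)) }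
      where
      twin = does-true (twin? s) eq
      a = proj₁ twin
      b = proj₁ (proj₂ twin)
      c = proj₂ (proj₂ twin)
      p′ : p σ′ ≈ₚ p s
      p′ = ≈ₚ-sym {p s} {p σ′} (≈ₚ-trans {p s} {p σ} {p σ′} b p≈)
      q′ : q σ′ ≈ₚ q s
      q′ = ≈ₚ-sym {q s} {q σ′} (≈ₚ-trans {q s} {q σ} {q σ′} c q≈)
      rearrange : ∀ a b c → a + b + c ≡ c + b + a
      rearrange a b c = trans (+-comm (a + b) c) (trans (cong (c +_) (+-comm a b)) (sym (+-assoc c b a)))
    avoids⊎switched (s ◃ t) | false with avoids⊎switched s | avoids⊎switched t
    ... | inj₁ a | inj₁ b = inj₁ (graft eq a b)
    ... | inj₂ S | _ = inj₂ record
      { other  = S.other ◃ t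
      ; p-same = ◃-cong-p {S.other} {s} {t} {t} S.p-same S.q-same (λ _ → refl) (λ _ → refl)
      ; q-same = ◃-cong-q {S.other} {s} {t} {t} S.p-same (λ _ → refl)
      ; change = begin
          vertices f S.other + vertices f t + vertices f σ   ≡⟨ swap-last (vertices f S.other) _ _ ⟩
          vertices f S.other + vertices f σ + vertices f t   ≡⟨ cong (_+ vertices f t) S.change ⟩
          vertices f s + vertices f σ′ + vertices f t        ≡⟨ swap-last (vertices f s) _ _ ⟩
          vertices f s + vertices f t + vertices f σ′        ∎ }
      where
      module S = Switched S
      open ≡-Reasoning
      swap-last : ∀ a b c → a + b + c ≡ a + c + b
      swap-last a b c = trans (+-assoc a b c) (trans (cong (a +_) (+-comm b c)) (sym (+-assoc a c b)))
    ... | inj₁ _ | inj₂ T = inj₂ record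
      { other  = s ◃ T.other
      ; p-same = ◃-cong-p {s} {s} {T.other} {t} (λ _ → refl) (λ _ → refl) T.p-same T.q-same
      ; q-same = ◃-cong-q {s} {s} {T.other} {t} (λ _ → refl) T.q-same
      ; change = trans (+-assoc (vertices f s) _ _) (trans (cong (vertices f s +_) T.change) (sym (+-assoc (vertices f s) _ _))) }
      where module T = Switched T

    -- The predecessor appears because f reads labels, while `toTree` stores weights.
    vertices-iso : ∀ {s t} → toTree s ≅ toTree t → vertices f s ≡ vertices f t
    vertices-iso {s} {t} I = trans (sym (sum-labels f s)) (trans (sum-weights-cong (f ∘ pred) I) (sum-labels f t))

    switched-mate : ∀ {t} → Switched t → HasCospectralMate (toTree t)
    switched-mate {t} S = toTree other , cospectral t other (≈ₚ-sym {p other} {p t} p-same) ,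
      λ I → f≢ (+-cancelˡ-≡ (vertices f t) _ _ (trans (cong (_+ vertices f σ) (vertices-iso {t} {other} I)) change))
      where open Switched S

    avoids : ∀ {t} → ¬ HasCospectralMate (toTree t) → Avoids P t
    avoids {t} n with avoids⊎switched t
    ... | inj₁ a = a
    ... | inj₂ S = ⊥-elim (n (switched-mate S))

    open Encoding σ P P-cong P-σ (λ {s} → P-mass {s})

    module Bound (n : ℕ) (n-big : 2 * M < n) where

      private
        k = n / K

        module At (β : Fin (length (bad n))) where
          tree : Rooted
          tree = lookup (bad n) β
          mass≡n : mass tree ≡ n
          mass≡n = All.lookup (All.filter⁺ (¬? ∘ mate?) (representatives-mass n)) (∈-lookup {xs = bad n} β)
          no-mate : ¬ HasCospectralMate (toTree tree)
          no-mate = All.lookup (All.all-filter (¬? ∘ mate?) (representatives n)) (∈-lookup {xs = bad n} β)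

        abstract
          codeOf : ∀ β (j₁ j₂ : Fin k) → Code (At.tree β) (toℕ j₁) (toℕ j₂)
          codeOf β j₁ j₂ = encode (avoids no-mate) (subst (2 * M <_) (sym mass≡n) n-big) (toℕ j₁) (toℕ j₂)
            (subst (λ m → toℕ j₁ < m / K) (sym mass≡n) (toℕ<n j₁))
            (subst (λ m → toℕ j₂ < m / K) (sym mass≡n) (toℕ<n j₂))
            where open At β

      bad-few : length (bad n) * (k * k) ≤ length (representatives n) * (n * Γ)
      bad-few = place-≤ n (λ β j₁ j₂ → Code.code (codeOf β j₁ j₂)) (λ β j₁ j₂ → Code.slot (codeOf β j₁ j₂))
        (λ β j₁ j₂ → trans (Code.mass≡ (codeOf β j₁ j₂)) (At.mass≡n β))
        (λ β β′ j₁ j₁′ j₂ j₂′ e e′ → conclude β β′ j₁ j₁′ j₂ j₂′ (code-injective (codeOf β j₁ j₂) (codeOf β′ j₁′ j₂′) e e′))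
        where
        conclude : ∀ β β′ (j₁ j₁′ j₂ j₂′ : Fin k) → At.tree β ~ At.tree β′ × toℕ j₁ ≡ toℕ j₁′ × toℕ j₂ ≡ toℕ j₂′ →
                   β ≡ β′ × j₁ ≡ j₁′ × j₂ ≡ j₂′
        conclude β β′ j₁ j₁′ j₂ j₂′ (e , e₁ , e₂) =
            distinct-lookup (AllPairs-filter⁺ (¬? ∘ mate?) (representatives-distinct n)) β β′ (iso⇒≅ (~⇒iso e))
          , toℕ-injective e₁ , toℕ-injective e₂

    nonempty : ∀ n → 1 ≤ n → 0 < length (representatives n)
    nonempty (suc n) _ with representatives (suc n) | represent (suc n) (toTree (node n)) (totalWeight-toTree (node n))
    ... | _ ∷ _ | _ = s≤s z≤n

    proportion : ℕ → ℚ
    -- An arbitrary value: no tree has total weight 0, and proportions are claimed from weight 1 on.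
    proportion zero = 0ℚ
    proportion (suc n) = (ℤ.+ length (good (suc n))) ℚ./ length (representatives (suc n))
      where instance _ = >-nonZero (nonempty (suc n) (s≤s z≤n))

    isProportion : ∀ n → 1 ≤ n → IsProportion weightedTrees (λ W → totalWeight W ≡ n) HasCospectralMate (proportion n)
    isProportion (suc n) _ = record
      { total = length (representatives (suc n))
      ; favourable = length (good (suc n))
      ; nonZero = >-nonZero (nonempty (suc n) (s≤s z≤n))
      ; |P| = all-trees (suc n)
      ; |P∧Q| = trees-with-mate (suc n)
      ; ratio = refl
      }

    limit : proportion ⟶ 1ℚ
    -- Beyond N₁ the inequality `sparse` yields b d < t; beyond 2 M a tree is massive enough to be
    -- decomposed.
    limit ε ε>0 = suc (N₁ + 2 * M) , close
      where
      d = ℚ.denominatorℕ ε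
      N₁ = suc (2 * K * Γ * d) * K
      close : ∀ n → suc (N₁ + 2 * M) ≤ n → ℚ.∣ proportion n ℚ.- 1ℚ ∣ ℚ.< ε
      close (suc n) big = close-to-1 (length (good (suc n))) b t {{>-nonZero t>0}} ε ε>0
        (length-filters mate? (representatives (suc n)))
        (sparse K Γ d (suc n) b t (≤-trans (m≤m+n N₁ (2 * M)) (≤-trans (n≤1+n _) big)) t>0
          (Bound.bad-few (suc n) (<-≤-trans (s≤s (m≤n+m (2 * M) N₁)) big)))
        where
        b = length (bad (suc n))
        t = length (representatives (suc n))
        t>0 = nonempty (suc n) (s≤s z≤n)

-- Two exchangeable branches of weight 21

open import Data.Nat.Properties using (_≟_)
open RootedTrees using (Rooted; node; _◃_)
open CharacteristicPolynomials using (p; q)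
open Degrees using (≈ₚ?)

pendant : ℕ → ℕ → Rooted
pendant a b = node (pred b) ◃ node (pred a)

-- A pendant edge with weights a, b has p = x^(a+b) − 1 and q = x^b, and branches hung from a
-- common vertex enter p and q only through the product of their p and the sum of their q / p.
-- So the identity
--   x/(x⁴−1) + x²/(x⁸−1) + x⁶/(x⁸−1) = x²/(x⁴−1) + x/(x⁸−1) + x⁵/(x⁸−1)
-- shows that σ and σ′ have the same p and q, although only σ′ has a vertex of weight 7.
σ σ′ : Rooted
σ  = pendant 3 1 ◃ pendant 6 2 ◃ pendant 2 6 ◃ node 0
σ′ = pendant 2 2 ◃ pendant 7 1 ◃ pendant 3 5 ◃ node 0

-- Label 6 is weight 7. Such a vertex occurs once in σ′ and not at all in σ.
isSeven : ℕ → ℕ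
isSeven k = if does (k ≟ 6) then 1 else 0

module Twins = Mates.Switch isSeven σ σ′
  -- These are equalities between closed polynomials, verified by evaluating the decision procedure.
  (toWitness {a? = ≈ₚ? (p σ) (p σ′)} _) (toWitness {a? = ≈ₚ? (q σ) (q σ′)} _) (λ ())

theorem8p6 : ∃[ r ] (∀ n → 1 ≤ n → IsProportion weightedTrees (λ W → totalWeight W ≡ n) HasCospectralMate (r n)) × (r ⟶ 1ℚ)
theorem8p6 = Twins.proportion , Twins.isProportion , Twins.limit
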